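{- There are absolute constants $c>0$ and $C\ge 0$ such that for every finite convex set $A\subset\mathbb{R}$ with $|A|\ge 2$, \[ |A-A|\ge c\,\frac{|A|^{8/5}}{(\log|A|)^{C}}. \]
   Context: A finite set $A=\{a_1<a_2<\dots<a_k\}\subset\mathbb{R}$ is convex if $a_i-a_{i-1}<a_{i+1}-a_i$ for all $1<i<k$. $A-A=\{a-b:a,b\in A\}$. -}

module Defs where

open import Data.Empty using (⊥-elim)
open import Data.Fin.Base using (Fin; toℕ)
import Data.Fin.Base as Fin
import Data.Integer.Base as ℤ
import Data.Integer.Properties as ℤₚ
open import Data.Nat.Base as ℕ using (ℕ; zero; suc; s≤s; z≤n)
import Data.Nat.Properties as ℕₚ
open import Data.Product.Base using (∃-syntax; _×_; _,_; proj₁; proj₂)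
open import Data.Rational.Base
  using (ℚ; 0ℚ; 1ℚ; ½; _+_; _*_; _-_; -_; _/_; ∣_∣; _≤_; _<_; 1/_; mkℚ;
         positive; nonNegative; ≢-nonZero; +-*-rawSemiring; toℚᵘ; *<*)
open import Data.Rational.Properties as ℚₚ using (≤-refl; ≤-trans; ≤-reflexive; <⇒≤; _≟_)
open import Data.Rational.Solver using (module +-*-Solver)
import Data.Rational.Unnormalised.Base as ℚᵘ
import Data.Rational.Unnormalised.Properties as ℚᵘₚ
open import Data.Sum.Base using (_⊎_; inj₁; inj₂)
open import Function.Bundles using (_⇔_)
open import Relation.Binary.PropositionalEquality
  using (_≡_; refl; sym; trans; cong; cong₂; subst; subst₂)
open import Relation.Nullary using (¬_; yes; no)
open import Algebra.Bundles using (CommutativeRing)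
open import Algebra.Definitions.RawSemiring +-*-rawSemiring
  using (_^_)
open import Algebra.Properties.Semiring.Exp (CommutativeRing.semiring ℚₚ.+-*-commutativeRing)
  using (^-homo-*; ^-assocʳ)

open +-*-Solver using (solve; _:=_; _:+_; _:*_; _:-_; :-_; con)
open ℚₚ.≤-Reasoning

ι : ℕ → ℚ
ι n = ℤ.+ n / 1

h : ℕ → ℚ
h n = ½ ^ n

-- 1/q, with the junk value 0 at q = 0
inv : ℚ → ℚ
inv q with q ≟ 0ℚ
... | yes _   = 0ℚ
... | no  q≢0 = (1/ q) {{≢-nonZero q≢0}}

∑< : ℕ → (ℕ → ℚ) → ℚ
∑< zero    f = 0ℚ
∑< (suc n) f = ∑< n f + f n

0<1 : 0ℚ < 1ℚ
0<1 = ℚₚ.positive⁻¹ 1ℚ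

0≤1 : 0ℚ ≤ 1ℚ
0≤1 = <⇒≤ 0<1

0<½ : 0ℚ < ½
0<½ = ℚₚ.positive⁻¹ ½

0≤½ : 0ℚ ≤ ½
0≤½ = <⇒≤ 0<½

*-monoˡ : ∀ {r p q} → 0ℚ ≤ r → p ≤ q → r * p ≤ r * q
*-monoˡ {r} 0≤r = ℚₚ.*-monoˡ-≤-nonNeg r {{nonNegative 0≤r}}

*-monoʳ : ∀ {r p q} → 0ℚ ≤ r → p ≤ q → p * r ≤ q * r
*-monoʳ {r} 0≤r = ℚₚ.*-monoʳ-≤-nonNeg r {{nonNegative 0≤r}}

*-mono : ∀ {p q r s} → 0ℚ ≤ r → 0ℚ ≤ q → p ≤ q → r ≤ s → p * r ≤ q * s
*-mono 0≤r 0≤q p≤q r≤s = ≤-trans (*-monoʳ 0≤r p≤q) (*-monoˡ 0≤q r≤s)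

0≤* : ∀ {p q} → 0ℚ ≤ p → 0ℚ ≤ q → 0ℚ ≤ p * q
0≤* {p} {q} 0≤p 0≤q = begin
  0ℚ     ≡⟨ ℚₚ.*-zeroʳ p ⟨
  p * 0ℚ ≤⟨ *-monoˡ 0≤p 0≤q ⟩
  p * q  ∎

0<* : ∀ {p q} → 0ℚ < p → 0ℚ < q → 0ℚ < p * q
0<* {p} {q} 0<p 0<q = begin-strict
  0ℚ     ≡⟨ ℚₚ.*-zeroʳ p ⟨
  p * 0ℚ <⟨ ℚₚ.*-monoʳ-<-pos p {{positive 0<p}} 0<q ⟩
  p * q  ∎

0≤+ : ∀ {p q} → 0ℚ ≤ p → 0ℚ ≤ q → 0ℚ ≤ p + q
0≤+ = ℚₚ.+-mono-≤

0<+ : ∀ {p q} → 0ℚ < p → 0ℚ ≤ q → 0ℚ < p + q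
0<+ = ℚₚ.+-mono-<-≤

p≤p+q : ∀ {p q} → 0ℚ ≤ q → p ≤ p + q
p≤p+q {p} {q} 0≤q = begin
  p      ≡⟨ ℚₚ.+-identityʳ p ⟨
  p + 0ℚ ≤⟨ ℚₚ.+-monoʳ-≤ p 0≤q ⟩
  p + q  ∎

p≤q+p : ∀ {p q} → 0ℚ ≤ q → p ≤ q + p
p≤q+p {p} {q} 0≤q = subst (p ≤_) (ℚₚ.+-comm p q) (p≤p+q 0≤q)

-‿≤ : ∀ {p q} → p ≤ q → 0ℚ ≤ q - p
-‿≤ {p} {q} p≤q = begin
  0ℚ    ≡⟨ ℚₚ.+-inverseʳ p ⟨
  p - p ≤⟨ ℚₚ.+-monoˡ-≤ (- p) p≤q ⟩
  q - p ∎

p-q≤p : ∀ {p q} → 0ℚ ≤ q → p - q ≤ p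
p-q≤p {p} {q} 0≤q = begin
  p - q       ≤⟨ p≤p+q 0≤q ⟩
  p - q + q   ≡⟨ solve 2 (λ p q → p :- q :+ q := p) refl p q ⟩
  p           ∎

∣-∣-swap : ∀ p q → ∣ p - q ∣ ≡ ∣ q - p ∣
∣-∣-swap p q = trans (sym (ℚₚ.∣-p∣≡∣p∣ (p - q)))
  (cong ∣_∣ (solve 2 (λ p q → :- (p :- q) := q :- p) refl p q))

∣-∣-triangle : ∀ p q r → ∣ p - r ∣ ≤ ∣ p - q ∣ + ∣ q - r ∣
∣-∣-triangle p q r = subst (λ t → ∣ t ∣ ≤ ∣ p - q ∣ + ∣ q - r ∣)
  (solve 3 (λ p q r → (p :- q) :+ (q :- r) := p :- r) refl p q r)
  (ℚₚ.∣p+q∣≤∣p∣+∣q∣ (p - q) (q - r))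

p≤∣p∣ : ∀ p → p ≤ ∣ p ∣
p≤∣p∣ p with ℚₚ.≤-total 0ℚ p
... | inj₁ 0≤p = ≤-reflexive (sym (ℚₚ.0≤p⇒∣p∣≡p 0≤p))
... | inj₂ p≤0 = ≤-trans p≤0 (ℚₚ.0≤∣p∣ p)

∣p∣≤q+∣p-q∣ : ∀ p q → ∣ p ∣ ≤ ∣ q ∣ + ∣ p - q ∣
∣p∣≤q+∣p-q∣ p q = subst (λ t → ∣ t ∣ ≤ ∣ q ∣ + ∣ p - q ∣)
  (solve 2 (λ p q → q :+ (p :- q) := p) refl p q)
  (ℚₚ.∣p+q∣≤∣p∣+∣q∣ q (p - q))

ι-suc : ∀ n → ι (suc n) ≡ 1ℚ + ι n
ι-suc n = ℚₚ.toℚᵘ-injective (ℚᵘₚ.≃-trans (ℚₚ.toℚᵘ-fromℚᵘ (ℚᵘ.mkℚᵘ (ℤ.+ suc n) 0))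
  (ℚᵘₚ.≃-sym (ℚᵘₚ.≃-trans (ℚₚ.toℚᵘ-homo-+ 1ℚ (ι n))
    (ℚᵘₚ.≃-trans (ℚᵘₚ.+-congʳ ℚᵘ.1ℚᵘ (ℚₚ.toℚᵘ-fromℚᵘ (ℚᵘ.mkℚᵘ (ℤ.+ n) 0)))
      (ℚᵘ.*≡* (cong (λ z → (ℤ.+ 1 ℤ.+ z) ℤ.* ℤ.+ 1) (ℤₚ.*-identityʳ (ℤ.+ n))))))))

ι-+ : ∀ m n → ι (m ℕ.+ n) ≡ ι m + ι n
ι-+ zero    n = sym (ℚₚ.+-identityˡ (ι n))
ι-+ (suc m) n = begin-equality
  ι (suc (m ℕ.+ n))  ≡⟨ ι-suc (m ℕ.+ n) ⟩
  1ℚ + ι (m ℕ.+ n)   ≡⟨ cong (1ℚ +_) (ι-+ m n) ⟩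
  1ℚ + (ι m + ι n)   ≡⟨ ℚₚ.+-assoc 1ℚ (ι m) (ι n) ⟨
  1ℚ + ι m + ι n     ≡⟨ cong (_+ ι n) (ι-suc m) ⟨
  ι (suc m) + ι n    ∎

0≤ι : ∀ n → 0ℚ ≤ ι n
0≤ι zero    = ≤-refl
0≤ι (suc n) = subst (0ℚ ≤_) (sym (ι-suc n)) (0≤+ 0≤1 (0≤ι n))

ι-mono : ∀ {m n} → m ℕ.≤ n → ι m ≤ ι n
ι-mono {m} {n} m≤n = begin
  ι m                ≤⟨ p≤p+q (0≤ι (n ℕ.∸ m)) ⟩
  ι m + ι (n ℕ.∸ m)  ≡⟨ ι-+ m (n ℕ.∸ m) ⟨
  ι (m ℕ.+ (n ℕ.∸ m)) ≡⟨ cong ι (ℕₚ.m+[n∸m]≡n m≤n) ⟩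
  ι n                ∎

ι-double : ∀ n → ι (2 ℕ.* n) ≡ ι n + ι n
ι-double n = trans (ι-+ n (n ℕ.+ 0)) (cong (λ k → ι n + ι k) (ℕₚ.+-identityʳ n))

0<h : ∀ n → 0ℚ < h n
0<h zero    = 0<1
0<h (suc n) = 0<* 0<½ (0<h n)

0≤h : ∀ n → 0ℚ ≤ h n
0≤h n = <⇒≤ (0<h n)

½+½ : ∀ q → ½ * q + ½ * q ≡ q
½+½ q = solve 1 (λ q → con ½ :* q :+ con ½ :* q := q) refl q

ι2^*h : ∀ n → ι (2 ℕ.^ n) * h n ≡ 1ℚ
ι2^*h zero    = refl
ι2^*h (suc n) = begin-equality
  ι (2 ℕ.* 2 ℕ.^ n) * (½ * h n)        ≡⟨ cong (_* (½ * h n)) (ι-double (2 ℕ.^ n)) ⟩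
  (ι (2 ℕ.^ n) + ι (2 ℕ.^ n)) * (½ * h n)
    ≡⟨ solve 2 (λ a b → (a :+ a) :* (con ½ :* b) := a :* b) refl (ι (2 ℕ.^ n)) (h n) ⟩
  ι (2 ℕ.^ n) * h n                    ≡⟨ ι2^*h n ⟩
  1ℚ                                   ∎

h-anti : ∀ {m n} → m ℕ.≤ n → h n ≤ h m
h-anti {m} {n} m≤n = subst (λ k → h k ≤ h m) (ℕₚ.m∸n+n≡m m≤n) (go (n ℕ.∸ m))
  where
  go : ∀ d → h (d ℕ.+ m) ≤ h m
  go zero    = ≤-refl
  go (suc d) = begin
    ½ * h (d ℕ.+ m)                       ≤⟨ p≤p+q (0≤* 0≤½ (0≤h (d ℕ.+ m))) ⟩
    ½ * h (d ℕ.+ m) + ½ * h (d ℕ.+ m)     ≡⟨ ½+½ (h (d ℕ.+ m)) ⟩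
    h (d ℕ.+ m)                           ≤⟨ go d ⟩
    h m                                   ∎

inv-inverse : ∀ {q} → 0ℚ < q → q * inv q ≡ 1ℚ
inv-inverse {q} 0<q with q ≟ 0ℚ
... | yes q≡0 = ⊥-elim (ℚₚ.<⇒≢ 0<q (sym q≡0))
... | no  q≢0 = ℚₚ.*-inverseʳ q {{≢-nonZero q≢0}}

0<inv : ∀ {q} → 0ℚ < q → 0ℚ < inv q
0<inv {q} 0<q = ℚₚ.*-cancelˡ-<-nonNeg q {{nonNegative (<⇒≤ 0<q)}}
  (subst₂ _<_ (sym (ℚₚ.*-zeroʳ q)) (sym (inv-inverse 0<q)) 0<1)

inv-anti : ∀ {p q} → 0ℚ < p → p ≤ q → inv q ≤ inv p
inv-anti {p} {q} 0<p p≤q = begin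
  inv q                ≡⟨ ℚₚ.*-identityʳ (inv q) ⟨
  inv q * 1ℚ           ≡⟨ cong (inv q *_) (inv-inverse 0<p) ⟨
  inv q * (p * inv p)  ≤⟨ *-monoˡ (<⇒≤ (0<inv 0<q)) (*-monoʳ (<⇒≤ (0<inv 0<p)) p≤q) ⟩
  inv q * (q * inv p)  ≡⟨ solve 3 (λ a b c → a :* (b :* c) := b :* a :* c) refl (inv q) q (inv p) ⟩
  q * inv q * inv p    ≡⟨ cong (_* inv p) (inv-inverse 0<q) ⟩
  1ℚ * inv p           ≡⟨ ℚₚ.*-identityˡ (inv p) ⟩
  inv p                ∎
  where
  0<q : 0ℚ < q
  0<q = ℚₚ.<-≤-trans 0<p p≤q

-- x/a - y/b = (x b - y a)/(a b)
frac-sub : ∀ {x y a b} → 0ℚ < a → 0ℚ < b →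
  x * inv a - y * inv b ≡ inv a * inv b * (x * b - y * a)
frac-sub {x} {y} {a} {b} 0<a 0<b = begin-equality
  x * inv a - y * inv b
    ≡⟨ cong₂ _-_ (ℚₚ.*-identityʳ (x * inv a)) (ℚₚ.*-identityʳ (y * inv b)) ⟨
  x * inv a * 1ℚ - y * inv b * 1ℚ
    ≡⟨ cong₂ (λ s t → x * inv a * s - y * inv b * t) (inv-inverse 0<b) (inv-inverse 0<a) ⟨
  x * inv a * (b * inv b) - y * inv b * (a * inv a)
    ≡⟨ solve 6 (λ x y a b i j → x :* i :* (b :* j) :- y :* j :* (a :* i)
                 := i :* j :* (x :* b :- y :* a)) refl x y a b (inv a) (inv b) ⟩
  inv a * inv b * (x * b - y * a) ∎

frac-bound : ∀ {x y a b δ} → 0ℚ < δ → δ ≤ a → δ ≤ b →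
  ∣ x * inv a - y * inv b ∣ ≤ inv δ * inv δ * ∣ x * b - y * a ∣
frac-bound {x} {y} {a} {b} {δ} 0<δ δ≤a δ≤b = begin
  ∣ x * inv a - y * inv b ∣            ≡⟨ cong ∣_∣ (frac-sub {x} {y} 0<a 0<b) ⟩
  ∣ inv a * inv b * (x * b - y * a) ∣  ≡⟨ ℚₚ.∣p*q∣≡∣p∣*∣q∣ (inv a * inv b) (x * b - y * a) ⟩
  ∣ inv a * inv b ∣ * ∣ x * b - y * a ∣
    ≡⟨ cong (_* ∣ x * b - y * a ∣) (ℚₚ.0≤p⇒∣p∣≡p (0≤* (<⇒≤ (0<inv 0<a)) (<⇒≤ (0<inv 0<b)))) ⟩
  inv a * inv b * ∣ x * b - y * a ∣
    ≤⟨ *-monoʳ (ℚₚ.0≤∣p∣ (x * b - y * a))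
         (*-mono (<⇒≤ (0<inv 0<b)) (<⇒≤ (0<inv 0<δ)) (inv-anti 0<δ δ≤a) (inv-anti 0<δ δ≤b)) ⟩
  inv δ * inv δ * ∣ x * b - y * a ∣    ∎
  where
  0<a : 0ℚ < a
  0<a = ℚₚ.<-≤-trans 0<δ δ≤a
  0<b : 0ℚ < b
  0<b = ℚₚ.<-≤-trans 0<δ δ≤b

n≤2^n : ∀ n → n ℕ.≤ 2 ℕ.^ n
n≤2^n zero    = z≤n
n≤2^n (suc n) = ℕₚ.≤-trans (ℕₚ.+-mono-≤ (ℕₚ.m^n>0 2 n) (n≤2^n n))
  (ℕₚ.+-monoʳ-≤ (2 ℕ.^ n) (ℕₚ.≤-reflexive (sym (ℕₚ.+-identityʳ (2 ℕ.^ n)))))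

-- every positive rational a/d is at least 1/d ≥ 1/2ᵈ
archimedean : ∀ {ε} → 0ℚ < ε → ∃[ N ] h N ≤ ε
archimedean {ε@(mkℚ a d _)} 0<ε = suc d , (begin
  h (suc d)                     ≡⟨ ℚₚ.*-identityʳ (h (suc d)) ⟨
  h (suc d) * 1ℚ                ≤⟨ *-monoˡ (0≤h (suc d)) 1≤ε*N ⟩
  h (suc d) * (ε * ι (2 ℕ.^ suc d))
    ≡⟨ solve 3 (λ a b c → a :* (b :* c) := b :* (c :* a)) refl (h (suc d)) ε (ι (2 ℕ.^ suc d)) ⟩
  ε * (ι (2 ℕ.^ suc d) * h (suc d)) ≡⟨ cong (ε *_) (ι2^*h (suc d)) ⟩
  ε * 1ℚ                        ≡⟨ ℚₚ.*-identityʳ ε ⟩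
  ε                             ∎)
  where
  -- a/d · d = a ≥ 1
  ε*d : toℚᵘ (ε * ι (suc d)) ℚᵘ.≃ ℚᵘ.mkℚᵘ a 0
  ε*d = ℚᵘₚ.≃-trans (ℚₚ.toℚᵘ-homo-* ε (ι (suc d)))
    (ℚᵘₚ.≃-trans (ℚᵘₚ.*-congˡ {toℚᵘ ε} (ℚₚ.toℚᵘ-fromℚᵘ (ℚᵘ.mkℚᵘ (ℤ.+ suc d) 0)))
      (ℚᵘ.*≡* (trans (ℤₚ.*-identityʳ _) (cong (a ℤ.*_) (sym (cong (λ k → ℤ.+ k) (ℕₚ.*-identityʳ (suc d))))))))
  1≤a : ℚᵘ.1ℚᵘ ℚᵘ.≤ ℚᵘ.mkℚᵘ a 0
  1≤a = ℚᵘ.*≤* (subst₂ ℤ._≤_ refl (sym (ℤₚ.*-identityʳ a))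
    (ℤₚ.i<j⇒suc[i]≤j (subst (ℤ.+ 0 ℤ.<_) (ℤₚ.*-identityʳ a) (ℚₚ.drop-*<* 0<ε))))
  1≤ε*d : 1ℚ ≤ ε * ι (suc d)
  1≤ε*d = ℚₚ.toℚᵘ-cancel-≤ (ℚᵘₚ.≤-trans 1≤a (ℚᵘₚ.≤-reflexive (ℚᵘₚ.≃-sym ε*d)))
  1≤ε*N : 1ℚ ≤ ε * ι (2 ℕ.^ suc d)
  1≤ε*N = ≤-trans 1≤ε*d (*-monoˡ (<⇒≤ 0<ε) (ι-mono (n≤2^n (suc d))))

∑<-mono : ∀ n {f g} → (∀ j → j ℕ.< n → f j ≤ g j) → ∑< n f ≤ ∑< n g
∑<-mono zero    f≤g = ≤-refl
∑<-mono (suc n) f≤g = ℚₚ.+-mono-≤ (∑<-mono n (λ j j<n → f≤g j (ℕₚ.m<n⇒m<1+n j<n)))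
                                  (f≤g n ℕₚ.≤-refl)

∑<-const : ∀ n c → ∑< n (λ _ → c) ≡ ι n * c
∑<-const zero    c = sym (ℚₚ.*-zeroˡ c)
∑<-const (suc n) c = begin-equality
  ∑< n (λ _ → c) + c  ≡⟨ cong (_+ c) (∑<-const n c) ⟩
  ι n * c + c         ≡⟨ solve 2 (λ a c → a :* c :+ c := (con 1ℚ :+ a) :* c) refl (ι n) c ⟩
  (1ℚ + ι n) * c      ≡⟨ cong (_* c) (ι-suc n) ⟨
  ι (suc n) * c       ∎

∑<-∣-∣ : ∀ n {f g c} → (∀ j → j ℕ.< n → ∣ f j - g j ∣ ≤ c) → ∣ ∑< n f - ∑< n g ∣ ≤ ι n * c
∑<-∣-∣ n {f} {g} {c} f-g≤c = ≤-trans (go n f-g≤c) (≤-reflexive (∑<-const n c))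
  where
  go : ∀ n → (∀ j → j ℕ.< n → ∣ f j - g j ∣ ≤ c) → ∣ ∑< n f - ∑< n g ∣ ≤ ∑< n (λ _ → c)
  go zero    _  = ≤-refl
  go (suc n) le = begin
    ∣ (∑< n f + f n) - (∑< n g + g n) ∣
      ≡⟨ cong ∣_∣ (solve 4 (λ a b c d → (a :+ b) :- (c :+ d) := (a :- c) :+ (b :- d)) refl
           (∑< n f) (f n) (∑< n g) (g n)) ⟩
    ∣ (∑< n f - ∑< n g) + (f n - g n) ∣  ≤⟨ ℚₚ.∣p+q∣≤∣p∣+∣q∣ (∑< n f - ∑< n g) (f n - g n) ⟩
    ∣ ∑< n f - ∑< n g ∣ + ∣ f n - g n ∣
      ≤⟨ ℚₚ.+-mono-≤ (go n (λ j j<n → le j (ℕₚ.m<n⇒m<1+n j<n))) (le n ℕₚ.≤-refl) ⟩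
    ∑< n (λ _ → c) + c                   ∎

∑<-double : ∀ n f → ∑< (2 ℕ.* n) f ≡ ∑< n (λ j → f (2 ℕ.* j) + f (suc (2 ℕ.* j)))
∑<-double zero    f = refl
∑<-double (suc n) f = begin-equality
  ∑< (2 ℕ.* suc n) f                             ≡⟨ cong (λ k → ∑< k f) (ℕₚ.*-suc 2 n) ⟩
  ∑< (2 ℕ.* n) f + f (2 ℕ.* n) + f (suc (2 ℕ.* n))
    ≡⟨ ℚₚ.+-assoc (∑< (2 ℕ.* n) f) (f (2 ℕ.* n)) (f (suc (2 ℕ.* n))) ⟩
  ∑< (2 ℕ.* n) f + (f (2 ℕ.* n) + f (suc (2 ℕ.* n)))
    ≡⟨ cong (_+ (f (2 ℕ.* n) + f (suc (2 ℕ.* n)))) (∑<-double n f) ⟩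
  ∑< (suc n) (λ j → f (2 ℕ.* j) + f (suc (2 ℕ.* j))) ∎

0≤^ : ∀ {x} n → 0ℚ ≤ x → 0ℚ ≤ x ^ n
0≤^ zero    0≤x = 0≤1
0≤^ (suc n) 0≤x = 0≤* 0≤x (0≤^ n 0≤x)

^-mono : ∀ {x y} n → 0ℚ ≤ x → x ≤ y → x ^ n ≤ y ^ n
^-mono zero    0≤x x≤y = ≤-refl
^-mono (suc n) 0≤x x≤y = *-mono (0≤^ n 0≤x) (≤-trans 0≤x x≤y) x≤y (^-mono n 0≤x x≤y)

∣^∣ : ∀ x n → ∣ x ^ n ∣ ≡ ∣ x ∣ ^ n
∣^∣ x zero    = refl
∣^∣ x (suc n) = trans (ℚₚ.∣p*q∣≡∣p∣*∣q∣ x (x ^ n)) (cong (∣ x ∣ *_) (∣^∣ x n))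

^-∣-∣ : ∀ n {a b M} → 1ℚ ≤ M → ∣ a ∣ ≤ M → ∣ b ∣ ≤ M →
  ∣ a ^ n - b ^ n ∣ ≤ ι n * ∣ a - b ∣ * M ^ n
^-∣-∣ zero    {a} {b} {M} 1≤M a≤M b≤M =
  ≤-reflexive (solve 1 (λ d → con 0ℚ := con 0ℚ :* d :* con 1ℚ) refl ∣ a - b ∣)
^-∣-∣ (suc n) {a} {b} {M} 1≤M a≤M b≤M = begin
  ∣ a * a ^ n - b * b ^ n ∣
    ≡⟨ cong ∣_∣ (solve 4 (λ a b x y → a :* x :- b :* y := a :* (x :- y) :+ (a :- b) :* y) refl
         a b (a ^ n) (b ^ n)) ⟩
  ∣ a * (a ^ n - b ^ n) + (a - b) * b ^ n ∣
    ≤⟨ ℚₚ.∣p+q∣≤∣p∣+∣q∣ (a * (a ^ n - b ^ n)) ((a - b) * b ^ n) ⟩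
  ∣ a * (a ^ n - b ^ n) ∣ + ∣ (a - b) * b ^ n ∣
    ≡⟨ cong₂ _+_ (ℚₚ.∣p*q∣≡∣p∣*∣q∣ a (a ^ n - b ^ n))
         (trans (ℚₚ.∣p*q∣≡∣p∣*∣q∣ (a - b) (b ^ n)) (cong (∣ a - b ∣ *_) (∣^∣ b n))) ⟩
  ∣ a ∣ * ∣ a ^ n - b ^ n ∣ + d * ∣ b ∣ ^ n
    ≤⟨ ℚₚ.+-mono-≤
         (*-mono (ℚₚ.0≤∣p∣ (a ^ n - b ^ n)) 0≤M a≤M (^-∣-∣ n 1≤M a≤M b≤M))
         (*-monoˡ (ℚₚ.0≤∣p∣ (a - b))
           (≤-trans (^-mono n (ℚₚ.0≤∣p∣ b) b≤M) Mⁿ≤Mⁿ⁺¹)) ⟩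
  M * (ι n * d * M ^ n) + d * (M * M ^ n)
    ≡⟨ solve 4 (λ M i d x → M :* (i :* d :* x) :+ d :* (M :* x)
                 := (con 1ℚ :+ i) :* d :* (M :* x)) refl M (ι n) d (M ^ n) ⟩
  (1ℚ + ι n) * d * (M * M ^ n)   ≡⟨ cong (λ t → t * d * (M * M ^ n)) (ι-suc n) ⟨
  ι (suc n) * d * (M * M ^ n)    ∎
  where
  d : ℚ
  d = ∣ a - b ∣
  0≤M : 0ℚ ≤ M
  0≤M = ≤-trans 0≤1 1≤M
  Mⁿ≤Mⁿ⁺¹ : M ^ n ≤ M * M ^ n
  Mⁿ≤Mⁿ⁺¹ = begin
    M ^ n       ≡⟨ ℚₚ.*-identityˡ (M ^ n) ⟨
    1ℚ * M ^ n  ≤⟨ *-monoʳ (0≤^ n 0≤M) 1≤M ⟩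
    M * M ^ n   ∎

^-upper : ∀ m {u} → 0ℚ ≤ u → ι m * u ≤ ½ → (1ℚ + u) ^ m ≤ 1ℚ + 1ℚ
^-upper m {u} 0≤u mu≤½ = begin
  y                       ≡⟨ solve 1 (λ y → y := (con 1ℚ :+ con 1ℚ) :* (y :* con ½)) refl y ⟩
  (1ℚ + 1ℚ) * (y * ½)     ≤⟨ *-monoˡ (ℚₚ.nonNegative⁻¹ (1ℚ + 1ℚ))
                               (≤-trans (*-monoˡ (0≤^ m 0≤1+u) ½≤1-mu) (go m)) ⟩
  (1ℚ + 1ℚ) * 1ℚ          ≡⟨ ℚₚ.*-identityʳ (1ℚ + 1ℚ) ⟩
  1ℚ + 1ℚ                 ∎
  where
  y : ℚ
  y = (1ℚ + u) ^ m
  0≤1+u : 0ℚ ≤ 1ℚ + u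
  0≤1+u = 0≤+ 0≤1 0≤u
  ½≤1-mu : ½ ≤ 1ℚ - ι m * u
  ½≤1-mu = ℚₚ.+-monoʳ-≤ 1ℚ (ℚₚ.neg-antimono-≤ mu≤½)
  go : ∀ m → (1ℚ + u) ^ m * (1ℚ - ι m * u) ≤ 1ℚ
  go zero    = ≤-reflexive (solve 1 (λ u → con 1ℚ :* (con 1ℚ :- con 0ℚ :* u) := con 1ℚ) refl u)
  go (suc m) = begin
    (1ℚ + u) * (1ℚ + u) ^ m * (1ℚ - ι (suc m) * u)
      ≡⟨ cong (λ t → (1ℚ + u) * (1ℚ + u) ^ m * (1ℚ - t * u)) (ι-suc m) ⟩
    (1ℚ + u) * (1ℚ + u) ^ m * (1ℚ - (1ℚ + ι m) * u)
      ≡⟨ solve 3 (λ u x i → (con 1ℚ :+ u) :* x :* (con 1ℚ :- (con 1ℚ :+ i) :* u)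
             := x :* (con 1ℚ :- i :* u) :- x :* ((con 1ℚ :+ i) :* (u :* u)))
           refl u ((1ℚ + u) ^ m) (ι m) ⟩
    (1ℚ + u) ^ m * (1ℚ - ι m * u) - (1ℚ + u) ^ m * ((1ℚ + ι m) * (u * u))
      ≤⟨ p-q≤p (0≤* (0≤^ m 0≤1+u) (0≤* (0≤+ 0≤1 (0≤ι m)) (0≤* 0≤u 0≤u))) ⟩
    (1ℚ + u) ^ m * (1ℚ - ι m * u)   ≤⟨ go m ⟩
    1ℚ                              ∎

^-lower : ∀ m {u} → 0ℚ ≤ u → u ≤ 1ℚ → ι m * u ≤ ½ → ½ ≤ (1ℚ - u) ^ m
^-lower m {u} 0≤u u≤1 mu≤½ = ≤-trans (ℚₚ.+-monoʳ-≤ 1ℚ (ℚₚ.neg-antimono-≤ mu≤½)) (go m)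
  where
  0≤1-u : 0ℚ ≤ 1ℚ - u
  0≤1-u = -‿≤ u≤1
  go : ∀ m → 1ℚ - ι m * u ≤ (1ℚ - u) ^ m
  go zero    = ≤-reflexive (solve 1 (λ u → con 1ℚ :- con 0ℚ :* u := con 1ℚ) refl u)
  go (suc m) = begin
    1ℚ - ι (suc m) * u       ≡⟨ cong (λ t → 1ℚ - t * u) (ι-suc m) ⟩
    1ℚ - (1ℚ + ι m) * u      ≤⟨ p≤p+q (0≤* (0≤ι m) (0≤* 0≤u 0≤u)) ⟩
    1ℚ - (1ℚ + ι m) * u + ι m * (u * u)
      ≡⟨ solve 2 (λ u i → con 1ℚ :- (con 1ℚ :+ i) :* u :+ i :* (u :* u)
                   := (con 1ℚ :- u) :* (con 1ℚ :- i :* u)) refl u (ι m) ⟩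
    (1ℚ - u) * (1ℚ - ι m * u) ≤⟨ *-monoˡ 0≤1-u (go m) ⟩
    (1ℚ - u) * (1ℚ - u) ^ m   ∎

record ℝ : Set where
  constructor mkℝ
  field
    seq    : ℕ → ℚ
    cauchy : ∀ ε → 0ℚ < ε → ∃[ N ] ∀ m n → N ℕ.≤ m → N ℕ.≤ n → ∣ seq m - seq n ∣ < ε

open ℝ public

infix  4 _≈ᴿ_ _<ᴿ_ _≤ᴿ_
infixl 6 _+ᴿ_ _-ᴿ_
infixl 7 _*ᴿ_
infix  8 -ᴿ_

_≈ᴿ_ _<ᴿ_ _≤ᴿ_ : ℝ → ℝ → Set
x ≈ᴿ y = ∀ ε → 0ℚ < ε → ∃[ N ] ∀ n → N ℕ.≤ n → ∣ seq x n - seq y n ∣ < ε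
x <ᴿ y = ∃[ ε ] 0ℚ < ε × ∃[ N ] ∀ n → N ℕ.≤ n → seq x n + ε ≤ seq y n
x ≤ᴿ y = ¬ (y <ᴿ x)

Small : (ℕ → ℕ → ℚ) → Set
Small e = ∀ ε → 0ℚ < ε → ∃[ N ] ∀ m n → N ℕ.≤ m → N ℕ.≤ n → e m n < ε

small-≤ : ∀ {e e′} N → (∀ m n → N ℕ.≤ m → N ℕ.≤ n → e′ m n ≤ e m n) → Small e → Small e′
small-≤ N e′≤e small ε 0<ε with small ε 0<ε
... | M , e<ε = N ℕ.⊔ M , λ m n ≤m ≤n → ℚₚ.≤-<-trans
  (e′≤e m n (ℕₚ.m⊔n≤o⇒m≤o N M ≤m) (ℕₚ.m⊔n≤o⇒m≤o N M ≤n))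
  (e<ε m n (ℕₚ.m⊔n≤o⇒n≤o N M ≤m) (ℕₚ.m⊔n≤o⇒n≤o N M ≤n))

small-+ : ∀ {e e′} → Small e → Small e′ → Small (λ m n → e m n + e′ m n)
small-+ {e} {e′} small small′ ε 0<ε
  with small (½ * ε) (0<* 0<½ 0<ε) | small′ (½ * ε) (0<* 0<½ 0<ε)
... | N , e<ε | M , e′<ε = N ℕ.⊔ M , λ m n ≤m ≤n → subst (e m n + e′ m n <_) (½+½ ε)
  (ℚₚ.+-mono-< (e<ε m n (ℕₚ.m⊔n≤o⇒m≤o N M ≤m) (ℕₚ.m⊔n≤o⇒m≤o N M ≤n))
               (e′<ε m n (ℕₚ.m⊔n≤o⇒n≤o N M ≤m) (ℕₚ.m⊔n≤o⇒n≤o N M ≤n)))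

small-* : ∀ {e K} → 0ℚ < K → Small e → Small (λ m n → K * e m n)
small-* {e} {K} 0<K small ε 0<ε with small (inv K * ε) (0<* (0<inv 0<K) 0<ε)
... | N , e<ε = N , λ m n ≤m ≤n → begin-strict
  K * e m n       <⟨ ℚₚ.*-monoʳ-<-pos K {{positive 0<K}} (e<ε m n ≤m ≤n) ⟩
  K * (inv K * ε) ≡⟨ ℚₚ.*-assoc K (inv K) ε ⟨
  K * inv K * ε   ≡⟨ cong (_* ε) (inv-inverse 0<K) ⟩
  1ℚ * ε          ≡⟨ ℚₚ.*-identityˡ ε ⟩
  ε               ∎

small-h : Small (λ m n → h m + h n)
small-h = small-+ (λ ε 0<ε → shrink ε 0<ε (λ m n → m) (λ ≤m ≤n → ≤m))
                  (λ ε 0<ε → shrink ε 0<ε (λ m n → n) (λ ≤m ≤n → ≤n))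
  where
  shrink : ∀ ε → 0ℚ < ε → (π : ℕ → ℕ → ℕ) →
    (∀ {N m n} → N ℕ.≤ m → N ℕ.≤ n → N ℕ.≤ π m n) →
    ∃[ N ] ∀ m n → N ℕ.≤ m → N ℕ.≤ n → h (π m n) < ε
  shrink ε 0<ε π ≤π with archimedean 0<ε
  ... | N , hN≤ε = suc N , λ m n ≤m ≤n → begin-strict
    h (π m n)  ≤⟨ h-anti (≤π ≤m ≤n) ⟩
    ½ * h N    <⟨ ℚₚ.*-monoˡ-<-pos (h N) {{positive (0<h N)}} ½<1 ⟩
    1ℚ * h N   ≡⟨ ℚₚ.*-identityˡ (h N) ⟩
    h N        ≤⟨ hN≤ε ⟩
    ε          ∎
    where
    ½<1 : ½ < 1ℚ
    ½<1 = *<* (ℤ.+<+ (s≤s (s≤s z≤n)))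

EventuallyBounded : ℝ → Set
EventuallyBounded x = ∃[ B ] 0ℚ < B × ∃[ N ] ∀ n → N ℕ.≤ n → ∣ seq x n ∣ ≤ B

eventually-bounded : ∀ x → EventuallyBounded x
eventually-bounded x = go (cauchy x 1ℚ 0<1)
  where
  go : (∃[ N ] ∀ m n → N ℕ.≤ m → N ℕ.≤ n → ∣ seq x m - seq x n ∣ < 1ℚ) → EventuallyBounded x
  go (N , close) = ∣ seq x N ∣ + 1ℚ , ℚₚ.+-mono-≤-< (ℚₚ.0≤∣p∣ (seq x N)) 0<1 , N , λ n N≤n →
    ≤-trans (∣p∣≤q+∣p-q∣ (seq x n) (seq x N))
      (ℚₚ.+-monoʳ-≤ ∣ seq x N ∣ (<⇒≤ (close n N N≤n ℕₚ.≤-refl)))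

fromℚ : ℚ → ℝ
fromℚ q = mkℝ (λ _ → q) λ ε 0<ε → 0 , λ _ _ _ _ →
  subst (λ t → ∣ t ∣ < ε) (sym (ℚₚ.+-inverseʳ q)) 0<ε

fromℕ : ℕ → ℝ
fromℕ n = fromℚ (ι n)

0ᴿ 1ᴿ : ℝ
0ᴿ = fromℚ 0ℚ
1ᴿ = fromℚ 1ℚ

_+ᴿ_ : ℝ → ℝ → ℝ
x +ᴿ y = mkℝ (λ n → seq x n + seq y n) (small-≤ 0 bound (small-+ (cauchy x) (cauchy y)))
  where
  bound : ∀ m n → 0 ℕ.≤ m → 0 ℕ.≤ n → ∣ seq x m + seq y m - (seq x n + seq y n) ∣
                                     ≤ ∣ seq x m - seq x n ∣ + ∣ seq y m - seq y n ∣
  bound m n _ _ = subst (λ t → ∣ t ∣ ≤ ∣ seq x m - seq x n ∣ + ∣ seq y m - seq y n ∣)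
    (solve 4 (λ a b c d → (a :- b) :+ (c :- d) := (a :+ c) :- (b :+ d)) refl
      (seq x m) (seq x n) (seq y m) (seq y n))
    (ℚₚ.∣p+q∣≤∣p∣+∣q∣ (seq x m - seq x n) (seq y m - seq y n))

-ᴿ_ : ℝ → ℝ
-ᴿ x = mkℝ (λ n → - seq x n) (small-≤ 0 bound (cauchy x))
  where
  bound : ∀ m n → 0 ℕ.≤ m → 0 ℕ.≤ n → ∣ - seq x m - - seq x n ∣ ≤ ∣ seq x m - seq x n ∣
  bound m n _ _ = ≤-reflexive (trans
    (cong ∣_∣ (solve 2 (λ a b → :- a :- :- b := b :- a) refl (seq x m) (seq x n)))
    (∣-∣-swap (seq x n) (seq x m)))

_-ᴿ_ : ℝ → ℝ → ℝ
x -ᴿ y = x +ᴿ (-ᴿ y)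

*-∣-∣ : ∀ {A B} a b c d → ∣ a ∣ ≤ A → ∣ d ∣ ≤ B →
  ∣ a * c - b * d ∣ ≤ A * ∣ c - d ∣ + B * ∣ a - b ∣
*-∣-∣ {A} {B} a b c d a≤A d≤B = begin
  ∣ a * c - b * d ∣
    ≡⟨ cong ∣_∣ (solve 4 (λ a b c d → a :* c :- b :* d := a :* (c :- d) :+ d :* (a :- b)) refl
         a b c d) ⟩
  ∣ a * (c - d) + d * (a - b) ∣       ≤⟨ ℚₚ.∣p+q∣≤∣p∣+∣q∣ (a * (c - d)) (d * (a - b)) ⟩
  ∣ a * (c - d) ∣ + ∣ d * (a - b) ∣
    ≡⟨ cong₂ _+_ (ℚₚ.∣p*q∣≡∣p∣*∣q∣ a (c - d)) (ℚₚ.∣p*q∣≡∣p∣*∣q∣ d (a - b)) ⟩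
  ∣ a ∣ * ∣ c - d ∣ + ∣ d ∣ * ∣ a - b ∣
    ≤⟨ ℚₚ.+-mono-≤ (*-monoʳ (ℚₚ.0≤∣p∣ (c - d)) a≤A) (*-monoʳ (ℚₚ.0≤∣p∣ (a - b)) d≤B) ⟩
  A * ∣ c - d ∣ + B * ∣ a - b ∣       ∎

_*ᴿ_ : ℝ → ℝ → ℝ
x *ᴿ y = mkℝ (λ n → seq x n * seq y n) (go (eventually-bounded x) (eventually-bounded y))
  where
  go : EventuallyBounded x → EventuallyBounded y →
    Small (λ m n → ∣ seq x m * seq y m - seq x n * seq y n ∣)
  go (A , 0<A , M , x≤A) (B , 0<B , N , y≤B) =
    small-≤ (M ℕ.⊔ N)
      (λ m n ≤m ≤n → *-∣-∣ (seq x m) (seq x n) (seq y m) (seq y n)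
        (x≤A m (ℕₚ.m⊔n≤o⇒m≤o M N ≤m)) (y≤B n (ℕₚ.m⊔n≤o⇒n≤o M N ≤n)))
      (small-+ (small-* 0<A (cauchy y)) (small-* 0<B (cauchy x)))

inv-∣-∣ : ∀ {a b δ} → 0ℚ < δ → δ ≤ a → δ ≤ b →
  ∣ inv a - inv b ∣ ≤ inv δ * inv δ * ∣ a - b ∣
inv-∣-∣ {a} {b} {δ} 0<δ δ≤a δ≤b = begin
  ∣ inv a - inv b ∣
    ≡⟨ cong₂ (λ s t → ∣ s - t ∣) (ℚₚ.*-identityˡ (inv a)) (ℚₚ.*-identityˡ (inv b)) ⟨
  ∣ 1ℚ * inv a - 1ℚ * inv b ∣           ≤⟨ frac-bound {1ℚ} {1ℚ} 0<δ δ≤a δ≤b ⟩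
  inv δ * inv δ * ∣ 1ℚ * b - 1ℚ * a ∣
    ≡⟨ cong₂ (λ s t → inv δ * inv δ * ∣ s - t ∣) (ℚₚ.*-identityˡ b) (ℚₚ.*-identityˡ a) ⟩
  inv δ * inv δ * ∣ b - a ∣             ≡⟨ cong (inv δ * inv δ *_) (∣-∣-swap b a) ⟩
  inv δ * inv δ * ∣ a - b ∣             ∎

recip : (x : ℝ) → 0ᴿ <ᴿ x → ℝ
recip x (δ , 0<δ , N , 0+δ≤x) = mkℝ (λ n → inv (seq x n))
  (small-≤ N (λ m n ≤m ≤n → inv-∣-∣ 0<δ (δ≤x m ≤m) (δ≤x n ≤n))
    (small-* (0<* (0<inv 0<δ) (0<inv 0<δ)) (cauchy x)))
  where
  δ≤x : ∀ n → N ℕ.≤ n → δ ≤ seq x n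
  δ≤x n N≤n = subst (_≤ seq x n) (ℚₚ.+-identityˡ δ) (0+δ≤x n N≤n)

divide : ℝ → (y : ℝ) → 0ᴿ <ᴿ y → ℝ
divide x y 0<y = x *ᴿ recip y 0<y

infixl 7 divide
syntax divide x y 0<y = x /ᴿ y [ 0<y ]

-- If the functions F n are eventually uniformly Lipschitz and converge dyadically
-- fast on a domain containing a tail of x, then F n (x n) is Cauchy.
diagonal : (F : ℕ → ℚ → ℚ) (x : ℝ) (P : ℚ → Set) (N : ℕ) {K L : ℚ} → 0ℚ < K → 0ℚ < L →
  (∀ n → N ℕ.≤ n → P (seq x n)) →
  (∀ n {p q} → N ℕ.≤ n → P p → P q → ∣ F n p - F n q ∣ ≤ K * ∣ p - q ∣) →
  (∀ n {p} → N ℕ.≤ n → P p → ∣ F (suc n) p - F n p ∣ ≤ L * h n) →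
  Small (λ m n → ∣ F m (seq x m) - F n (seq x n) ∣)
diagonal F x P N {K} {L} 0<K 0<L Px lipschitz step =
  small-≤ N bound (small-+ (small-* 0<K (cauchy x)) (small-* (0<+ 0<L (<⇒≤ 0<L)) small-h))
  where
  -- telescoping: ∑_{m≤i<m+d} 2⁻ⁱ ≤ 2·2⁻ᵐ
  tail : ∀ m d {p} → N ℕ.≤ m → P p → ∣ F (d ℕ.+ m) p - F m p ∣ ≤ (L + L) * (h m - h (d ℕ.+ m))
  tail m zero {p} N≤m Pp = begin
    ∣ F m p - F m p ∣       ≡⟨ cong ∣_∣ (ℚₚ.+-inverseʳ (F m p)) ⟩
    0ℚ                      ≡⟨ ℚₚ.*-zeroʳ (L + L) ⟨
    (L + L) * 0ℚ            ≡⟨ cong ((L + L) *_) (ℚₚ.+-inverseʳ (h m)) ⟨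
    (L + L) * (h m - h m)   ∎
  tail m (suc d) {p} N≤m Pp = begin
    ∣ F (suc d ℕ.+ m) p - F m p ∣
      ≤⟨ ∣-∣-triangle (F (suc d ℕ.+ m) p) (F (d ℕ.+ m) p) (F m p) ⟩
    ∣ F (suc d ℕ.+ m) p - F (d ℕ.+ m) p ∣ + ∣ F (d ℕ.+ m) p - F m p ∣
      ≤⟨ ℚₚ.+-mono-≤ (step (d ℕ.+ m) (ℕₚ.m≤n⇒m≤o+n d N≤m) Pp) (tail m d N≤m Pp) ⟩
    L * h (d ℕ.+ m) + (L + L) * (h m - h (d ℕ.+ m))
      ≡⟨ solve 3 (λ L a b → L :* b :+ (L :+ L) :* (a :- b) := (L :+ L) :* (a :- con ½ :* b)) refl
           L (h m) (h (d ℕ.+ m)) ⟩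
    (L + L) * (h m - h (suc d ℕ.+ m)) ∎

  diff : ∀ {m n p} → N ℕ.≤ m → m ℕ.≤ n → P p → ∣ F n p - F m p ∣ ≤ (L + L) * (h m + h n)
  diff {m} {n} {p} N≤m m≤n Pp =
    subst (λ k → ∣ F k p - F m p ∣ ≤ (L + L) * (h m + h k)) (ℕₚ.m∸n+n≡m m≤n)
      (≤-trans (tail m (n ℕ.∸ m) N≤m Pp)
        (*-monoˡ (<⇒≤ (0<+ 0<L (<⇒≤ 0<L))) (≤-trans (p-q≤p {h m} {h k} (0≤h k)) (p≤p+q {h m} {h k} (0≤h k)))))
    where
    k : ℕ
    k = n ℕ.∸ m ℕ.+ m

  diff′ : ∀ m n {p} → N ℕ.≤ m → N ℕ.≤ n → P p → ∣ F m p - F n p ∣ ≤ (L + L) * (h m + h n)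
  diff′ m n {p} N≤m N≤n Pp with ℕₚ.≤-total m n
  ... | inj₁ m≤n = subst (_≤ (L + L) * (h m + h n)) (∣-∣-swap (F n p) (F m p)) (diff N≤m m≤n Pp)
  ... | inj₂ n≤m = subst (λ t → ∣ F m p - F n p ∣ ≤ (L + L) * t) (ℚₚ.+-comm (h n) (h m))
                     (diff N≤n n≤m Pp)

  bound : ∀ m n → N ℕ.≤ m → N ℕ.≤ n → ∣ F m (seq x m) - F n (seq x n) ∣
            ≤ K * ∣ seq x m - seq x n ∣ + (L + L) * (h m + h n)
  bound m n ≤m ≤n = ≤-trans (∣-∣-triangle (F m (seq x m)) (F m (seq x n)) (F n (seq x n)))
    (ℚₚ.+-mono-≤ (lipschitz m ≤m (Px m ≤m) (Px n ≤n)) (diff′ m n ≤m ≤n (Px n ≤n)))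

-- (1 + x/2ⁿ)^(2ⁿ) → exp x
expₙ : ℕ → ℚ → ℚ
expₙ n x = (1ℚ + x * h n) ^ (2 ℕ.^ n)

module ExpBounds {B : ℚ} (0<B : 0ℚ < B) where

  private
    arch = archimedean (0<* 0<½ (0<inv 0<B))

  N₀ : ℕ
  N₀ = proj₁ arch

  B*h≤½ : ∀ {n} → N₀ ℕ.≤ n → B * h n ≤ ½
  B*h≤½ {n} N₀≤n = begin
    B * h n         ≤⟨ *-monoˡ (<⇒≤ 0<B) (≤-trans (h-anti N₀≤n) (proj₂ arch)) ⟩
    B * (½ * inv B) ≡⟨ solve 2 (λ b i → b :* (con ½ :* i) := con ½ :* (b :* i)) refl B (inv B) ⟩
    ½ * (B * inv B) ≡⟨ cong (½ *_) (inv-inverse 0<B) ⟩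
    ½ * 1ℚ          ≡⟨ ℚₚ.*-identityʳ ½ ⟩
    ½               ∎

  0≤B*h : ∀ n → 0ℚ ≤ B * h n
  0≤B*h n = 0≤* (<⇒≤ 0<B) (0≤h n)

  -- (1 + u)^(2ⁿ) is split as ((1 + u)^(2ⁿ⁻ᴺ))^(2ᴺ)
  split : ∀ {n} y → N₀ ℕ.≤ n → y ^ (2 ℕ.^ n) ≡ (y ^ (2 ℕ.^ (n ℕ.∸ N₀))) ^ (2 ℕ.^ N₀)
  split {n} y N₀≤n = begin-equality
    y ^ (2 ℕ.^ n)                            ≡⟨ cong (λ k → y ^ (2 ℕ.^ k)) (ℕₚ.m∸n+n≡m N₀≤n) ⟨
    y ^ (2 ℕ.^ (n ℕ.∸ N₀ ℕ.+ N₀))            ≡⟨ cong (y ^_) (ℕₚ.^-distribˡ-+-* 2 (n ℕ.∸ N₀) N₀) ⟩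
    y ^ (2 ℕ.^ (n ℕ.∸ N₀) ℕ.* 2 ℕ.^ N₀)      ≡⟨ ^-assocʳ y (2 ℕ.^ (n ℕ.∸ N₀)) (2 ℕ.^ N₀) ⟨
    (y ^ (2 ℕ.^ (n ℕ.∸ N₀))) ^ (2 ℕ.^ N₀)    ∎

  h-split : ∀ {n} → N₀ ℕ.≤ n → ι (2 ℕ.^ (n ℕ.∸ N₀)) * (B * h n) ≤ ½
  h-split {n} N₀≤n = begin
    ι (2 ℕ.^ r) * (B * h n)         ≡⟨ cong (λ k → ι (2 ℕ.^ r) * (B * h k)) (ℕₚ.m∸n+n≡m N₀≤n) ⟨
    ι (2 ℕ.^ r) * (B * h (r ℕ.+ N₀)) ≡⟨ cong (λ t → ι (2 ℕ.^ r) * (B * t)) (^-homo-* ½ r N₀) ⟩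
    ι (2 ℕ.^ r) * (B * (h r * h N₀))
      ≡⟨ solve 4 (λ a b c d → a :* (b :* (c :* d)) := a :* c :* (b :* d)) refl
           (ι (2 ℕ.^ r)) B (h r) (h N₀) ⟩
    ι (2 ℕ.^ r) * h r * (B * h N₀)  ≡⟨ cong (_* (B * h N₀)) (ι2^*h r) ⟩
    1ℚ * (B * h N₀)                 ≡⟨ ℚₚ.*-identityˡ (B * h N₀) ⟩
    B * h N₀                        ≤⟨ B*h≤½ ℕₚ.≤-refl ⟩
    ½                               ∎
    where
    r : ℕ
    r = n ℕ.∸ N₀

  E : ℚ
  E = (1ℚ + 1ℚ) ^ (2 ℕ.^ N₀)

  0<^ : ∀ {x} n → 0ℚ < x → 0ℚ < x ^ n
  0<^ zero    0<x = 0<1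
  0<^ (suc n) 0<x = 0<* 0<x (0<^ n 0<x)

  0<E : 0ℚ < E
  0<E = 0<^ (2 ℕ.^ N₀) (ℚₚ.positive⁻¹ (1ℚ + 1ℚ))

  upper : ∀ {n} → N₀ ℕ.≤ n → (1ℚ + B * h n) ^ (2 ℕ.^ n) ≤ E
  upper {n} N₀≤n = begin
    (1ℚ + B * h n) ^ (2 ℕ.^ n) ≡⟨ split (1ℚ + B * h n) N₀≤n ⟩
    ((1ℚ + B * h n) ^ (2 ℕ.^ (n ℕ.∸ N₀))) ^ (2 ℕ.^ N₀)
      ≤⟨ ^-mono (2 ℕ.^ N₀) (0≤^ (2 ℕ.^ (n ℕ.∸ N₀)) (0≤+ 0≤1 (0≤B*h n)))
           (^-upper (2 ℕ.^ (n ℕ.∸ N₀)) (0≤B*h n) (h-split N₀≤n)) ⟩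
    E                          ∎

  lower : ∀ {n p} → N₀ ℕ.≤ n → ∣ p ∣ ≤ B → ½ ^ (2 ℕ.^ N₀) ≤ expₙ n p
  lower {n} {p} N₀≤n p≤B = begin
    ½ ^ (2 ℕ.^ N₀)
      ≤⟨ ^-mono (2 ℕ.^ N₀) 0≤½ (^-lower (2 ℕ.^ (n ℕ.∸ N₀)) (0≤B*h n) Bh≤1 (h-split N₀≤n)) ⟩
    ((1ℚ - B * h n) ^ (2 ℕ.^ (n ℕ.∸ N₀))) ^ (2 ℕ.^ N₀) ≡⟨ split (1ℚ - B * h n) N₀≤n ⟨
    (1ℚ - B * h n) ^ (2 ℕ.^ n)  ≤⟨ ^-mono (2 ℕ.^ n) (-‿≤ Bh≤1) (ℚₚ.+-monoʳ-≤ 1ℚ -Bh≤ph) ⟩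
    expₙ n p                    ∎
    where
    Bh≤1 : B * h n ≤ 1ℚ
    Bh≤1 = ≤-trans (B*h≤½ N₀≤n) (≤-trans (p≤p+q 0≤½) (≤-reflexive (½+½ 1ℚ)))
    -p≤B : - p ≤ B
    -p≤B = ≤-trans (p≤∣p∣ (- p)) (subst (_≤ B) (sym (ℚₚ.∣-p∣≡∣p∣ p)) p≤B)
    -Bh≤ph : - (B * h n) ≤ p * h n
    -Bh≤ph = subst (- (B * h n) ≤_)
      (solve 2 (λ p h → :- (:- p :* h) := p :* h) refl p (h n))
      (ℚₚ.neg-antimono-≤ (*-monoʳ (0≤h n) -p≤B))

  base≤ : ∀ n {p} → ∣ p ∣ ≤ B → ∣ 1ℚ + p * h n ∣ ≤ 1ℚ + B * h n
  base≤ n {p} p≤B = begin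
    ∣ 1ℚ + p * h n ∣      ≤⟨ ℚₚ.∣p+q∣≤∣p∣+∣q∣ 1ℚ (p * h n) ⟩
    1ℚ + ∣ p * h n ∣      ≡⟨ cong (_+_ 1ℚ) (ℚₚ.∣p*q∣≡∣p∣*∣q∣ p (h n)) ⟩
    1ℚ + ∣ p ∣ * ∣ h n ∣  ≡⟨ cong (λ t → 1ℚ + ∣ p ∣ * t) (ℚₚ.0≤p⇒∣p∣≡p (0≤h n)) ⟩
    1ℚ + ∣ p ∣ * h n      ≤⟨ ℚₚ.+-monoʳ-≤ 1ℚ (*-monoʳ (0≤h n) p≤B) ⟩
    1ℚ + B * h n          ∎

  lipschitz : ∀ n {p q} → N₀ ℕ.≤ n → ∣ p ∣ ≤ B → ∣ q ∣ ≤ B →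
    ∣ expₙ n p - expₙ n q ∣ ≤ E * ∣ p - q ∣
  lipschitz n {p} {q} N₀≤n p≤B q≤B = begin
    ∣ expₙ n p - expₙ n q ∣
      ≤⟨ ^-∣-∣ (2 ℕ.^ n) (p≤p+q (0≤B*h n)) (base≤ n p≤B) (base≤ n q≤B) ⟩
    ι (2 ℕ.^ n) * ∣ (1ℚ + p * h n) - (1ℚ + q * h n) ∣ * M
      ≡⟨ cong (λ t → ι (2 ℕ.^ n) * t * M) dist ⟩
    ι (2 ℕ.^ n) * (∣ p - q ∣ * h n) * M
      ≡⟨ solve 4 (λ a b c m → a :* (b :* c) :* m := a :* c :* (m :* b)) refl
           (ι (2 ℕ.^ n)) ∣ p - q ∣ (h n) M ⟩
    ι (2 ℕ.^ n) * h n * (M * ∣ p - q ∣)  ≡⟨ cong (_* (M * ∣ p - q ∣)) (ι2^*h n) ⟩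
    1ℚ * (M * ∣ p - q ∣)                 ≡⟨ ℚₚ.*-identityˡ (M * ∣ p - q ∣) ⟩
    M * ∣ p - q ∣                        ≤⟨ *-monoʳ (ℚₚ.0≤∣p∣ (p - q)) (upper N₀≤n) ⟩
    E * ∣ p - q ∣                        ∎
    where
    M : ℚ
    M = (1ℚ + B * h n) ^ (2 ℕ.^ n)
    dist : ∣ (1ℚ + p * h n) - (1ℚ + q * h n) ∣ ≡ ∣ p - q ∣ * h n
    dist = trans
      (cong ∣_∣ (solve 3 (λ p q h → (con 1ℚ :+ p :* h) :- (con 1ℚ :+ q :* h) := (p :- q) :* h) refl
        p q (h n)))
      (trans (ℚₚ.∣p*q∣≡∣p∣*∣q∣ (p - q) (h n)) (cong (∣ p - q ∣ *_) (ℚₚ.0≤p⇒∣p∣≡p (0≤h n))))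

  -- expₙ₊₁ and expₙ are 2ⁿ-th powers whose bases differ by (p/2ⁿ⁺¹)²
  step : ∀ n {p} → N₀ ℕ.≤ n → ∣ p ∣ ≤ B → ∣ expₙ (suc n) p - expₙ n p ∣ ≤ B * B * E * h n
  step n {p} N₀≤n p≤B = begin
    ∣ expₙ (suc n) p - expₙ n p ∣
      ≡⟨ cong (λ t → ∣ t - expₙ n p ∣) (^-assocʳ c 2 (2 ℕ.^ n)) ⟨
    ∣ (c ^ 2) ^ (2 ℕ.^ n) - expₙ n p ∣
      ≤⟨ ^-∣-∣ (2 ℕ.^ n) 1≤M c²≤M (≤-trans (base≤ n p≤B) Mₙ≤M) ⟩
    ι (2 ℕ.^ n) * ∣ c ^ 2 - (1ℚ + p * h n) ∣ * M ^ (2 ℕ.^ n)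
      ≡⟨ cong₂ (λ s t → ι (2 ℕ.^ n) * s * t) dist (^-assocʳ m 2 (2 ℕ.^ n)) ⟩
    ι (2 ℕ.^ n) * (∣ p ∣ * k * (∣ p ∣ * k)) * m ^ (2 ℕ.^ suc n)
      ≤⟨ *-mono (0≤^ (2 ℕ.^ suc n) 0≤m) (0≤* (0≤ι (2 ℕ.^ n)) (0≤* 0≤Bk 0≤Bk))
           (*-monoˡ (0≤ι (2 ℕ.^ n)) (*-mono (0≤* (ℚₚ.0≤∣p∣ p) 0≤k) 0≤Bk pk≤Bk pk≤Bk))
           (upper (ℕₚ.m≤n⇒m≤1+n N₀≤n)) ⟩
    ι (2 ℕ.^ n) * (B * k * (B * k)) * E
      ≡⟨ solve 4 (λ i b h e → i :* (b :* (con ½ :* h) :* (b :* (con ½ :* h))) :* e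
                   := i :* h :* (b :* b :* e :* (con ½ :* (con ½ :* h)))) refl
           (ι (2 ℕ.^ n)) B (h n) E ⟩
    ι (2 ℕ.^ n) * h n * (B * B * E * h (suc (suc n)))
      ≡⟨ cong (_* (B * B * E * h (suc (suc n)))) (ι2^*h n) ⟩
    1ℚ * (B * B * E * h (suc (suc n)))
      ≡⟨ ℚₚ.*-identityˡ (B * B * E * h (suc (suc n))) ⟩
    B * B * E * h (suc (suc n))
      ≤⟨ *-monoˡ (<⇒≤ (0<* (0<* 0<B 0<B) 0<E)) (h-anti (ℕₚ.m≤n+m n 2)) ⟩
    B * B * E * h n ∎
    where
    k c m M : ℚ
    k = h (suc n)
    c = 1ℚ + p * k
    m = 1ℚ + B * k
    M = m ^ 2
    0≤k : 0ℚ ≤ k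
    0≤k = 0≤h (suc n)
    0≤Bk : 0ℚ ≤ B * k
    0≤Bk = 0≤B*h (suc n)
    0≤m : 0ℚ ≤ m
    0≤m = 0≤+ 0≤1 0≤Bk
    pk≤Bk : ∣ p ∣ * k ≤ B * k
    pk≤Bk = *-monoʳ 0≤k p≤B
    Mₙ≤M : 1ℚ + B * h n ≤ M
    Mₙ≤M = begin
      1ℚ + B * h n                      ≤⟨ p≤p+q (0≤* 0≤Bk 0≤Bk) ⟩
      1ℚ + B * h n + B * k * (B * k)
        ≡⟨ solve 2 (λ b h → con 1ℚ :+ b :* h :+ b :* (con ½ :* h) :* (b :* (con ½ :* h))
             := (con 1ℚ :+ b :* (con ½ :* h)) :* ((con 1ℚ :+ b :* (con ½ :* h)) :* con 1ℚ)) refl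
             B (h n) ⟩
      M                                 ∎
    1≤M : 1ℚ ≤ M
    1≤M = ≤-trans (p≤p+q (0≤B*h n)) Mₙ≤M
    c²≤M : ∣ c ^ 2 ∣ ≤ M
    c²≤M = ≤-trans (≤-reflexive (∣^∣ c 2)) (^-mono 2 (ℚₚ.0≤∣p∣ c) (base≤ (suc n) p≤B))
    dist : ∣ c ^ 2 - (1ℚ + p * h n) ∣ ≡ ∣ p ∣ * k * (∣ p ∣ * k)
    dist = begin-equality
      ∣ c ^ 2 - (1ℚ + p * h n) ∣
        ≡⟨ cong ∣_∣ (solve 2 (λ p h → (con 1ℚ :+ p :* (con ½ :* h))
               :* ((con 1ℚ :+ p :* (con ½ :* h)) :* con 1ℚ) :- (con 1ℚ :+ p :* h)
               := p :* (con ½ :* h) :* (p :* (con ½ :* h))) refl p (h n)) ⟩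
      ∣ p * k * (p * k) ∣       ≡⟨ ℚₚ.∣p*q∣≡∣p∣*∣q∣ (p * k) (p * k) ⟩
      ∣ p * k ∣ * ∣ p * k ∣     ≡⟨ cong (λ t → t * t) (trans (ℚₚ.∣p*q∣≡∣p∣*∣q∣ p k)
                                     (cong (∣ p ∣ *_) (ℚₚ.0≤p⇒∣p∣≡p 0≤k))) ⟩
      ∣ p ∣ * k * (∣ p ∣ * k)   ∎

exp : ℝ → ℝ
exp x = mkℝ (λ n → expₙ n (seq x n)) (go (eventually-bounded x))
  where
  go : EventuallyBounded x → Small (λ m n → ∣ expₙ m (seq x m) - expₙ n (seq x n) ∣)
  go (B , 0<B , N , x≤B) =
    diagonal expₙ x (λ p → ∣ p ∣ ≤ B) (N ℕ.⊔ N₀) 0<E (0<* (0<* 0<B 0<B) 0<E)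
      (λ n ≤n → x≤B n (ℕₚ.m⊔n≤o⇒m≤o N N₀ ≤n))
      (λ n ≤n → lipschitz n (ℕₚ.m⊔n≤o⇒n≤o N N₀ ≤n))
      (λ n ≤n → step n (ℕₚ.m⊔n≤o⇒n≤o N N₀ ≤n))
    where open ExpBounds 0<B

exp-positive : ∀ x → 0ᴿ <ᴿ exp x
exp-positive x = go (eventually-bounded x)
  where
  go : EventuallyBounded x → 0ᴿ <ᴿ exp x
  go (B , 0<B , N , x≤B) = ½ ^ (2 ℕ.^ N₀) , 0<^ (2 ℕ.^ N₀) 0<½ , N ℕ.⊔ N₀ , λ n ≤n →
    subst (_≤ expₙ n (seq x n)) (sym (ℚₚ.+-identityˡ (½ ^ (2 ℕ.^ N₀))))
      (lower (ℕₚ.m⊔n≤o⇒n≤o N N₀ ≤n) (x≤B n (ℕₚ.m⊔n≤o⇒m≤o N N₀ ≤n)))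
    where open ExpBounds 0<B

-- Left Riemann sums, with 2ⁿ steps, of ∫₁ˣ ds/s = ∫₀¹ (x - 1)/(1 + t(x - 1)) dt
logₙ : ℕ → ℚ → ℚ
logₙ n x = ∑< (2 ℕ.^ n) λ j → h n * ((x - 1ℚ) * inv (1ℚ + ι j * h n * (x - 1ℚ)))

node≤1 : ∀ n {j} → j ℕ.< 2 ℕ.^ n → ι j * h n ≤ 1ℚ
node≤1 n j< = ≤-trans (*-monoʳ (0≤h n) (ι-mono (ℕₚ.<⇒≤ j<))) (≤-reflexive (ι2^*h n))

0≤node : ∀ n j → 0ℚ ≤ ι j * h n
0≤node n j = 0≤* (0≤ι j) (0≤h n)

average : ∀ n c → ι (2 ℕ.^ n) * (h n * c) ≡ c
average n c = begin-equality
  ι (2 ℕ.^ n) * (h n * c)  ≡⟨ ℚₚ.*-assoc (ι (2 ℕ.^ n)) (h n) c ⟨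
  ι (2 ℕ.^ n) * h n * c    ≡⟨ cong (_* c) (ι2^*h n) ⟩
  1ℚ * c                   ≡⟨ ℚₚ.*-identityˡ c ⟩
  c                        ∎

module LogBounds {δ B : ℚ} (0<δ : 0ℚ < δ) (δ≤1 : δ ≤ 1ℚ) (0<B : 0ℚ < B) where

  Dom : ℚ → Set
  Dom p = δ ≤ p × ∣ p - 1ℚ ∣ ≤ B

  D : ℚ
  D = inv δ * inv δ

  0<D : 0ℚ < D
  0<D = 0<* (0<inv 0<δ) (0<inv 0<δ)

  δ≤denominator : ∀ {t p} → 0ℚ ≤ t → t ≤ 1ℚ → δ ≤ p → δ ≤ 1ℚ + t * (p - 1ℚ)
  δ≤denominator {t} {p} 0≤t t≤1 δ≤p = begin
    δ ≤⟨ p≤p+q (0≤+ (0≤* (-‿≤ t≤1) (-‿≤ δ≤1)) (0≤* 0≤t (-‿≤ δ≤p))) ⟩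
    δ + ((1ℚ - t) * (1ℚ - δ) + t * (p - δ))
      ≡⟨ solve 3 (λ d t p → d :+ ((con 1ℚ :- t) :* (con 1ℚ :- d) :+ t :* (p :- d))
                   := con 1ℚ :+ t :* (p :- con 1ℚ)) refl δ t p ⟩
    1ℚ + t * (p - 1ℚ) ∎

  lipschitz : ∀ n {p q} → Dom p → Dom q → ∣ logₙ n p - logₙ n q ∣ ≤ D * ∣ p - q ∣
  lipschitz n {p} {q} (δ≤p , _) (δ≤q , _) =
    ≤-trans (∑<-∣-∣ (2 ℕ.^ n) term) (≤-reflexive (average n (D * ∣ p - q ∣)))
    where
    term : ∀ j → j ℕ.< 2 ℕ.^ n →
      ∣ h n * ((p - 1ℚ) * inv (1ℚ + ι j * h n * (p - 1ℚ)))
        - h n * ((q - 1ℚ) * inv (1ℚ + ι j * h n * (q - 1ℚ))) ∣ ≤ h n * (D * ∣ p - q ∣)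
    term j j< = begin
      ∣ h n * (X * inv a) - h n * (Y * inv b) ∣
        ≡⟨ cong ∣_∣ (solve 3 (λ h x y → h :* x :- h :* y := h :* (x :- y)) refl
             (h n) (X * inv a) (Y * inv b)) ⟩
      ∣ h n * (X * inv a - Y * inv b) ∣      ≡⟨ ℚₚ.∣p*q∣≡∣p∣*∣q∣ (h n) (X * inv a - Y * inv b) ⟩
      ∣ h n ∣ * ∣ X * inv a - Y * inv b ∣
        ≡⟨ cong (_* ∣ X * inv a - Y * inv b ∣) (ℚₚ.0≤p⇒∣p∣≡p (0≤h n)) ⟩
      h n * ∣ X * inv a - Y * inv b ∣
        ≤⟨ *-monoˡ (0≤h n) (frac-bound {X} {Y} 0<δ
             (δ≤denominator (0≤node n j) (node≤1 n j<) δ≤p)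
             (δ≤denominator (0≤node n j) (node≤1 n j<) δ≤q)) ⟩
      h n * (D * ∣ X * b - Y * a ∣)
        ≡⟨ cong (λ s → h n * (D * ∣ s ∣)) (solve 3 (λ p q t →
             (p :- con 1ℚ) :* (con 1ℚ :+ t :* (q :- con 1ℚ))
               :- (q :- con 1ℚ) :* (con 1ℚ :+ t :* (p :- con 1ℚ))
             := p :- q) refl p q (ι j * h n)) ⟩
      h n * (D * ∣ p - q ∣)                  ∎
      where
      X Y a b : ℚ
      X = p - 1ℚ
      Y = q - 1ℚ
      a = 1ℚ + ι j * h n * X
      b = 1ℚ + ι j * h n * Y

  -- halving the mesh splits the j-th term into terms 2j and 2j+1
  step : ∀ n {p} → Dom p → ∣ logₙ (suc n) p - logₙ n p ∣ ≤ D * (B * B) * h n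
  step n {p} (δ≤p , p≤B) = begin
    ∣ logₙ (suc n) p - logₙ n p ∣
      ≡⟨ cong (λ t → ∣ t - logₙ n p ∣) (∑<-double (2 ℕ.^ n) g) ⟩
    ∣ ∑< (2 ℕ.^ n) (λ j → g (2 ℕ.* j) + g (suc (2 ℕ.* j))) - logₙ n p ∣
      ≤⟨ ∑<-∣-∣ (2 ℕ.^ n) term ⟩
    ι (2 ℕ.^ n) * (k * (D * (B * B * k)))
      ≡⟨ solve 4 (λ i h d b → i :* (con ½ :* h :* (d :* (b :* b :* (con ½ :* h))))
           := i :* (h :* (d :* (b :* b) :* (con ½ :* (con ½ :* h))))) refl
           (ι (2 ℕ.^ n)) (h n) D B ⟩
    ι (2 ℕ.^ n) * (h n * (D * (B * B) * h (suc (suc n))))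
      ≡⟨ average n (D * (B * B) * h (suc (suc n))) ⟩
    D * (B * B) * h (suc (suc n))
      ≤⟨ *-monoˡ (<⇒≤ (0<* 0<D (0<* 0<B 0<B))) (h-anti (ℕₚ.m≤n+m n 2)) ⟩
    D * (B * B) * h n ∎
    where
    k X : ℚ
    k = h (suc n)
    X = p - 1ℚ
    f g : ℕ → ℚ
    f j = h n * (X * inv (1ℚ + ι j * h n * X))
    g j = k * (X * inv (1ℚ + ι j * k * X))
    0≤k : 0ℚ ≤ k
    0≤k = 0≤h (suc n)
    2j*k : ∀ j → ι (2 ℕ.* j) * k ≡ ι j * h n
    2j*k j = trans (cong (_* k) (ι-double j))
      (solve 2 (λ i h → (i :+ i) :* (con ½ :* h) := i :* h) refl (ι j) (h n))
    term : ∀ j → j ℕ.< 2 ℕ.^ n →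
      ∣ g (2 ℕ.* j) + g (suc (2 ℕ.* j)) - f j ∣ ≤ k * (D * (B * B * k))
    term j j< = begin
      ∣ g (2 ℕ.* j) + g (suc (2 ℕ.* j)) - f j ∣
        ≡⟨ cong (λ t → ∣ k * (X * inv (1ℚ + t * X)) + k * (X * inv b) - f j ∣) (2j*k j) ⟩
      ∣ k * (X * inv a) + k * (X * inv b) - h n * (X * inv a) ∣
        ≡⟨ cong ∣_∣ (solve 3 (λ h x y → con ½ :* h :* x :+ con ½ :* h :* y :- h :* x
             := con ½ :* h :* (y :- x)) refl (h n) (X * inv a) (X * inv b)) ⟩
      ∣ k * (X * inv b - X * inv a) ∣      ≡⟨ ℚₚ.∣p*q∣≡∣p∣*∣q∣ k (X * inv b - X * inv a) ⟩
      ∣ k ∣ * ∣ X * inv b - X * inv a ∣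
        ≡⟨ cong (_* ∣ X * inv b - X * inv a ∣) (ℚₚ.0≤p⇒∣p∣≡p 0≤k) ⟩
      k * ∣ X * inv b - X * inv a ∣        ≤⟨ *-monoˡ 0≤k (frac-bound {X} {X} 0<δ δ≤b δ≤a) ⟩
      k * (D * ∣ X * a - X * b ∣)          ≡⟨ cong (λ t → k * (D * t)) dist ⟩
      k * (D * (∣ X ∣ * ∣ X ∣ * k))
        ≤⟨ *-monoˡ 0≤k (*-monoˡ (<⇒≤ 0<D) (*-monoʳ 0≤k
             (*-mono (ℚₚ.0≤∣p∣ X) (<⇒≤ 0<B) p≤B p≤B))) ⟩
      k * (D * (B * B * k))                ∎
      where
      a b : ℚ
      a = 1ℚ + ι j * h n * X
      b = 1ℚ + ι (suc (2 ℕ.* j)) * k * X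
      δ≤a : δ ≤ a
      δ≤a = δ≤denominator (0≤node n j) (node≤1 n j<) δ≤p
      2j+1< : suc (2 ℕ.* j) ℕ.< 2 ℕ.^ suc n
      2j+1< = subst (ℕ._≤ 2 ℕ.^ suc n) (ℕₚ.*-suc 2 j) (ℕₚ.*-monoʳ-≤ 2 j<)
      δ≤b : δ ≤ b
      δ≤b = δ≤denominator (0≤node (suc n) (suc (2 ℕ.* j))) (node≤1 (suc n) 2j+1<) δ≤p
      b≡ : b ≡ 1ℚ + (ι j * h n + k) * X
      b≡ = cong (λ t → 1ℚ + t * X) (begin-equality
        ι (suc (2 ℕ.* j)) * k      ≡⟨ cong (_* k) (ι-suc (2 ℕ.* j)) ⟩
        (1ℚ + ι (2 ℕ.* j)) * k     ≡⟨ solve 2 (λ i k → (con 1ℚ :+ i) :* k := i :* k :+ k) refl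
                                        (ι (2 ℕ.* j)) k ⟩
        ι (2 ℕ.* j) * k + k        ≡⟨ cong (_+ k) (2j*k j) ⟩
        ι j * h n + k              ∎)
      dist : ∣ X * a - X * b ∣ ≡ ∣ X ∣ * ∣ X ∣ * k
      dist = begin-equality
        ∣ X * a - X * b ∣                     ≡⟨ cong (λ t → ∣ X * a - X * t ∣) b≡ ⟩
        ∣ X * a - X * (1ℚ + (ι j * h n + k) * X) ∣
          ≡⟨ cong ∣_∣ (solve 3 (λ x t k → x :* (con 1ℚ :+ t :* x) :- x :* (con 1ℚ :+ (t :+ k) :* x)
               := :- (x :* x :* k)) refl X (ι j * h n) k) ⟩
        ∣ - (X * X * k) ∣        ≡⟨ ℚₚ.∣-p∣≡∣p∣ (X * X * k) ⟩
        ∣ X * X * k ∣            ≡⟨ ℚₚ.∣p*q∣≡∣p∣*∣q∣ (X * X) k ⟩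
        ∣ X * X ∣ * ∣ k ∣        ≡⟨ cong₂ _*_ (ℚₚ.∣p*q∣≡∣p∣*∣q∣ X X) (ℚₚ.0≤p⇒∣p∣≡p 0≤k) ⟩
        ∣ X ∣ * ∣ X ∣ * k        ∎

truncate-at-1 : ∀ {δ} → 0ℚ < δ → ∃[ δ′ ] 0ℚ < δ′ × δ′ ≤ 1ℚ × δ′ ≤ δ
truncate-at-1 {δ} 0<δ = go (ℚₚ.≤-total δ 1ℚ)
  where
  go : δ ≤ 1ℚ ⊎ 1ℚ ≤ δ → ∃[ δ′ ] 0ℚ < δ′ × δ′ ≤ 1ℚ × δ′ ≤ δ
  go (inj₁ δ≤1) = δ , 0<δ , δ≤1 , ≤-refl
  go (inj₂ 1≤δ) = 1ℚ , 0<1 , ≤-refl , 1≤δ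

log : (x : ℝ) → 0ᴿ <ᴿ x → ℝ
log x (δ₀ , 0<δ₀ , M , 0+δ₀≤x) = mkℝ (λ n → logₙ n (seq x n))
  (go (truncate-at-1 0<δ₀) (eventually-bounded (x -ᴿ 1ᴿ)))
  where
  go : (∃[ δ ] 0ℚ < δ × δ ≤ 1ℚ × δ ≤ δ₀) → EventuallyBounded (x -ᴿ 1ᴿ) →
    Small (λ m n → ∣ logₙ m (seq x m) - logₙ n (seq x n) ∣)
  go (δ , 0<δ , δ≤1 , δ≤δ₀) (B , 0<B , N , x-1≤B) =
    diagonal logₙ x Dom (M ℕ.⊔ N) 0<D (0<* 0<D (0<* 0<B 0<B))
      (λ n ≤n → ≤-trans δ≤δ₀ (subst (_≤ seq x n) (ℚₚ.+-identityˡ δ₀)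
                  (0+δ₀≤x n (ℕₚ.m⊔n≤o⇒m≤o M N ≤n)))
              , x-1≤B n (ℕₚ.m⊔n≤o⇒n≤o M N ≤n))
      (λ n _ → lipschitz n)
      (λ n _ → step n)
    where open LogBounds 0<δ δ≤1 0<B

logₙ-lower : ∀ n {ε B p} → 0ℚ < ε → 0ℚ < B → ε ≤ p - 1ℚ → p - 1ℚ ≤ B →
  ε * inv (1ℚ + B) ≤ logₙ n p
logₙ-lower n {ε} {B} {p} 0<ε 0<B ε≤X X≤B = begin
  c                                  ≡⟨ average n c ⟨
  ι (2 ℕ.^ n) * (h n * c)            ≡⟨ ∑<-const (2 ℕ.^ n) (h n * c) ⟨
  ∑< (2 ℕ.^ n) (λ _ → h n * c)       ≤⟨ ∑<-mono (2 ℕ.^ n) (λ j j< → *-monoˡ (0≤h n) (term j j<)) ⟩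
  logₙ n p                           ∎
  where
  c : ℚ
  c = ε * inv (1ℚ + B)
  0≤X : 0ℚ ≤ p - 1ℚ
  0≤X = ≤-trans (<⇒≤ 0<ε) ε≤X
  term : ∀ j → j ℕ.< 2 ℕ.^ n → c ≤ (p - 1ℚ) * inv (1ℚ + ι j * h n * (p - 1ℚ))
  term j j< = *-mono (<⇒≤ (0<inv (0<+ 0<1 (<⇒≤ 0<B)))) 0≤X ε≤X
    (inv-anti (0<+ 0<1 (0≤* (0≤node n j) 0≤X)) (ℚₚ.+-monoʳ-≤ 1ℚ (begin
      ι j * h n * (p - 1ℚ)  ≤⟨ *-monoʳ 0≤X (node≤1 n j<) ⟩
      1ℚ * (p - 1ℚ)         ≡⟨ ℚₚ.*-identityˡ (p - 1ℚ) ⟩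
      p - 1ℚ                ≤⟨ X≤B ⟩
      B                     ∎)))

log-positive : ∀ x (0<x : 0ᴿ <ᴿ x) → 1ᴿ <ᴿ x → 0ᴿ <ᴿ log x 0<x
log-positive x 0<x (ε , 0<ε , M , 1+ε≤x) = go (eventually-bounded (x -ᴿ 1ᴿ))
  where
  go : EventuallyBounded (x -ᴿ 1ᴿ) → 0ᴿ <ᴿ log x 0<x
  go (B , 0<B , N , x-1≤B) = c , 0<* 0<ε (0<inv (0<+ 0<1 (<⇒≤ 0<B))) , M ℕ.⊔ N , λ n ≤n →
    subst (_≤ logₙ n (seq x n)) (sym (ℚₚ.+-identityˡ c))
      (logₙ-lower n {p = seq x n} 0<ε 0<B (ε≤x-1 n (ℕₚ.m⊔n≤o⇒m≤o M N ≤n))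
        (≤-trans (p≤∣p∣ (seq x n - 1ℚ)) (x-1≤B n (ℕₚ.m⊔n≤o⇒n≤o M N ≤n))))
    where
    c : ℚ
    c = ε * inv (1ℚ + B)
    ε≤x-1 : ∀ n → M ℕ.≤ n → ε ≤ seq x n - 1ℚ
    ε≤x-1 n M≤n = begin
      ε              ≡⟨ solve 1 (λ e → e := con 1ℚ :+ e :- con 1ℚ) refl ε ⟩
      1ℚ + ε - 1ℚ    ≤⟨ ℚₚ.+-monoˡ-≤ (- 1ℚ) (1+ε≤x n M≤n) ⟩
      seq x n - 1ℚ   ∎

power : (x : ℝ) → 0ᴿ <ᴿ x → ℝ → ℝ
power x 0<x y = exp (y *ᴿ log x 0<x)

power-positive : ∀ x (0<x : 0ᴿ <ᴿ x) y → 0ᴿ <ᴿ power x 0<x y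
power-positive x 0<x y = exp-positive (y *ᴿ log x 0<x)

1<fromℕ : ∀ {n} → 2 ℕ.≤ n → 1ᴿ <ᴿ fromℕ n
1<fromℕ 2≤n = 1ℚ , 0<1 , 0 , λ _ _ → ι-mono 2≤n

0<fromℕ : ∀ {n} → 2 ℕ.≤ n → 0ᴿ <ᴿ fromℕ n
0<fromℕ 2≤n = 1ℚ , 0<1 , 0 , λ _ _ → ι-mono (ℕₚ.≤-trans (s≤s z≤n) 2≤n)

record FiniteSet : Set where
  field
    size       : ℕ
    elem       : Fin size → ℝ
    increasing : ∀ {i j} → i Fin.< j → elem i <ᴿ elem j

open FiniteSet public

infix 4 _∈_

_∈_ : ℝ → FiniteSet → Set
x ∈ A = ∃[ i ] x ≈ᴿ elem A i

Convex : FiniteSet → Set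
Convex A = ∀ (i j k : Fin (size A)) → toℕ j ≡ suc (toℕ i) → toℕ k ≡ suc (toℕ j) →
  elem A j -ᴿ elem A i <ᴿ elem A k -ᴿ elem A j

-- D = A - A. Equality and order of reals being undecidable, D is not computed from A;
-- it is characterised by its elements, which determine it, and hence size D, uniquely.
-- It exists up to double negation, which is harmless in front of a ¬¬-stable conclusion x ≤ᴿ y.
IsDifferenceSet : FiniteSet → FiniteSet → Set
IsDifferenceSet D A = ∀ x → x ∈ D ⇔ (∃[ a ] ∃[ b ] a ∈ A × b ∈ A × x ≈ᴿ a -ᴿ b)

module Submission where

-- Write n = |A|, m = |A - A|, and let r(x) count the representations x = a - b with a ∈ A, b ∈ B.
-- Split the indices of A and the values x with r(x) ≥ t into blocks. For fixed b the points (i, a_i - b)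
-- form a monotone chain in the resulting grid, so most of them share a cell with another one; and by
-- convexity the two values together with the difference of the two indices determine the pair. This
-- yields #{x : r(x) ≥ t} ≪ n|B|²/t³ and hence Σ r(x)³ ≪ n|B|² log n, for B = A and for B = A - A.
-- Now count the identities (a_l - a_j) - (a_l - a_i) = a_i - a_j with a_i - a_j popular, i.e. having at
-- least n²/2m representations. By Cauchy–Schwarz the square of their number is at most Σ r(x)³ (for
-- B = A) times the number of pairs (u , v) of elements of A - A with u - v popular, and the latter is
-- at most (2m/n²) #{a - u = b - v}, again controlled by the third moment (for B = A - A). The outcome
-- is n⁸ ≪ m⁵ log³ n, which is more than needed for C = 1. The order of ℝ is undecidable, but the finitely
-- many comparisons involved are decided under a double negation, the goal x ≤ᴿ y being a negation.

open import Defs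
import Data.Integer.Base as ℤ
open import Data.Product.Base using (∃-syntax; _×_)
open import Data.Rational.Base using (_/_)

open import Algebra.Bundles using (CommutativeRing)
open import Data.Empty using (⊥; ⊥-elim)
open import Data.Fin.Base as Fin using (Fin; toℕ; fromℕ<)
import Data.Fin.Properties as Finₚ
open import Data.List.Base using (List; []; _∷_; length; cartesianProduct; allFin; upTo; map; _++_)
open import Data.List.Membership.Propositional using () renaming (_∈_ to _∈ˡ_)
import Data.List.Membership.Propositional.Properties as Mem
import Data.List.Properties as Listₚ
import Data.List.Relation.Unary.All as All
open import Data.List.Relation.Unary.AllPairs using (AllPairs; []; _∷_)
import Data.List.Relation.Unary.AllPairs.Properties as APₚ
open import Data.List.Relation.Unary.Any using (here; there)
open import Data.List.Relation.Unary.Unique.Propositional using (Unique)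
import Data.List.Relation.Unary.Unique.Propositional.Properties as Uniqueₚ
open import Data.Nat.Base as ℕ using (ℕ; zero; suc; z≤n; s≤s; NonZero)
import Data.Nat.DivMod as DivMod
import Data.Nat.Properties as ℕₚ
open import Data.Nat.Tactic.RingSolver using (solve-∀)
open import Data.Product.Base using (_,_; proj₁; proj₂)
import Data.Product.Properties as Productₚ
open import Data.Rational.Base using (ℚ; 0ℚ; 1ℚ; ½; ∣_∣; positive; +-*-rawSemiring)
open import Data.Rational.Properties as ℚₚ using (≤-refl; ≤-trans; ≤-reflexive; <⇒≤)
open import Data.Rational.Solver using (module +-*-Solver)
open import Data.Sum.Base using (inj₁; inj₂)
open import Function.Base using (_∘_)
open import Function.Bundles using (Equivalence)
open import Relation.Binary.Definitions using (DecidableEquality; tri<; tri≈; tri>)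
open import Relation.Binary.PropositionalEquality
  using (_≡_; refl; sym; trans; cong; cong₂; subst; subst₂)
open import Relation.Nullary using (¬_; ¬?; Dec; yes; no; _×-dec_)

-- The bound on popular values is the one usually drawn from the Szemerédi-Trotter theorem.
-- Pigeonhole suffices here because a monotone chain meets about as many cells as the grid has rows
-- plus columns, not rows times columns. Only order, injectivity and the rigidity of gaps enter, so
-- reals are replaced by natural-number ranks (`Incidence`) before any counting, and one estimate
-- serves both choices of B. The other obstacle is that `exp` and `log` are given by approximating
-- sequences. No functional equation is established for the limits. The negated goal places |A - A|
-- below the claimed bound from some stage on, and a single late stage `N` refutes it by
-- inequalities between rationals. There AM-GM makes `expₙ N` and `logₙ N` inverse up to a factor 2.
-- With C = 1 the denominator is exp (log (log n)), for which p ≤ exp (log p) is enough. The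
-- constant c = 2⁻¹¹ is chosen so that all accumulated constants multiply to one half.

module Combinatorics where

  open import Data.Nat.Base using (_+_; _*_; _∸_; _^_; _≤_; _<_)
  open ℕₚ.≤-Reasoning

  -- Finite sums, indicators and double counting

  𝟙 : {P : Set} → Dec P → ℕ
  𝟙 (yes _) = 1
  𝟙 (no  _) = 0

  𝟙≤1 : {P : Set} (P? : Dec P) → 𝟙 P? ≤ 1
  𝟙≤1 (yes _) = ℕₚ.≤-refl
  𝟙≤1 (no  _) = z≤n

  𝟙-yes : {P : Set} (P? : Dec P) → P → 𝟙 P? ≡ 1
  𝟙-yes (yes _) p = refl
  𝟙-yes (no ¬p) p = ⊥-elim (¬p p)

  𝟙-pos : {P : Set} (P? : Dec P) → 0 < 𝟙 P? → P
  𝟙-pos (yes p) _ = p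

  𝟙-mono : {P Q : Set} (P? : Dec P) (Q? : Dec Q) → (P → Q) → 𝟙 P? ≤ 𝟙 Q?
  𝟙-mono (yes p) Q? P⇒Q = ℕₚ.≤-reflexive (sym (𝟙-yes Q? (P⇒Q p)))
  𝟙-mono (no  _) Q? P⇒Q = z≤n

  𝟙-mono-< : {P Q : Set} (P? : Dec P) (Q? : Dec Q) → ¬ P → Q → 𝟙 P? < 𝟙 Q?
  𝟙-mono-< (yes p) Q? ¬p q = ⊥-elim (¬p p)
  𝟙-mono-< (no _)  Q? ¬p q = ℕₚ.≤-reflexive (sym (𝟙-yes Q? q))

  *-pos : ∀ x y → 0 < x * y → 0 < x × 0 < y
  *-pos zero    y       ()
  *-pos (suc x) zero    0<xy = ⊥-elim (ℕₚ.<⇒≢ 0<xy (sym (ℕₚ.*-zeroʳ x)))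
  *-pos (suc x) (suc y) _    = s≤s z≤n , s≤s z≤n

  ∑ : {A : Set} → List A → (A → ℕ) → ℕ
  ∑ []       f = 0
  ∑ (x ∷ xs) f = f x + ∑ xs f

  module _ {A : Set} where

    ∑-mono-∈ : ∀ xs {f g : A → ℕ} → (∀ {x} → x ∈ˡ xs → f x ≤ g x) → ∑ xs f ≤ ∑ xs g
    ∑-mono-∈ []       f≤g = z≤n
    ∑-mono-∈ (x ∷ xs) f≤g = ℕₚ.+-mono-≤ (f≤g (here refl)) (∑-mono-∈ xs (f≤g ∘ there))

    ∑-mono : ∀ xs {f g : A → ℕ} → (∀ x → f x ≤ g x) → ∑ xs f ≤ ∑ xs g
    ∑-mono xs f≤g = ∑-mono-∈ xs (λ {x} _ → f≤g x)

    ∑-mono-< : ∀ {xs x} {f g : A → ℕ} → (∀ x → f x ≤ g x) → x ∈ˡ xs → f x < g x → ∑ xs f < ∑ xs g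
    ∑-mono-< {x ∷ xs} f≤g (here refl) fx<gx = ℕₚ.+-mono-<-≤ fx<gx (∑-mono xs f≤g)
    ∑-mono-< {x ∷ xs} f≤g (there x∈xs) fx<gx = ℕₚ.+-mono-≤-< (f≤g x) (∑-mono-< f≤g x∈xs fx<gx)

    ∑-cong : ∀ xs {f g : A → ℕ} → (∀ x → f x ≡ g x) → ∑ xs f ≡ ∑ xs g
    ∑-cong []       f≡g = refl
    ∑-cong (x ∷ xs) f≡g = cong₂ _+_ (f≡g x) (∑-cong xs f≡g)

    ∑-+ : ∀ xs (f g : A → ℕ) → ∑ xs (λ x → f x + g x) ≡ ∑ xs f + ∑ xs g
    ∑-+ []       f g = refl
    ∑-+ (x ∷ xs) f g rewrite ∑-+ xs f g = lemma (f x) (g x) (∑ xs f) (∑ xs g)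
      where
      lemma : ∀ a b c d → a + b + (c + d) ≡ a + c + (b + d)
      lemma = solve-∀

    *-∑ : ∀ c xs (f : A → ℕ) → c * ∑ xs f ≡ ∑ xs (λ x → c * f x)
    *-∑ c []       f = ℕₚ.*-zeroʳ c
    *-∑ c (x ∷ xs) f = trans (ℕₚ.*-distribˡ-+ c (f x) (∑ xs f)) (cong (c * f x +_) (*-∑ c xs f))

    ∑-* : ∀ xs (f : A → ℕ) c → ∑ xs f * c ≡ ∑ xs (λ x → f x * c)
    ∑-* []       f c = refl
    ∑-* (x ∷ xs) f c = trans (ℕₚ.*-distribʳ-+ c (f x) (∑ xs f)) (cong (f x * c +_) (∑-* xs f c))

    ∑-const : ∀ (xs : List A) c → ∑ xs (λ _ → c) ≡ length xs * c
    ∑-const []       c = refl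
    ∑-const (x ∷ xs) c = cong (c +_) (∑-const xs c)

    ∑-zero : ∀ (xs : List A) → ∑ xs (λ _ → 0) ≡ 0
    ∑-zero xs = trans (∑-const xs 0) (ℕₚ.*-zeroʳ (length xs))

    ∑-∈ : ∀ {xs x} (f : A → ℕ) → x ∈ˡ xs → f x ≤ ∑ xs f
    ∑-∈ f (here refl) = ℕₚ.m≤m+n _ _
    ∑-∈ f (there x∈xs) = ℕₚ.m≤n⇒m≤o+n _ (∑-∈ f x∈xs)

    ∑-pos : ∀ xs (f : A → ℕ) → 0 < ∑ xs f → ∃[ x ] 0 < f x
    ∑-pos (x ∷ xs) f 0<∑ with f x in eq
    ... | zero  = ∑-pos xs f 0<∑
    ... | suc _ = x , subst (0 <_) (sym eq) (s≤s z≤n)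

    ∑-≤1 : ∀ {xs} → Unique xs → ∀ (f : A → ℕ) → (∀ x → f x ≤ 1) →
      (∀ {x y} → 0 < f x → 0 < f y → x ≡ y) → ∑ xs f ≤ 1
    ∑-≤1 []                    f f≤1 f-inj = z≤n
    ∑-≤1 {x ∷ xs} (x∉xs ∷ uniq) f f≤1 f-inj with f x in eq
    ... | zero  = ∑-≤1 uniq f f≤1 f-inj
    ... | suc k = begin
      suc k + ∑ xs f         ≤⟨ ℕₚ.+-mono-≤ (subst (_≤ 1) eq (f≤1 x)) (∑-mono-∈ xs {g = λ _ → 0} vanish) ⟩
      1 + ∑ xs (λ _ → 0)     ≡⟨ cong (1 +_) (∑-zero xs) ⟩
      1                      ∎
      where
      vanish : ∀ {y} → y ∈ˡ xs → f y ≤ 0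
      vanish {y} y∈xs with f y in eq′
      ... | zero  = z≤n
      ... | suc _ = ⊥-elim (All.lookup x∉xs y∈xs
                      (f-inj (subst (0 <_) (sym eq) (s≤s z≤n)) (subst (0 <_) (sym eq′) (s≤s z≤n))))

  module _ {A B : Set} where

    ∑-swap : ∀ xs ys (f : A → B → ℕ) → ∑ xs (λ x → ∑ ys (f x)) ≡ ∑ ys (λ y → ∑ xs (λ x → f x y))
    ∑-swap []       ys f = sym (∑-zero ys)
    ∑-swap (x ∷ xs) ys f = trans (cong (∑ ys (f x) +_) (∑-swap xs ys f))
      (sym (∑-+ ys (f x) (λ y → ∑ xs (λ x → f x y))))

    ∑-product : ∀ xs ys (f : A × B → ℕ) → ∑ (cartesianProduct xs ys) f ≡ ∑ xs (λ x → ∑ ys (λ y → f (x , y)))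
    ∑-product []       ys f = refl
    ∑-product (x ∷ xs) ys f = trans (row ys) (cong (∑ ys (λ y → f (x , y)) +_) (∑-product xs ys f))
      where
      row : ∀ zs → ∑ (map (x ,_) zs ++ cartesianProduct xs ys) f
                 ≡ ∑ zs (λ y → f (x , y)) + ∑ (cartesianProduct xs ys) f
      row []       = refl
      row (z ∷ zs) = trans (cong (f (x , z) +_) (row zs)) (sym (ℕₚ.+-assoc (f (x , z)) _ _))

  module Fibres {B : Set} (_≟_ : DecidableEquality B) where

    ∑-𝟙≟ : ∀ {ys y} → Unique ys → y ∈ˡ ys → (f : B → ℕ) → ∑ ys (λ z → 𝟙 (y ≟ z) * f z) ≡ f y
    ∑-𝟙≟ {_ ∷ ys} {y} (y∉ys ∷ _) (here refl) f = begin-equality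
      𝟙 (y ≟ y) * f y + ∑ ys (λ z → 𝟙 (y ≟ z) * f z)
        ≡⟨ cong₂ _+_ (cong (_* f y) (𝟙-yes (y ≟ y) refl)) (ℕₚ.n≤0⇒n≡0 (begin
             ∑ ys (λ z → 𝟙 (y ≟ z) * f z)  ≤⟨ ∑-mono-∈ ys vanish ⟩
             ∑ ys (λ _ → 0)                ≡⟨ ∑-zero ys ⟩
             0                             ∎)) ⟩
      1 * f y + 0  ≡⟨ trans (ℕₚ.+-identityʳ _) (ℕₚ.*-identityˡ _) ⟩
      f y          ∎
      where
      vanish : ∀ {z} → z ∈ˡ ys → 𝟙 (y ≟ z) * f z ≤ 0
      vanish {z} z∈ys with y ≟ z
      ... | yes y≡z = ⊥-elim (All.lookup y∉ys z∈ys y≡z)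
      ... | no  _   = z≤n
    ∑-𝟙≟ {z ∷ ys} {y} (z∉ys ∷ uniq) (there y∈ys) f with y ≟ z
    ... | yes y≡z = ⊥-elim (All.lookup z∉ys y∈ys (sym y≡z))
    ... | no  _   = ∑-𝟙≟ uniq y∈ys f

    module _ {A : Set} (xs : List A) (φ : A → B) where

      fibre : B → ℕ
      fibre y = ∑ xs (λ x → 𝟙 (φ x ≟ y))

      -- Change of variables: both sides count pairs with `φ x` equal to `y`, weighted by `f y`. For
      -- a difference map `φ`, `fibre` is the representation function r.
      ∑-fibres : ∀ {ys} → Unique ys → (∀ x → φ x ∈ˡ ys) → (f : B → ℕ) →
        ∑ xs (λ x → f (φ x)) ≡ ∑ ys (λ y → fibre y * f y)
      ∑-fibres {ys} uniq φ∈ys f = begin-equality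
        ∑ xs (λ x → f (φ x))
          ≡⟨ ∑-cong xs (λ x → sym (∑-𝟙≟ uniq (φ∈ys x) f)) ⟩
        ∑ xs (λ x → ∑ ys (λ y → 𝟙 (φ x ≟ y) * f y))
          ≡⟨ ∑-swap xs ys (λ x y → 𝟙 (φ x ≟ y) * f y) ⟩
        ∑ ys (λ y → ∑ xs (λ x → 𝟙 (φ x ≟ y) * f y))
          ≡⟨ ∑-cong ys (λ y → sym (∑-* xs (λ x → 𝟙 (φ x ≟ y)) (f y))) ⟩
        ∑ ys (λ y → fibre y * f y)  ∎

    -- Every `x` with `P x` owns a pair (x , φ x), and over each `y` there is at most one such pair.
    ∑-injection : ∀ {A : Set} {xs : List A} {ys : List B} {P : A → Set} → Unique xs →
      (P? : ∀ x → Dec (P x)) (φ : A → B) → (∀ {x} → P x → φ x ∈ˡ ys) →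
      (∀ {x y} → P x → P y → φ x ≡ φ y → x ≡ y) → ∑ xs (λ x → 𝟙 (P? x)) ≤ length ys
    ∑-injection {A} {xs} {ys} {P} uniq P? φ φ∈ys φ-inj = begin
      ∑ xs (λ x → 𝟙 (P? x))                              ≤⟨ ∑-mono xs into ⟩
      ∑ xs (λ x → ∑ ys (λ y → 𝟙 (P? x ×-dec (φ x ≟ y)))) ≡⟨ ∑-swap xs ys _ ⟩
      ∑ ys (λ y → ∑ xs (λ x → 𝟙 (P? x ×-dec (φ x ≟ y)))) ≤⟨ ∑-mono ys once ⟩
      ∑ ys (λ _ → 1)                                     ≡⟨ ∑-const ys 1 ⟩
      length ys * 1                                      ≡⟨ ℕₚ.*-identityʳ _ ⟩
      length ys                                          ∎
      where
      into : ∀ x → 𝟙 (P? x) ≤ ∑ ys (λ y → 𝟙 (P? x ×-dec (φ x ≟ y)))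
      into x with P? x in eq
      ... | no  _  = z≤n
      ... | yes px = begin
        1                          ≡⟨ 𝟙-yes (yes px ×-dec (φ x ≟ φ x)) (px , refl) ⟨
        𝟙 (yes px ×-dec (φ x ≟ φ x))
          ≤⟨ ∑-∈ (λ y → 𝟙 (yes px ×-dec (φ x ≟ y))) (φ∈ys px) ⟩
        ∑ ys (λ y → 𝟙 (yes px ×-dec (φ x ≟ y))) ∎
      once : ∀ y → ∑ xs (λ x → 𝟙 (P? x ×-dec (φ x ≟ y))) ≤ 1
      once y = ∑-≤1 uniq _ (λ x → 𝟙≤1 (P? x ×-dec (φ x ≟ y))) λ {x} {x′} 0<x 0<x′ →
        let px , φx≡y = 𝟙-pos (P? x ×-dec (φ x ≟ y)) 0<x
            px′ , φx′≡y = 𝟙-pos (P? x′ ×-dec (φ x′ ≟ y)) 0<x′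
        in φ-inj px px′ (trans φx≡y (sym φx′≡y))

  -- Pigeonhole with collisions

  module _ {A : Set} {_≺_ : A → A → Set} (_≺?_ : ∀ x y → Dec (x ≺ y)) where

    -- A class of size c contains at least c(c - 1)/2 pairs `x ≺ y`, and c ≤ 1 + c(c - 1)/2. In the
    -- induction the head, if it belongs to the class, pairs with all later members.
    class≤1+pairs : ∀ {xs} → AllPairs _≺_ xs → (f : A → ℕ) → (∀ x → f x ≤ 1) →
      ∑ xs f ≤ 1 + ∑ xs (λ x → ∑ xs (λ y → 𝟙 (x ≺? y) * (f x * f y)))
    class≤1+pairs []                   f f≤1 = z≤n
    class≤1+pairs {x ∷ xs} (x≺xs ∷ ord) f f≤1 = begin
      f x + ∑ xs f                            ≤⟨ cases (f x) (∑ xs f) (f≤1 x) (class≤1+pairs ord f f≤1) ⟩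
      1 + (f x * ∑ xs f + rest)
        ≡⟨ cong (λ t → 1 + (t + rest)) (*-∑ (f x) xs f) ⟩
      1 + (∑ xs (λ y → f x * f y) + rest)
        ≤⟨ ℕₚ.+-monoʳ-≤ 1 (ℕₚ.+-mono-≤ (∑-mono-∈ xs (λ {y} y∈xs → ℕₚ.≤-reflexive (sym
             (trans (cong (_* (f x * f y)) (𝟙-yes (x ≺? y) (All.lookup x≺xs y∈xs))) (ℕₚ.*-identityˡ _)))))
             (∑-mono xs (λ y → ℕₚ.m≤n+m (∑ xs (λ z → g y z)) (g y x)))) ⟩
      1 + (∑ xs (g x) + ∑ xs (λ y → ∑ (x ∷ xs) (g y)))
        ≤⟨ ℕₚ.+-monoʳ-≤ 1 (ℕₚ.+-monoˡ-≤ _ (ℕₚ.m≤n+m (∑ xs (g x)) (g x x))) ⟩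
      1 + (∑ (x ∷ xs) (g x) + ∑ xs (λ y → ∑ (x ∷ xs) (g y))) ∎
      where
      g : A → A → ℕ
      g x y = 𝟙 (x ≺? y) * (f x * f y)
      rest : ℕ
      rest = ∑ xs (λ y → ∑ xs (g y))
      cases : ∀ c S {P} → c ≤ 1 → S ≤ 1 + P → c + S ≤ 1 + (c * S + P)
      cases zero          S c≤1 S≤ = S≤
      cases (suc zero)    S {P} c≤1 S≤ = ℕₚ.+-monoʳ-≤ 1 (ℕₚ.≤-trans (ℕₚ.≤-reflexive (sym (ℕₚ.+-identityʳ S))) (ℕₚ.m≤m+n (S + 0) P))
      cases (suc (suc _)) S (s≤s ()) S≤

    -- `class≤1+pairs` is applied to every class of `κ`: the ones add up to `length vs`, and a
    -- colliding pair lies in exactly one class.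
    pigeonhole : ∀ {xs vs} → AllPairs _≺_ xs → Unique vs → {P : A → Set} (P? : ∀ x → Dec (P x))
      (κ : A → ℕ) → (∀ {x} → P x → κ x ∈ˡ vs) →
      ∑ xs (λ x → 𝟙 (P? x)) ≤ length vs +
        ∑ xs (λ x → ∑ xs (λ y → 𝟙 ((x ≺? y) ×-dec (P? x ×-dec P? y) ×-dec (κ x ℕₚ.≟ κ y))))
    pigeonhole {xs} {vs} ord uniq {P} P? κ κ∈vs = begin
      ∑ xs (λ x → 𝟙 (P? x))
        ≤⟨ ∑-mono xs (λ x → into x) ⟩
      ∑ xs (λ x → ∑ vs (λ v → f v x))                      ≡⟨ ∑-swap xs vs (λ x v → f v x) ⟩
      ∑ vs (λ v → ∑ xs (f v))
        ≤⟨ ∑-mono vs (λ v → class≤1+pairs ord (f v) (λ x → 𝟙≤1 (P? x ×-dec (κ x ℕₚ.≟ v)))) ⟩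
      ∑ vs (λ v → 1 + ∑ xs (λ x → ∑ xs (λ y → 𝟙 (x ≺? y) * (f v x * f v y))))
        ≡⟨ ∑-+ vs (λ _ → 1) _ ⟩
      ∑ vs (λ _ → 1) + ∑ vs (λ v → ∑ xs (λ x → ∑ xs (λ y → 𝟙 (x ≺? y) * (f v x * f v y))))
        ≡⟨ cong₂ _+_ (trans (∑-const vs 1) (ℕₚ.*-identityʳ _))
             (trans (∑-swap vs xs _) (∑-cong xs (λ x → ∑-swap vs xs _))) ⟩
      length vs + ∑ xs (λ x → ∑ xs (λ y → ∑ vs (λ v → 𝟙 (x ≺? y) * (f v x * f v y))))
        ≤⟨ ℕₚ.+-monoʳ-≤ (length vs) (∑-mono xs (λ x → ∑-mono xs (λ y → collide x y))) ⟩
      length vs + ∑ xs (λ x → ∑ xs (λ y → 𝟙 ((x ≺? y) ×-dec (P? x ×-dec P? y) ×-dec (κ x ℕₚ.≟ κ y)))) ∎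
      where
      f : ℕ → A → ℕ
      f v x = 𝟙 (P? x ×-dec (κ x ℕₚ.≟ v))
      into : ∀ x → 𝟙 (P? x) ≤ ∑ vs (λ v → f v x)
      into x with P? x
      ... | no  _  = z≤n
      ... | yes px = ℕₚ.≤-trans (ℕₚ.≤-reflexive (sym (𝟙-yes (yes px ×-dec (κ x ℕₚ.≟ κ x)) (px , refl))))
                       (∑-∈ (λ v → 𝟙 (yes px ×-dec (κ x ℕₚ.≟ v))) (κ∈vs px))
      cell : ∀ v x y → 0 < 𝟙 (x ≺? y) * (f v x * f v y) →
        x ≺ y × P x × P y × κ x ≡ v × κ y ≡ v
      cell v x y 0<t with *-pos (𝟙 (x ≺? y)) (f v x * f v y) 0<t
      ... | 0<x≺y , 0<ff with *-pos (f v x) (f v y) 0<ff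
      ... | 0<fx , 0<fy with 𝟙-pos (P? x ×-dec (κ x ℕₚ.≟ v)) 0<fx | 𝟙-pos (P? y ×-dec (κ y ℕₚ.≟ v)) 0<fy
      ... | px , κx | py , κy = 𝟙-pos (x ≺? y) 0<x≺y , px , py , κx , κy
      collide : ∀ x y → ∑ vs (λ v → 𝟙 (x ≺? y) * (f v x * f v y))
                      ≤ 𝟙 ((x ≺? y) ×-dec (P? x ×-dec P? y) ×-dec (κ x ℕₚ.≟ κ y))
      collide x y with ∑ vs (λ v → 𝟙 (x ≺? y) * (f v x * f v y)) in eq
      ... | zero  = z≤n
      ... | suc k with ∑-pos vs (λ v → 𝟙 (x ≺? y) * (f v x * f v y)) (subst (0 <_) (sym eq) (s≤s z≤n))
      ... | v , 0<t with cell v x y 0<t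
      ... | x≺y , px , py , κx , κy = begin
        suc k  ≡⟨ eq ⟨
        ∑ vs (λ v → 𝟙 (x ≺? y) * (f v x * f v y))
          ≤⟨ ∑-≤1 uniq _ (λ v → ℕₚ.*-mono-≤ (𝟙≤1 (x ≺? y))
               (ℕₚ.*-mono-≤ (𝟙≤1 (P? x ×-dec (κ x ℕₚ.≟ v))) (𝟙≤1 (P? y ×-dec (κ y ℕₚ.≟ v)))))
               (λ {v} {w} 0<v 0<w → κ-unique (cell v x y 0<v) (cell w x y 0<w)) ⟩
        1      ≡⟨ 𝟙-yes ((x ≺? y) ×-dec (P? x ×-dec P? y) ×-dec (κ x ℕₚ.≟ κ y))
                    (x≺y , (px , py) , trans κx (sym κy)) ⟨
        𝟙 ((x ≺? y) ×-dec (P? x ×-dec P? y) ×-dec (κ x ℕₚ.≟ κ y)) ∎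
        where
        κ-unique : ∀ {v w} → x ≺ y × P x × P y × κ x ≡ v × κ y ≡ v →
          x ≺ y × P x × P y × κ x ≡ w × κ y ≡ w → v ≡ w
        κ-unique (_ , _ , _ , p , _) (_ , _ , _ , q , _) = trans (sym p) q

  -- Cauchy-Schwarz with natural-number weights

  2xy≤x²+y² : ∀ x y → 2 * (x * y) ≤ x * x + y * y
  2xy≤x²+y² x y with ℕₚ.≤-total x y
  ... | inj₁ x≤y = subst (λ z → 2 * (x * z) ≤ x * x + z * z) (ℕₚ.m+[n∸m]≡n x≤y) (lemma x (y ℕ.∸ x))
    where
    lemma : ∀ x d → 2 * (x * (x + d)) ≤ x * x + (x + d) * (x + d)
    lemma x d = ℕₚ.≤-trans (ℕₚ.m≤m+n _ (d * d)) (ℕₚ.≤-reflexive (identity x d))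
      where
      identity : ∀ x d → 2 * (x * (x + d)) + d * d ≡ x * x + (x + d) * (x + d)
      identity = solve-∀
  ... | inj₂ y≤x = subst (λ z → 2 * (z * y) ≤ z * z + y * y) (ℕₚ.m+[n∸m]≡n y≤x) (lemma y (x ℕ.∸ y))
    where
    lemma : ∀ y d → 2 * ((y + d) * y) ≤ (y + d) * (y + d) + y * y
    lemma y d = ℕₚ.≤-trans (ℕₚ.m≤m+n _ (d * d)) (ℕₚ.≤-reflexive (identity y d))
      where
      identity : ∀ y d → 2 * ((y + d) * y) + d * d ≡ (y + d) * (y + d) + y * y
      identity = solve-∀

  module _ {A : Set} (w f : A → ℕ) where

    -- The sum of w x (f x - c)² is nonnegative, written without subtraction. With c the new value
    -- of `f` it handles the cross term in the induction for `cauchy-schwarz`.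
    2c∑≤ : ∀ c xs → 2 * (c * ∑ xs (λ x → w x * f x)) ≤ ∑ xs (λ x → w x * (f x * f x)) + ∑ xs w * (c * c)
    2c∑≤ c []       = ℕₚ.≤-reflexive (cong (2 *_) (ℕₚ.*-zeroʳ c))
    2c∑≤ c (x ∷ xs) = begin
      2 * (c * (w x * f x + S))                    ≡⟨ expand c (w x) (f x) S ⟩
      w x * (2 * (f x * c)) + 2 * (c * S)
        ≤⟨ ℕₚ.+-mono-≤ (ℕₚ.*-monoʳ-≤ (w x) (2xy≤x²+y² (f x) c)) (2c∑≤ c xs) ⟩
      w x * (f x * f x + c * c) + (Q + W * (c * c)) ≡⟨ collect c (w x) (f x) Q W ⟩
      w x * (f x * f x) + Q + (w x + W) * (c * c)   ∎
      where
      S Q W : ℕ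
      S = ∑ xs (λ x → w x * f x)
      Q = ∑ xs (λ x → w x * (f x * f x))
      W = ∑ xs w
      expand : ∀ c w f S → 2 * (c * (w * f + S)) ≡ w * (2 * (f * c)) + 2 * (c * S)
      expand = solve-∀
      collect : ∀ c w f Q W → w * (f * f + c * c) + (Q + W * (c * c)) ≡ w * (f * f) + Q + (w + W) * (c * c)
      collect = solve-∀

    cauchy-schwarz : ∀ xs → ∑ xs (λ x → w x * f x) * ∑ xs (λ x → w x * f x)
                          ≤ ∑ xs w * ∑ xs (λ x → w x * (f x * f x))
    cauchy-schwarz []       = z≤n
    cauchy-schwarz (x ∷ xs) = begin
      (w x * f x + S) * (w x * f x + S)  ≡⟨ expand (w x) (f x) S ⟩
      w x * (w x * (f x * f x)) + w x * (2 * (f x * S)) + S * S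
        ≤⟨ ℕₚ.+-mono-≤ (ℕₚ.+-monoʳ-≤ (w x * (w x * (f x * f x))) (ℕₚ.*-monoʳ-≤ (w x) (2c∑≤ (f x) xs)))
             (cauchy-schwarz xs) ⟩
      w x * (w x * (f x * f x)) + w x * (Q + W * (f x * f x)) + W * Q  ≡⟨ collect (w x) (f x) Q W ⟩
      (w x + W) * (w x * (f x * f x) + Q)  ∎
      where
      S Q W : ℕ
      S = ∑ xs (λ x → w x * f x)
      Q = ∑ xs (λ x → w x * (f x * f x))
      W = ∑ xs w
      expand : ∀ w f S → (w * f + S) * (w * f + S) ≡ w * (w * (f * f)) + w * (2 * (f * S)) + S * S
      expand = solve-∀
      collect : ∀ w f Q W → w * (w * (f * f)) + w * (Q + W * (f * f)) + W * Q ≡ (w + W) * (w * (f * f) + Q)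
      collect = solve-∀


  -- The third moment of the representation function

  private
    module Fℕ = Fibres ℕₚ._≟_

  same-quotient⇒∸< : ∀ a b q .{{_ : NonZero q}} → a ℕ./ q ≡ b ℕ./ q → b ∸ a < q
  same-quotient⇒∸< a b q a/q≡b/q = begin-strict
    b ∸ a                                      ≤⟨ ℕₚ.∸-monoʳ-≤ b (DivMod.m/n*n≤m a q) ⟩
    b ∸ a ℕ./ q * q                            ≡⟨ cong₂ (λ s t → s ∸ t * q) (DivMod.m≡m%n+[m/n]*n b q) a/q≡b/q ⟩
    b ℕ.% q + b ℕ./ q * q ∸ b ℕ./ q * q        ≡⟨ ℕₚ.m+n∸n≡m (b ℕ.% q) (b ℕ./ q * q) ⟩
    b ℕ.% q                                    <⟨ DivMod.m%n<n b q ⟩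
    q                                          ∎

  +-split-≡ : ∀ {a b c d} → a ≤ b → c ≤ d → a + c ≡ b + d → a ≡ b × c ≡ d
  +-split-≡ {a} {b} {c} {d} a≤b c≤d eq with ℕₚ.m≤n⇒m<n∨m≡n a≤b
  ... | inj₁ a<b = ⊥-elim (ℕₚ.<⇒≢ (ℕₚ.+-mono-<-≤ a<b c≤d) eq)
  ... | inj₂ refl = refl , ℕₚ.+-cancelˡ-≡ a c d eq

  allFin-sorted : ∀ n → AllPairs Fin._<_ (allFin n)
  allFin-sorted n = APₚ.tabulate⁺-< (λ i<j → i<j)

  length-allFin : ∀ n → length (allFin n) ≡ n
  length-allFin n = Listₚ.length-tabulate (λ i → i)

  ∑-allFin-const : ∀ n c → ∑ (allFin n) (λ _ → c) ≡ n * c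
  ∑-allFin-const n c = trans (∑-const (allFin n) c) (cong (_* c) (length-allFin n))

  length-product : {A B : Set} (xs : List A) (ys : List B) →
    length (cartesianProduct xs ys) ≡ length xs * length ys
  length-product []       ys = refl
  length-product (x ∷ xs) ys = trans (Listₚ.length-++ (map (x ,_) ys))
    (cong₂ _+_ (Listₚ.length-map (x ,_) ys) (length-product xs ys))

  -- `ρ i k` stands for the position of a_i - b_k in the order of the differences. The field
  -- `convex` is all that is kept of the convexity of A: two equal gaps a_j - a_i that span equally
  -- many indices start at the same index.
  record Incidence {n m : ℕ} (ρ : Fin n → Fin m → ℕ) (R : ℕ) : Set where
    field
      bounded   : ∀ i k → ρ i k < R
      monotone  : ∀ {i j} k → i Fin.< j → ρ i k < ρ j k
      injective : ∀ i {k k′} → ρ i k ≡ ρ i k′ → k ≡ k′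
      convex    : ∀ {i j i′ j′ k k′} → i Fin.< j → i′ Fin.< j′ → toℕ j ∸ toℕ i ≡ toℕ j′ ∸ toℕ i′ →
                  ρ i k ≡ ρ i′ k′ → ρ j k ≡ ρ j′ k′ → i ≡ i′

  module _ {n m : ℕ} (ρ : Fin n → Fin m → ℕ) where

    points : List (Fin n × Fin m)
    points = cartesianProduct (allFin n) (allFin m)

    value : Fin n × Fin m → ℕ
    value p = ρ (proj₁ p) (proj₂ p)

    rep : ℕ → ℕ
    rep = Fℕ.fibre points value

  module ThirdMoment {n m : ℕ} {ρ : Fin n → Fin m → ℕ} {R : ℕ} (inc : Incidence ρ R) where

    open Incidence inc

    r : ℕ → ℕ
    r = rep ρ

    r≤n : ∀ x → r x ≤ n
    r≤n x = begin
      r x                                                     ≡⟨ ∑-product (allFin n) (allFin m) _ ⟩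
      ∑ (allFin n) (λ i → ∑ (allFin m) (λ k → 𝟙 (ρ i k ℕₚ.≟ x)))
        ≤⟨ ∑-mono (allFin n) (λ i → ∑-≤1 (Uniqueₚ.allFin⁺ m) _ (λ k → 𝟙≤1 (ρ i k ℕₚ.≟ x))
             (λ {k} {k′} 0<k 0<k′ → injective i (trans (𝟙-pos (ρ i k ℕₚ.≟ x) 0<k) (sym (𝟙-pos (ρ i k′ ℕₚ.≟ x) 0<k′))))) ⟩
      ∑ (allFin n) (λ _ → 1)                                  ≡⟨ trans (∑-allFin-const n 1) (ℕₚ.*-identityʳ n) ⟩
      n                                                       ∎

    monotone-injective : ∀ {i j} k → ρ i k ≡ ρ j k → i ≡ j
    monotone-injective {i} {j} k eq with Finₚ.<-cmp i j
    ... | tri< i<j _ _ = ⊥-elim (ℕₚ.<⇒≢ (monotone k i<j) eq)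
    ... | tri≈ _ i≡j _ = i≡j
    ... | tri> _ _ j<i = ⊥-elim (ℕₚ.<⇒≢ (monotone k j<i) (sym eq))

    r≤m : ∀ x → r x ≤ m
    r≤m x = begin
      r x                                                     ≡⟨ ∑-product (allFin n) (allFin m) _ ⟩
      ∑ (allFin n) (λ i → ∑ (allFin m) (λ k → 𝟙 (ρ i k ℕₚ.≟ x))) ≡⟨ ∑-swap (allFin n) (allFin m) _ ⟩
      ∑ (allFin m) (λ k → ∑ (allFin n) (λ i → 𝟙 (ρ i k ℕₚ.≟ x)))
        ≤⟨ ∑-mono (allFin m) (λ k → ∑-≤1 (Uniqueₚ.allFin⁺ n) _ (λ i → 𝟙≤1 (ρ i k ℕₚ.≟ x))
             (λ {i} {i′} 0<i 0<i′ → monotone-injective k (trans (𝟙-pos (ρ i k ℕₚ.≟ x) 0<i) (sym (𝟙-pos (ρ i′ k ℕₚ.≟ x) 0<i′))))) ⟩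
      ∑ (allFin m) (λ _ → 1)                                  ≡⟨ trans (∑-allFin-const m 1) (ℕₚ.*-identityʳ m) ⟩
      m                                                       ∎

    value∈ : ∀ p → value ρ p ∈ˡ upTo R
    value∈ (i , k) = Mem.∈-upTo⁺ (bounded i k)

    ∑-values : (f : ℕ → ℕ) → ∑ (points ρ) (λ p → f (value ρ p)) ≡ ∑ (upTo R) (λ x → r x * f x)
    ∑-values = Fℕ.∑-fibres (points ρ) (value ρ) (Uniqueₚ.upTo⁺ R) value∈

    ∑r : ∑ (upTo R) r ≡ n * m
    ∑r = begin-equality
      ∑ (upTo R) r                ≡⟨ ∑-cong (upTo R) (λ x → sym (ℕₚ.*-identityʳ (r x))) ⟩
      ∑ (upTo R) (λ x → r x * 1)  ≡⟨ ∑-values (λ _ → 1) ⟨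
      ∑ (points ρ) (λ _ → 1)      ≡⟨ ∑-product (allFin n) (allFin m) _ ⟩
      ∑ (allFin n) (λ _ → ∑ (allFin m) (λ _ → 1))
        ≡⟨ trans (∑-allFin-const n _) (cong (n *_) (trans (∑-allFin-const m 1) (ℕₚ.*-identityʳ m))) ⟩
      n * m                       ∎

    module Level (t : ℕ) where

      Rich? : ∀ x → Dec (t ≤ r x)
      Rich? x = t ℕₚ.≤? r x

      X : ℕ
      X = ∑ (upTo R) (λ x → 𝟙 (Rich? x))

      -- Renumbers the rich values consecutively from 0, so that blocks of `q` of them are classes
      -- of equal quotient by `q`.
      rank : ℕ → ℕ
      rank y = ∑ (upTo R) (λ x → 𝟙 ((x ℕₚ.<? y) ×-dec Rich? x))

      rank-< : ∀ {x y} → x < R → t ≤ r x → x < y → rank x < rank y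
      rank-< {x} {y} x<R rich x<y = ∑-mono-<
        (λ z → 𝟙-mono ((z ℕₚ.<? x) ×-dec Rich? z) ((z ℕₚ.<? y) ×-dec Rich? z)
                 (λ (z<x , rz) → ℕₚ.<-trans z<x x<y , rz))
        (Mem.∈-upTo⁺ x<R) (𝟙-mono-< ((x ℕₚ.<? x) ×-dec Rich? x) ((x ℕₚ.<? y) ×-dec Rich? x)
        (λ (x<x , _) → ℕₚ.<-irrefl refl x<x) (x<y , rich))

      rank<X : ∀ {x} → x < R → t ≤ r x → rank x < X
      rank<X {x} x<R rich = ℕₚ.<-≤-trans (rank-< x<R rich ℕₚ.≤-refl)
        (∑-mono (upTo R) (λ z → 𝟙-mono ((z ℕₚ.<? suc x) ×-dec Rich? z) (Rich? z) proj₂))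

      rank-injective : ∀ {x y} → x < R → y < R → t ≤ r x → t ≤ r y → rank x ≡ rank y → x ≡ y
      rank-injective {x} {y} x<R y<R rx ry eq with ℕₚ.<-cmp x y
      ... | tri< x<y _ _ = ⊥-elim (ℕₚ.<⇒≢ (rank-< x<R rx x<y) eq)
      ... | tri≈ _ x≡y _ = x≡y
      ... | tri> _ _ y<x = ⊥-elim (ℕₚ.<⇒≢ (rank-< y<R ry y<x) (sym eq))

      tX≤∑𝟙r : t * X ≤ ∑ (upTo R) (λ x → r x * 𝟙 (Rich? x))
      tX≤∑𝟙r = begin
        t * X                                    ≡⟨ *-∑ t (upTo R) _ ⟩
        ∑ (upTo R) (λ x → t * 𝟙 (Rich? x))       ≤⟨ ∑-mono (upTo R) (λ x → rich x (Rich? x)) ⟩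
        ∑ (upTo R) (λ x → r x * 𝟙 (Rich? x))     ∎
        where
        rich : ∀ x (d : Dec (t ≤ r x)) → t * 𝟙 d ≤ r x * 𝟙 d
        rich x (yes t≤r) = ℕₚ.*-monoˡ-≤ 1 t≤r
        rich x (no _)    = ℕₚ.≤-reflexive (trans (ℕₚ.*-zeroʳ t) (sym (ℕₚ.*-zeroʳ (r x))))

      tX≤nm : t * X ≤ n * m
      tX≤nm = begin
        t * X                                  ≤⟨ tX≤∑𝟙r ⟩
        ∑ (upTo R) (λ x → r x * 𝟙 (Rich? x))   ≤⟨ ∑-mono (upTo R) (λ x → ℕₚ.*-monoʳ-≤ (r x) (𝟙≤1 (Rich? x))) ⟩
        ∑ (upTo R) (λ x → r x * 1)             ≡⟨ ∑-cong (upTo R) (λ x → ℕₚ.*-identityʳ (r x)) ⟩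
        ∑ (upTo R) r                           ≡⟨ ∑r ⟩
        n * m                                  ∎

      -- Cut the indices into blocks of length g and the rich values into blocks of length q;
      -- each sequence i ↦ ρ i k runs monotonically through the resulting grid of cells.
      module Grid (g q : ℕ) .{{_ : NonZero g}} .{{_ : NonZero q}} where

        -- Names a cell by the sum of its two coordinates. Along a chain neither coordinate
        -- decreases, so equal sums force equal cells, and only `cells` names occur.
        κ : Fin m → Fin n → ℕ
        κ k i = toℕ i ℕ./ g + rank (ρ i k) ℕ./ q

        cells : ℕ
        cells = suc (n ℕ./ g + X ℕ./ q)

        Pair : Fin m × Fin n × Fin n → Set
        Pair (k , i , j) = i Fin.< j × (t ≤ r (ρ i k) × t ≤ r (ρ j k)) × κ k i ≡ κ k j

        Pair? : ∀ p → Dec (Pair p)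
        Pair? (k , i , j) = (i Finₚ.<? j) ×-dec (Rich? (ρ i k) ×-dec Rich? (ρ j k)) ×-dec (κ k i ℕₚ.≟ κ k j)

        -- The lower value, the distance to the upper value and the distance of the indices. Within
        -- one cell the distances are below `q` and `g`, which leaves X · q · g codes.
        code : Fin m × Fin n × Fin n → ℕ × ℕ × ℕ
        code (k , i , j) = rank (ρ i k) , rank (ρ j k) ∸ rank (ρ i k) , toℕ j ∸ toℕ i

        rank-≤ : ∀ {k i j} → Pair (k , i , j) → rank (ρ i k) ≤ rank (ρ j k)
        rank-≤ {k} {i} {j} (i<j , (ri , _) , _) = ℕₚ.<⇒≤ (rank-< (bounded i k) ri (monotone k i<j))

        code∈ : ∀ {p} → Pair p → code p ∈ˡ cartesianProduct (upTo X) (cartesianProduct (upTo q) (upTo g))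
        code∈ {k , i , j} P@(i<j , (ri , rj) , κ≡) =
          let i/g≡ , rk/q≡ = +-split-≡ (DivMod./-monoˡ-≤ g (ℕₚ.<⇒≤ i<j)) (DivMod./-monoˡ-≤ q (rank-≤ P)) κ≡
          in Mem.∈-cartesianProduct⁺ (Mem.∈-upTo⁺ (rank<X (bounded i k) ri))
               (Mem.∈-cartesianProduct⁺ (Mem.∈-upTo⁺ (same-quotient⇒∸< (rank (ρ i k)) (rank (ρ j k)) q rk/q≡))
                                        (Mem.∈-upTo⁺ (same-quotient⇒∸< (toℕ i) (toℕ j) g i/g≡)))

        -- The code fixes both values and the index gap. Convexity then fixes `i`, injectivity of
        -- `ρ i` fixes `k`, and strict monotonicity of the chain fixes `j`.
        code-injective : ∀ {p p′} → Pair p → Pair p′ → code p ≡ code p′ → p ≡ p′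
        code-injective {k , i , j} {k′ , i′ , j′} P@(i<j , (ri , rj) , _) P′@(i′<j′ , (ri′ , rj′) , _) eq =
          finish (convex i<j i′<j′ gap ρi≡ ρj≡)
          where
          rank≡ : rank (ρ i k) ≡ rank (ρ i′ k′)
          rank≡ = cong proj₁ eq
          gap : toℕ j ∸ toℕ i ≡ toℕ j′ ∸ toℕ i′
          gap = cong (proj₂ ∘ proj₂) eq
          ρi≡ : ρ i k ≡ ρ i′ k′
          ρi≡ = rank-injective (bounded i k) (bounded i′ k′) ri ri′ rank≡
          ρj≡ : ρ j k ≡ ρ j′ k′
          ρj≡ = rank-injective (bounded j k) (bounded j′ k′) rj rj′
            (trans (sym (ℕₚ.m+[n∸m]≡n (rank-≤ P)))
              (trans (cong₂ _+_ rank≡ (cong (proj₁ ∘ proj₂) eq)) (ℕₚ.m+[n∸m]≡n (rank-≤ P′))))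
          finish : i ≡ i′ → (k , i , j) ≡ (k′ , i′ , j′)
          finish refl with injective i ρi≡
          ... | refl with monotone-injective k ρj≡
          ... | refl = refl

        tX≤ : t * X ≤ m * cells + X * (q * g)
        tX≤ = begin
          t * X                                                       ≤⟨ tX≤∑𝟙r ⟩
          ∑ (upTo R) (λ x → r x * 𝟙 (Rich? x))                        ≡⟨ ∑-values (λ x → 𝟙 (Rich? x)) ⟨
          ∑ (points ρ) (λ p → 𝟙 (Rich? (value ρ p)))                  ≡⟨ ∑-product I K _ ⟩
          ∑ I (λ i → ∑ K (λ k → 𝟙 (Rich? (ρ i k))))                   ≡⟨ ∑-swap I K _ ⟩
          ∑ K (λ k → ∑ I (λ i → 𝟙 (Rich? (ρ i k))))
            ≤⟨ ∑-mono K (λ k → pigeonhole Finₚ._<?_ (allFin-sorted n) (Uniqueₚ.upTo⁺ cells)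
                 (λ i → Rich? (ρ i k)) (κ k) (λ {i} → κ∈ k i)) ⟩
          ∑ K (λ k → length (upTo cells) + ∑ I (λ i → ∑ I (λ j → 𝟙 (Pair? (k , i , j)))))
            ≡⟨ ∑-+ K (λ _ → length (upTo cells)) _ ⟩
          ∑ K (λ _ → length (upTo cells)) + ∑ K (λ k → ∑ I (λ i → ∑ I (λ j → 𝟙 (Pair? (k , i , j)))))
            ≡⟨ cong₂ _+_ (trans (∑-allFin-const m _) (cong (m *_) (Listₚ.length-upTo cells)))
                 (trans (∑-cong K (λ k → sym (∑-product I I _))) (sym (∑-product K (cartesianProduct I I) _))) ⟩
          m * cells + ∑ (cartesianProduct K (cartesianProduct I I)) (λ p → 𝟙 (Pair? p))
            ≤⟨ ℕₚ.+-monoʳ-≤ (m * cells) (Fℕ³.∑-injection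
                 (Uniqueₚ.cartesianProduct⁺ (Uniqueₚ.allFin⁺ m) (Uniqueₚ.cartesianProduct⁺ (Uniqueₚ.allFin⁺ n) (Uniqueₚ.allFin⁺ n)))
                 Pair? code code∈ code-injective) ⟩
          m * cells + length (cartesianProduct (upTo X) (cartesianProduct (upTo q) (upTo g)))
            ≡⟨ cong (m * cells +_) (trans (length-product (upTo X) _) (cong₂ _*_ (Listₚ.length-upTo X)
                 (trans (length-product (upTo q) (upTo g)) (cong₂ _*_ (Listₚ.length-upTo q) (Listₚ.length-upTo g))))) ⟩
          m * cells + X * (q * g)  ∎
          where
          module Fℕ³ = Fibres (Productₚ.≡-dec ℕₚ._≟_ (Productₚ.≡-dec ℕₚ._≟_ ℕₚ._≟_))
          I = allFin n
          K = allFin m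
          κ∈ : ∀ k i → t ≤ r (ρ i k) → κ k i ∈ˡ upTo cells
          κ∈ k i ri = Mem.∈-upTo⁺ (s≤s (ℕₚ.+-mono-≤ (DivMod./-monoˡ-≤ g (ℕₚ.<⇒≤ (Finₚ.toℕ<n i)))
                                          (DivMod./-monoˡ-≤ q (ℕₚ.<⇒≤ (rank<X (bounded i k) ri)))))

      -- Multiply t X ≤ 2m + 2X q g by t². As some value is rich, t ≤ m and t ≤ n; the rounded block
      -- lengths satisfy q t ≤ 5m and g t X ≤ 5mn. Hence 2 + 2 · 25 = 52.
      rich-bound : 0 < t → t * t * t * X ≤ 52 * (m * m * n)
      rich-bound 0<t with X in X≡
      ... | zero    = ℕₚ.≤-trans (ℕₚ.≤-reflexive (ℕₚ.*-zeroʳ (t * t * t))) z≤n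
      ... | suc X-1 with ∑-pos (upTo R) (λ x → 𝟙 (Rich? x)) (subst (0 <_) (sym X≡) (s≤s z≤n))
      ... | x , 0<𝟙 = begin
        t * t * t * suc X-1            ≡⟨ cong (t * t * t *_) X≡ ⟨
        t * t * t * X                  ≡⟨ ℕₚ.*-assoc (t * t) t X ⟩
        t * t * (t * X)                ≤⟨ ℕₚ.*-monoʳ-≤ (t * t) tX≤2m+2Xqg ⟩
        t * t * (2 * m + 2 * (X * (q * g)))  ≡⟨ expand t m X q g ⟩
        2 * m * (t * t) + 2 * ((q * t) * (g * (t * X)))
          ≤⟨ ℕₚ.+-mono-≤ (ℕₚ.*-monoʳ-≤ (2 * m) (ℕₚ.*-mono-≤ t≤m t≤n))
               (ℕₚ.*-monoʳ-≤ 2 (ℕₚ.*-mono-≤ qt≤ gtX≤)) ⟩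
        2 * m * (m * n) + 2 * ((5 * m) * (5 * (m * n)))  ≡⟨ collect m n ⟩
        52 * (m * m * n) ∎
        where
        rich : t ≤ r x
        rich = 𝟙-pos (Rich? x) 0<𝟙
        t≤m : t ≤ m
        t≤m = ℕₚ.≤-trans rich (r≤m x)
        t≤n : t ≤ n
        t≤n = ℕₚ.≤-trans rich (r≤n x)
        instance
          t≢0 : NonZero t
          t≢0 = ℕ.>-nonZero 0<t
          n≢0 : NonZero n
          n≢0 = ℕ.>-nonZero (ℕₚ.<-≤-trans 0<t t≤n)
          X≢0 : NonZero X
          X≢0 = subst NonZero (sym X≡) _
          tX≢0 : NonZero (t * X)
          tX≢0 = ℕₚ.m*n≢0 t X
        -- With q about 4m/t and g about 4mn/(t X), each of the terms m (X/q) and m (n/g) in `tX≤`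
        -- is at most t X/4, so together they absorb only half of the left side.
        q g : ℕ
        q = suc (4 * m ℕ./ t)
        g = suc (4 * (m * n) ℕ./ (t * X))
        open Grid g q
        ≤suc-quotient : ∀ a b .{{_ : NonZero b}} → a ≤ suc (a ℕ./ b) * b
        ≤suc-quotient a b = ℕₚ.≤-trans (ℕₚ.≤-reflexive (DivMod.m≡m%n+[m/n]*n a b))
          (ℕₚ.+-monoˡ-≤ (a ℕ./ b * b) (ℕₚ.<⇒≤ (DivMod.m%n<n a b)))
        suc-quotient≤ : ∀ a b {c} .{{_ : NonZero b}} → b ≤ c → suc (a ℕ./ b) * b ≤ c + a
        suc-quotient≤ a b b≤c = ℕₚ.+-mono-≤ b≤c (DivMod.m/n*n≤m a b)
        qt≤ : q * t ≤ 5 * m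
        qt≤ = suc-quotient≤ (4 * m) t t≤m
        gtX≤ : g * (t * X) ≤ 5 * (m * n)
        gtX≤ = suc-quotient≤ (4 * (m * n)) (t * X) (ℕₚ.≤-trans tX≤nm (ℕₚ.≤-reflexive (ℕₚ.*-comm n m)))
        rows : 4 * (m * (X ℕ./ q)) ≤ t * X
        rows = begin
          4 * (m * (X ℕ./ q))   ≡⟨ ℕₚ.*-assoc 4 m _ ⟨
          4 * m * (X ℕ./ q)     ≤⟨ ℕₚ.*-monoˡ-≤ (X ℕ./ q) (≤suc-quotient (4 * m) t) ⟩
          q * t * (X ℕ./ q)     ≡⟨ rearrange q t (X ℕ./ q) ⟩
          t * (X ℕ./ q * q)     ≤⟨ ℕₚ.*-monoʳ-≤ t (DivMod.m/n*n≤m X q) ⟩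
          t * X                 ∎
          where
          rearrange : ∀ a b c → a * b * c ≡ b * (c * a)
          rearrange = solve-∀
        columns : 4 * (m * (n ℕ./ g)) ≤ t * X
        columns = ℕₚ.*-cancelˡ-≤ n (begin
          n * (4 * (m * (n ℕ./ g)))        ≡⟨ rearrange n m (n ℕ./ g) ⟩
          4 * (m * n) * (n ℕ./ g)          ≤⟨ ℕₚ.*-monoˡ-≤ (n ℕ./ g) (≤suc-quotient (4 * (m * n)) (t * X)) ⟩
          g * (t * X) * (n ℕ./ g)          ≡⟨ rearrange′ g (t * X) (n ℕ./ g) ⟩
          n ℕ./ g * g * (t * X)            ≤⟨ ℕₚ.*-monoˡ-≤ (t * X) (DivMod.m/n*n≤m n g) ⟩
          n * (t * X)                      ∎)
          where
          rearrange : ∀ n m c → n * (4 * (m * c)) ≡ 4 * (m * n) * c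
          rearrange = solve-∀
          rearrange′ : ∀ a b c → a * b * c ≡ c * a * b
          rearrange′ = solve-∀
        tX≤2m+2Xqg : t * X ≤ 2 * m + 2 * (X * (q * g))
        tX≤2m+2Xqg = ℕₚ.*-cancelˡ-≤ 2 (ℕₚ.+-cancelˡ-≤ (2 * (t * X)) _ _ (begin
          2 * (t * X) + 2 * (t * X)          ≡⟨ double (t * X) ⟩
          4 * (t * X)                        ≤⟨ ℕₚ.*-monoʳ-≤ 4 tX≤ ⟩
          4 * (m * cells + X * (q * g))      ≡⟨ split m (n ℕ./ g) (X ℕ./ q) (X * (q * g)) ⟩
          4 * (m * (n ℕ./ g)) + 4 * (m * (X ℕ./ q)) + (4 * m + 4 * (X * (q * g)))
            ≤⟨ ℕₚ.+-monoˡ-≤ _ (ℕₚ.+-mono-≤ columns rows) ⟩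
          t * X + t * X + (4 * m + 4 * (X * (q * g)))  ≡⟨ halve (t * X) m (X * (q * g)) ⟩
          2 * (t * X) + 2 * (2 * m + 2 * (X * (q * g))) ∎))
          where
          double : ∀ a → 2 * a + 2 * a ≡ 4 * a
          double = solve-∀
          split : ∀ m a b c → 4 * (m * suc (a + b) + c) ≡ 4 * (m * a) + 4 * (m * b) + (4 * m + 4 * c)
          split = solve-∀
          halve : ∀ a m c → a + a + (4 * m + 4 * c) ≡ 2 * a + 2 * (2 * m + 2 * c)
          halve = solve-∀
        expand : ∀ t m X q g → t * t * (2 * m + 2 * (X * (q * g))) ≡ 2 * m * (t * t) + 2 * ((q * t) * (g * (t * X)))
        expand = solve-∀
        collect : ∀ m n → 2 * m * (m * n) + 2 * ((5 * m) * (5 * (m * n))) ≡ 52 * (m * m * n)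
        collect = solve-∀

    -- Dyadic decomposition: 2^l ≤ r x < 2^(l+1) for some l < L.
    cube≤levels : ∀ L x → r x < 2 ^ L →
      r x * (r x * r x) ≤ ∑ (upTo L) (λ l → 8 * (2 ^ l * 2 ^ l * 2 ^ l * 𝟙 (Level.Rich? (2 ^ l) x)))
    cube≤levels L x r< with r x ℕₚ.≟ 0
    ... | yes r≡0 = ℕₚ.≤-trans (ℕₚ.≤-reflexive (cong (λ c → c * (r x * r x)) r≡0)) z≤n
    ... | no  r≢0 = find L r<
      where
      level : ℕ → ℕ
      level l = 8 * (2 ^ l * 2 ^ l * 2 ^ l * 𝟙 (Level.Rich? (2 ^ l) x))
      enough : ∀ l → 2 ^ l ≤ r x → r x < 2 ^ suc l → r x * (r x * r x) ≤ level l
      enough l lo hi = begin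
        r x * (r x * r x)            ≤⟨ ℕₚ.*-mono-≤ (ℕₚ.<⇒≤ hi) (ℕₚ.*-mono-≤ (ℕₚ.<⇒≤ hi) (ℕₚ.<⇒≤ hi)) ⟩
        2 * 2 ^ l * (2 * 2 ^ l * (2 * 2 ^ l)) ≡⟨ cubes (2 ^ l) ⟩
        8 * (2 ^ l * 2 ^ l * 2 ^ l * 1)
          ≡⟨ cong (λ c → 8 * (2 ^ l * 2 ^ l * 2 ^ l * c)) (𝟙-yes (Level.Rich? (2 ^ l) x) lo) ⟨
        level l                      ∎
        where
        cubes : ∀ a → 2 * a * (2 * a * (2 * a)) ≡ 8 * (a * a * a * 1)
        cubes = solve-∀
      descend : ∀ l → r x < 2 ^ l → ∃[ l′ ] l′ < l × 2 ^ l′ ≤ r x × r x < 2 ^ suc l′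
      descend zero    r<1 = ⊥-elim (r≢0 (ℕₚ.n<1⇒n≡0 r<1))
      descend (suc l) r< with 2 ^ l ℕₚ.≤? r x
      ... | yes lo = l , ℕₚ.≤-refl , lo , r<
      ... | no ¬lo with descend l (ℕₚ.≰⇒> ¬lo)
      ... | l′ , l′<l , lo , hi = l′ , ℕₚ.m<n⇒m<1+n l′<l , lo , hi
      find : ∀ L → r x < 2 ^ L → r x * (r x * r x) ≤ ∑ (upTo L) level
      find L r< with descend L r<
      ... | l , l<L , lo , hi = ℕₚ.≤-trans (enough l lo hi) (∑-∈ level (Mem.∈-upTo⁺ l<L))

    -- Each of the `L` dyadic levels contributes at most 8 · 52 m²n; raising 52 to 64 makes the
    -- constant 2⁹.
    third-moment : ∀ L → n < 2 ^ L → ∑ (upTo R) (λ x → r x * (r x * r x)) ≤ 512 * (L * (m * m * n))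
    third-moment L n<2^L = begin
      ∑ (upTo R) (λ x → r x * (r x * r x))
        ≤⟨ ∑-mono (upTo R) (λ x → cube≤levels L x (ℕₚ.≤-<-trans (r≤n x) n<2^L)) ⟩
      ∑ (upTo R) (λ x → ∑ (upTo L) (λ l → 8 * (2 ^ l * 2 ^ l * 2 ^ l * 𝟙 (Level.Rich? (2 ^ l) x))))
        ≡⟨ ∑-swap (upTo R) (upTo L) _ ⟩
      ∑ (upTo L) (λ l → ∑ (upTo R) (λ x → 8 * (2 ^ l * 2 ^ l * 2 ^ l * 𝟙 (Level.Rich? (2 ^ l) x))))
        ≡⟨ ∑-cong (upTo L) (λ l → sym (trans (cong (8 *_) (*-∑ (2 ^ l * 2 ^ l * 2 ^ l) (upTo R) _)) (*-∑ 8 (upTo R) _))) ⟩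
      ∑ (upTo L) (λ l → 8 * (2 ^ l * 2 ^ l * 2 ^ l * Level.X (2 ^ l)))
        ≤⟨ ∑-mono (upTo L) (λ l → ℕₚ.*-monoʳ-≤ 8 (Level.rich-bound (2 ^ l) (ℕₚ.m^n>0 2 l))) ⟩
      ∑ (upTo L) (λ _ → 8 * (52 * (m * m * n)))
        ≡⟨ trans (∑-const (upTo L) _) (cong (_* (8 * (52 * (m * m * n)))) (Listₚ.length-upTo L)) ⟩
      L * (8 * (52 * (m * m * n)))
        ≤⟨ ℕₚ.*-monoʳ-≤ L (ℕₚ.*-monoʳ-≤ 8 (ℕₚ.*-monoˡ-≤ (m * m * n) (ℕₚ.m≤m+n 52 12))) ⟩
      L * (8 * (64 * (m * m * n)))   ≡⟨ collect L (m * m * n) ⟩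
      512 * (L * (m * m * n))        ∎
      where
      collect : ∀ L a → L * (8 * (64 * a)) ≡ 512 * (L * a)
      collect = solve-∀

  -- From the third moments to n⁸ ≪ m⁵ log³ n

  -- s i j is the index of a_i - a_j in D and ρ i u the rank of a_i - d_u among all such differences.
  module SchoenShkredov {n m R : ℕ} (0<n : 0 < n) (0<m : 0 < m)
    (s : Fin n → Fin n → Fin m) (ρ : Fin n → Fin m → ℕ)
    (inc₁ : Incidence (λ i j → toℕ (s i j)) m) (inc₂ : Incidence ρ R)
    (transpose : ∀ {l j l′ j′} → s l j ≡ s l′ j′ → s l l′ ≡ s j j′)
    (shift : ∀ l {i j i′ j′} → s i′ j′ ≡ s i j → ρ j′ (s l i) ≡ ρ i′ (s l j)) where

    private
      module M₁ = ThirdMoment inc₁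
      module M₂ = ThirdMoment inc₂
      I = allFin n
      K = allFin m
      KK = cartesianProduct K K

    σ : Fin n → Fin n → ℕ
    σ i j = toℕ (s i j)

    r₁ r₂ : ℕ → ℕ
    r₁ = rep σ
    r₂ = rep ρ

    E₁ E₂ F₂ : ℕ
    E₁ = ∑ (upTo m) (λ y → r₁ y * (r₁ y * r₁ y))
    E₂ = ∑ (upTo R) (λ y → r₂ y * r₂ y)
    F₂ = ∑ (upTo R) (λ y → r₂ y * (r₂ y * r₂ y))

    Popular? : ∀ y → Dec (n * n ≤ 2 * m * r₁ y)
    Popular? y = n * n ℕₚ.≤? 2 * m * r₁ y

    popular : ℕ
    popular = ∑ (points σ) (λ p → 𝟙 (Popular? (value σ p)))

    -- At most m differences occur, and an unpopular one has fewer than n²/2m representations, so at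
    -- most n²/2 pairs are unpopular.
    half-popular : n * n ≤ 2 * popular
    half-popular = ℕₚ.+-cancelʳ-≤ (n * n) (n * n) (2 * popular) (begin
      n * n + n * n                     ≡⟨ cong₂ _+_ total total ⟨
      ∑ (points σ) (λ p → 1) + ∑ (points σ) (λ p → 1)
        ≤⟨ ℕₚ.+-mono-≤ cover cover ⟩
      (popular + unpopular) + (popular + unpopular)  ≡⟨ double popular unpopular ⟩
      2 * popular + 2 * unpopular       ≤⟨ ℕₚ.+-monoʳ-≤ (2 * popular) few ⟩
      2 * popular + n * n               ∎)
      where
      unpopular : ℕ
      unpopular = ∑ (points σ) (λ p → 𝟙 (¬? (Popular? (value σ p))))
      total : ∑ (points σ) (λ p → 1) ≡ n * n
      total = trans (∑-const (points σ) 1) (trans (ℕₚ.*-identityʳ _)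
        (trans (length-product I I) (cong₂ _*_ (length-allFin n) (length-allFin n))))
      𝟙-either : {P : Set} (P? : Dec P) → 1 ≤ 𝟙 P? + 𝟙 (¬? P?)
      𝟙-either (yes _) = s≤s z≤n
      𝟙-either (no  _) = s≤s z≤n
      cover : ∑ (points σ) (λ p → 1) ≤ popular + unpopular
      cover = ℕₚ.≤-trans (∑-mono (points σ) (λ p → 𝟙-either (Popular? (value σ p))))
        (ℕₚ.≤-reflexive (∑-+ (points σ) _ _))
      double : ∀ a b → (a + b) + (a + b) ≡ 2 * a + 2 * b
      double = solve-∀
      instance
        m≢0 : NonZero m
        m≢0 = ℕ.>-nonZero 0<m
      small : ∀ y (d : Dec (n * n ≤ 2 * m * r₁ y)) → 2 * m * (r₁ y * 𝟙 (¬? d)) ≤ n * n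
      small y (yes _) = ℕₚ.≤-trans (ℕₚ.≤-reflexive (trans (cong (2 * m *_) (ℕₚ.*-zeroʳ (r₁ y))) (ℕₚ.*-zeroʳ (2 * m)))) z≤n
      small y (no ¬p) = ℕₚ.≤-trans (ℕₚ.≤-reflexive (cong (2 * m *_) (ℕₚ.*-identityʳ (r₁ y)))) (ℕₚ.<⇒≤ (ℕₚ.≰⇒> ¬p))
      few : 2 * unpopular ≤ n * n
      few = ℕₚ.*-cancelˡ-≤ m (begin
        m * (2 * unpopular)
          ≡⟨ trans (sym (ℕₚ.*-assoc m 2 unpopular)) (cong (_* unpopular) (ℕₚ.*-comm m 2)) ⟩
        2 * m * unpopular                         ≡⟨ cong (2 * m *_) (M₁.∑-values (λ y → 𝟙 (¬? (Popular? y)))) ⟩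
        2 * m * ∑ (upTo m) (λ y → r₁ y * 𝟙 (¬? (Popular? y)))  ≡⟨ *-∑ (2 * m) (upTo m) _ ⟩
        ∑ (upTo m) (λ y → 2 * m * (r₁ y * 𝟙 (¬? (Popular? y)))) ≤⟨ ∑-mono (upTo m) (λ y → small y (Popular? y)) ⟩
        ∑ (upTo m) (λ _ → n * n)  ≡⟨ trans (∑-const (upTo m) _) (cong (_* (n * n)) (Listₚ.length-upTo m)) ⟩
        m * (n * n)               ∎)

    Hit? : ∀ u v l i j → Dec (s l j ≡ u × s l i ≡ v × n * n ≤ 2 * m * r₁ (σ i j))
    Hit? u v l i j = (s l j Finₚ.≟ u) ×-dec (s l i Finₚ.≟ v) ×-dec Popular? (σ i j)

    -- The identity (a_l - a_j) - (a_l - a_i) = a_i - a_j counted over popular differences.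
    w : Fin m × Fin m → ℕ
    w (u , v) = ∑ I (λ l → ∑ I (λ i → ∑ I (λ j → 𝟙 (Hit? u v l i j))))

    ∑w : n * popular ≤ ∑ KK w
    ∑w = begin
      n * popular                            ≡⟨ ∑-allFin-const n popular ⟨
      ∑ I (λ l → popular)                    ≡⟨ ∑-cong I (λ l → ∑-product I I _) ⟩
      ∑ I (λ l → ∑ I (λ i → ∑ I (λ j → 𝟙 (Popular? (σ i j)))))
        ≤⟨ ∑-mono I (λ l → ∑-mono I (λ i → ∑-mono I (λ j → hit l i j))) ⟩
      ∑ I (λ l → ∑ I (λ i → ∑ I (λ j → ∑ KK (λ p → 𝟙 (Hit? (proj₁ p) (proj₂ p) l i j)))))
        ≡⟨ ∑-cong I (λ l → ∑-cong I (λ i → ∑-swap I KK _)) ⟩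
      ∑ I (λ l → ∑ I (λ i → ∑ KK (λ p → ∑ I (λ j → 𝟙 (Hit? (proj₁ p) (proj₂ p) l i j)))))
        ≡⟨ ∑-cong I (λ l → ∑-swap I KK _) ⟩
      ∑ I (λ l → ∑ KK (λ p → ∑ I (λ i → ∑ I (λ j → 𝟙 (Hit? (proj₁ p) (proj₂ p) l i j)))))
        ≡⟨ ∑-swap I KK _ ⟩
      ∑ KK w  ∎
      where
      hit : ∀ l i j → 𝟙 (Popular? (σ i j)) ≤ ∑ KK (λ p → 𝟙 (Hit? (proj₁ p) (proj₂ p) l i j))
      hit l i j = ℕₚ.≤-trans
        (𝟙-mono (Popular? (σ i j)) (Hit? (s l j) (s l i) l i j) (λ pop → refl , refl , pop))
        (∑-∈ (λ p → 𝟙 (Hit? (proj₁ p) (proj₂ p) l i j))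
          (Mem.∈-cartesianProduct⁺ (Mem.∈-allFin (s l j)) (Mem.∈-allFin (s l i))))

    W : ℕ
    W = ∑ KK (λ p → 𝟙 (0 ℕₚ.<? w p))

    -- Taking the indicator of the support of `w` as weight makes the first factor the size of that
    -- support.
    w-cauchy-schwarz : ∑ KK w * ∑ KK w ≤ W * ∑ KK (λ p → w p * w p)
    w-cauchy-schwarz = begin
      ∑ KK w * ∑ KK w    ≡⟨ cong₂ _*_ support support ⟩
      ∑ KK (λ p → 𝟙 (0 ℕₚ.<? w p) * w p) * ∑ KK (λ p → 𝟙 (0 ℕₚ.<? w p) * w p)
        ≤⟨ cauchy-schwarz (λ p → 𝟙 (0 ℕₚ.<? w p)) w KK ⟩
      W * ∑ KK (λ p → 𝟙 (0 ℕₚ.<? w p) * (w p * w p))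
        ≤⟨ ℕₚ.*-monoʳ-≤ W (∑-mono KK (λ p → ℕₚ.≤-trans (ℕₚ.*-monoˡ-≤ (w p * w p) (𝟙≤1 (0 ℕₚ.<? w p)))
             (ℕₚ.≤-reflexive (ℕₚ.*-identityˡ _)))) ⟩
      W * ∑ KK (λ p → w p * w p)  ∎
      where
      𝟙-support : ∀ c → c ≡ 𝟙 (0 ℕₚ.<? c) * c
      𝟙-support zero    = refl
      𝟙-support (suc c) = sym (ℕₚ.*-identityˡ (suc c))
      support : ∑ KK w ≡ ∑ KK (λ p → 𝟙 (0 ℕₚ.<? w p) * w p)
      support = ∑-cong KK (λ p → 𝟙-support (w p))

    α : Fin n → Fin m → ℕ
    α l u = ∑ I (λ j → 𝟙 (s l j Finₚ.≟ u))

    w≤ : ∀ u v → w (u , v) ≤ ∑ I (λ l → α l u * α l v)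
    w≤ u v = ∑-mono I λ l → begin
      ∑ I (λ i → ∑ I (λ j → 𝟙 (Hit? u v l i j)))
        ≤⟨ ∑-mono I (λ i → ∑-mono I (λ j → 𝟙-×-≤ (s l j Finₚ.≟ u) (s l i Finₚ.≟ v) (Popular? (σ i j)))) ⟩
      ∑ I (λ i → ∑ I (λ j → 𝟙 (s l j Finₚ.≟ u) * 𝟙 (s l i Finₚ.≟ v)))
        ≡⟨ ∑-cong I (λ i → sym (∑-* I (λ j → 𝟙 (s l j Finₚ.≟ u)) (𝟙 (s l i Finₚ.≟ v)))) ⟩
      ∑ I (λ i → α l u * 𝟙 (s l i Finₚ.≟ v))   ≡⟨ *-∑ (α l u) I _ ⟨
      α l u * α l v ∎
      where
      𝟙-×-≤ : {P Q S : Set} (P? : Dec P) (Q? : Dec Q) (S? : Dec S) → 𝟙 (P? ×-dec Q? ×-dec S?) ≤ 𝟙 P? * 𝟙 Q?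
      𝟙-×-≤ (yes _) (yes _) S? = 𝟙≤1 _
      𝟙-×-≤ (yes _) (no _)  S? = z≤n
      𝟙-×-≤ (no _)  Q?      S? = z≤n

    correlation : Fin n → Fin n → ℕ
    correlation l l′ = ∑ K (λ u → α l u * α l′ u)

    -- A coincidence a_l - a_j = a_l′ - a_j′ is, by `transpose`, a representation a_j - a_j′ of a_l
    -- - a_l′.
    correlation≤ : ∀ l l′ → correlation l l′ ≤ r₁ (σ l l′)
    correlation≤ l l′ = begin
      correlation l l′                                  ≡⟨ Fin-fibres (α l′) ⟨
      ∑ I (λ j → ∑ I (λ j′ → 𝟙 (s l′ j′ Finₚ.≟ s l j)))
        ≤⟨ ∑-mono I (λ j → ∑-mono I (λ j′ → 𝟙-mono (s l′ j′ Finₚ.≟ s l j) (σ j j′ ℕₚ.≟ σ l l′)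
             (λ eq → cong toℕ (sym (transpose (sym eq)))))) ⟩
      ∑ I (λ j → ∑ I (λ j′ → 𝟙 (σ j j′ ℕₚ.≟ σ l l′)))   ≡⟨ ∑-product I I _ ⟨
      r₁ (σ l l′)                                       ∎
      where
      open Fibres (Finₚ._≟_ {m})
      Fin-fibres : ∀ f → ∑ I (λ j → f (s l j)) ≡ ∑ K (λ u → α l u * f u)
      Fin-fibres = ∑-fibres I (s l) (Uniqueₚ.allFin⁺ m) (λ j → Mem.∈-allFin (s l j))

    ∑-square : {A : Set} (xs : List A) (f : A → ℕ) → ∑ xs f * ∑ xs f ≡ ∑ xs (λ x → ∑ xs (λ y → f x * f y))
    ∑-square xs f = trans (∑-* xs f (∑ xs f)) (∑-cong xs (λ x → *-∑ (f x) xs f))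

    -- Popularity is dropped. After expanding the square, the sum over `u` and `v` factors into the
    -- square of a correlation, at most r₁(σ l l′)²; since a value y arises from r₁ y pairs (l ,
    -- l′), cubes result.
    ∑w²≤E₁ : ∑ KK (λ p → w p * w p) ≤ E₁
    ∑w²≤E₁ = begin
      ∑ KK (λ p → w p * w p)
        ≤⟨ ∑-mono KK (λ (u , v) → ℕₚ.*-mono-≤ (w≤ u v) (w≤ u v)) ⟩
      ∑ KK (λ (u , v) → ∑ I (λ l → α l u * α l v) * ∑ I (λ l → α l u * α l v))
        ≡⟨ ∑-cong KK (λ (u , v) → ∑-square I (λ l → α l u * α l v)) ⟩
      ∑ KK (λ (u , v) → ∑ I (λ l → ∑ I (λ l′ → α l u * α l v * (α l′ u * α l′ v))))
        ≡⟨ trans (∑-swap KK I _) (∑-cong I (λ l → ∑-swap KK I _)) ⟩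
      ∑ I (λ l → ∑ I (λ l′ → ∑ KK (λ (u , v) → α l u * α l v * (α l′ u * α l′ v))))
        ≡⟨ ∑-cong I (λ l → ∑-cong I (λ l′ → square l l′)) ⟩
      ∑ I (λ l → ∑ I (λ l′ → correlation l l′ * correlation l l′))
        ≤⟨ ∑-mono I (λ l → ∑-mono I (λ l′ → ℕₚ.*-mono-≤ (correlation≤ l l′) (correlation≤ l l′))) ⟩
      ∑ I (λ l → ∑ I (λ l′ → r₁ (σ l l′) * r₁ (σ l l′)))  ≡⟨ ∑-product I I _ ⟨
      ∑ (points σ) (λ p → r₁ (value σ p) * r₁ (value σ p)) ≡⟨ M₁.∑-values (λ y → r₁ y * r₁ y) ⟩
      E₁  ∎
      where
      rearrange : ∀ a b c d → a * b * (c * d) ≡ a * c * (b * d)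
      rearrange = solve-∀
      square : ∀ l l′ → ∑ KK (λ (u , v) → α l u * α l v * (α l′ u * α l′ v)) ≡ correlation l l′ * correlation l l′
      square l l′ = trans (∑-product K K _) (trans
        (∑-cong K (λ u → ∑-cong K (λ v → rearrange (α l u) (α l v) (α l′ u) (α l′ v))))
        (sym (∑-square K (λ u → α l u * α l′ u))))

    -- Representations of u - v as a_i - a_j, written as coincidences a_j - v = a_i - u so that
    -- their total is the second moment of `r₂`.
    e : Fin m × Fin m → ℕ
    e (u , v) = ∑ I (λ i → ∑ I (λ j → 𝟙 (ρ j v ℕₚ.≟ ρ i u)))

    -- A pair in the support has u - v equal to a popular a_i - a_j, and `shift` turns each
    -- representation of the latter into a coincidence counted by `e`.
    w-pos⇒ : ∀ p → 0 < w p → n * n ≤ 2 * m * e p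
    w-pos⇒ (u , v) 0<w with ∑-pos I _ 0<w
    ... | l , 0<wₗ with ∑-pos I _ 0<wₗ
    ... | i , 0<wₗᵢ with ∑-pos I _ 0<wₗᵢ
    ... | j , 0<𝟙 with 𝟙-pos (Hit? u v l i j) 0<𝟙
    ... | refl , refl , pop = ℕₚ.≤-trans pop (ℕₚ.*-monoʳ-≤ (2 * m) (begin
      r₁ (σ i j)                                               ≡⟨ ∑-product I I _ ⟩
      ∑ I (λ i′ → ∑ I (λ j′ → 𝟙 (σ i′ j′ ℕₚ.≟ σ i j)))
        ≤⟨ ∑-mono I (λ i′ → ∑-mono I (λ j′ → 𝟙-mono (σ i′ j′ ℕₚ.≟ σ i j) (ρ j′ (s l i) ℕₚ.≟ ρ i′ (s l j))
             (λ eq → shift l (Finₚ.toℕ-injective eq)))) ⟩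
      e (s l j , s l i)                                        ∎))

    ∑e : ∑ KK e ≡ E₂
    ∑e = begin-equality
      ∑ KK e                                                                ≡⟨ ∑-product K K _ ⟩
      ∑ K (λ u → ∑ K (λ v → ∑ I (λ i → ∑ I (λ j → 𝟙 (ρ j v ℕₚ.≟ ρ i u)))))
        ≡⟨ ∑-cong K (λ u → trans (∑-swap K I _) (∑-cong I (λ i → ∑-swap K I _))) ⟩
      ∑ K (λ u → ∑ I (λ i → ∑ I (λ j → ∑ K (λ v → 𝟙 (ρ j v ℕₚ.≟ ρ i u)))))  ≡⟨ ∑-swap K I _ ⟩
      ∑ I (λ i → ∑ K (λ u → ∑ I (λ j → ∑ K (λ v → 𝟙 (ρ j v ℕₚ.≟ ρ i u)))))
        ≡⟨ ∑-cong I (λ i → ∑-cong K (λ u → ∑-product I K _)) ⟨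
      ∑ I (λ i → ∑ K (λ u → r₂ (ρ i u)))                                    ≡⟨ ∑-product I K _ ⟨
      ∑ (points ρ) (λ p → r₂ (value ρ p))                                   ≡⟨ M₂.∑-values r₂ ⟩
      E₂                                                                    ∎

    Wn²≤ : W * (n * n) ≤ 2 * m * E₂
    Wn²≤ = begin
      W * (n * n)                                  ≡⟨ ∑-* KK _ (n * n) ⟩
      ∑ KK (λ p → 𝟙 (0 ℕₚ.<? w p) * (n * n))       ≤⟨ ∑-mono KK (λ p → bound p (0 ℕₚ.<? w p)) ⟩
      ∑ KK (λ p → 2 * m * e p)                     ≡⟨ *-∑ (2 * m) KK e ⟨
      2 * m * ∑ KK e                               ≡⟨ cong (2 * m *_) ∑e ⟩
      2 * m * E₂                                   ∎
      where
      bound : ∀ p (d : Dec (0 < w p)) → 𝟙 d * (n * n) ≤ 2 * m * e p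
      bound p (yes 0<w) = ℕₚ.≤-trans (ℕₚ.≤-reflexive (ℕₚ.*-identityˡ (n * n))) (w-pos⇒ p 0<w)
      bound p (no _)    = z≤n

    E₂²≤ : E₂ * E₂ ≤ n * m * F₂
    E₂²≤ = ℕₚ.≤-trans (cauchy-schwarz r₂ r₂ (upTo R)) (ℕₚ.≤-reflexive (cong (_* F₂) M₂.∑r))

    n⁶≤ : n * (n * n) * (n * (n * n)) ≤ 4 * (W * E₁)
    n⁶≤ = begin
      n * (n * n) * (n * (n * n))             ≤⟨ ℕₚ.*-mono-≤ cube cube ⟩
      2 * ∑ KK w * (2 * ∑ KK w)               ≡⟨ expand (∑ KK w) ⟩
      4 * (∑ KK w * ∑ KK w)                   ≤⟨ ℕₚ.*-monoʳ-≤ 4 (ℕₚ.≤-trans w-cauchy-schwarz (ℕₚ.*-monoʳ-≤ W ∑w²≤E₁)) ⟩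
      4 * (W * E₁)                            ∎
      where
      expand : ∀ a → 2 * a * (2 * a) ≡ 4 * (a * a)
      expand = solve-∀
      swap : ∀ a b → a * (2 * b) ≡ 2 * (a * b)
      swap = solve-∀
      cube : n * (n * n) ≤ 2 * ∑ KK w
      cube = ℕₚ.≤-trans (ℕₚ.*-monoʳ-≤ n half-popular)
        (ℕₚ.≤-trans (ℕₚ.≤-reflexive (swap n popular)) (ℕₚ.*-monoʳ-≤ 2 ∑w))

    module _ (L : ℕ) (n<2^L : n < 2 ^ L) where

      -- Multiplying n⁶ ≤ 4 W E₁ by n² makes room for the bound on W n²; then n³ cancels.
      n⁵≤ : ∀ C → E₁ ≤ C * (L * (n * n * n)) → n * n * n * n * n ≤ 8 * C * (m * L * E₂)
      n⁵≤ C E₁≤ = ℕₚ.*-cancelˡ-≤ (n * n * n) (begin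
        n * n * n * (n * n * n * n * n)         ≡⟨ split n ⟩
        n * (n * n) * (n * (n * n)) * (n * n)   ≤⟨ ℕₚ.*-monoˡ-≤ (n * n) n⁶≤ ⟩
        4 * (W * E₁) * (n * n)                  ≡⟨ swap W E₁ (n * n) ⟩
        4 * E₁ * (W * (n * n))                  ≤⟨ ℕₚ.*-mono-≤ (ℕₚ.*-monoʳ-≤ 4 E₁≤) Wn²≤ ⟩
        4 * (C * (L * (n * n * n))) * (2 * m * E₂) ≡⟨ collect C L n m E₂ ⟩
        n * n * n * (8 * C * (m * L * E₂))      ∎)
        where
        instance
          n≢0 : NonZero n
          n≢0 = ℕ.>-nonZero 0<n
          n²≢0 : NonZero (n * n)
          n²≢0 = ℕₚ.m*n≢0 n n
          n³≢0 : NonZero (n * n * n)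
          n³≢0 = ℕₚ.m*n≢0 (n * n) n
        split : ∀ n → n * n * n * (n * n * n * n * n) ≡ n * (n * n) * (n * (n * n)) * (n * n)
        split = solve-∀
        swap : ∀ W E a → 4 * (W * E) * a ≡ 4 * E * (W * a)
        swap = solve-∀
        collect : ∀ C L n m E → 4 * (C * (L * (n * n * n))) * (2 * m * E) ≡ n * n * n * (8 * C * (m * L * E))
        collect = solve-∀

      n⁸≤64C³L³m⁵ : ∀ C → E₁ ≤ C * (L * (n * n * n)) → F₂ ≤ C * (L * (m * m * n)) →
        n ^ 8 ≤ 64 * (C * C * C) * (L ^ 3 * m ^ 5)
      n⁸≤64C³L³m⁵ C E₁≤ F₂≤ = ℕₚ.*-cancelˡ-≤ (n * n) (begin
        n * n * n ^ 8                                          ≡⟨ split n ⟩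
        (n * n * n * n * n) * (n * n * n * n * n)              ≤⟨ ℕₚ.*-mono-≤ (n⁵≤ C E₁≤) (n⁵≤ C E₁≤) ⟩
        8 * C * (m * L * E₂) * (8 * C * (m * L * E₂))          ≡⟨ square C m L E₂ ⟩
        64 * (C * C) * (m * m) * (L * L) * (E₂ * E₂)
          ≤⟨ ℕₚ.*-monoʳ-≤ (64 * (C * C) * (m * m) * (L * L)) (ℕₚ.≤-trans E₂²≤ (ℕₚ.*-monoʳ-≤ (n * m) F₂≤)) ⟩
        64 * (C * C) * (m * m) * (L * L) * (n * m * (C * (L * (m * m * n)))) ≡⟨ collect C m L n ⟩
        n * n * (64 * (C * C * C) * (L ^ 3 * m ^ 5))           ∎)
        where
        instance
          n≢0 : NonZero n
          n≢0 = ℕ.>-nonZero 0<n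
          n²≢0 : NonZero (n * n)
          n²≢0 = ℕₚ.m*n≢0 n n
        split : ∀ n → n * n * (n * (n * (n * (n * (n * (n * (n * (n * 1)))))))) ≡ (n * n * n * n * n) * (n * n * n * n * n)
        split = solve-∀
        square : ∀ C m L E → 8 * C * (m * L * E) * (8 * C * (m * L * E)) ≡ 64 * (C * C) * (m * m) * (L * L) * (E * E)
        square = solve-∀
        collect : ∀ C m L n → 64 * (C * C) * (m * m) * (L * L) * (n * m * (C * (L * (m * m * n))))
          ≡ n * n * (64 * (C * C * C) * (L * (L * (L * 1)) * (m * (m * (m * (m * (m * 1)))))))
        collect = solve-∀

      -- The constant is 64 · (2⁹)³ = 2³³.
      n⁸≤ : n ^ 8 ≤ 2 ^ 33 * (L ^ 3 * m ^ 5)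
      n⁸≤ = n⁸≤64C³L³m⁵ 512 (M₁.third-moment L n<2^L) (M₂.third-moment L n<2^L)

open import Data.Rational.Base using (_+_; _*_; _-_; -_; _≤_; _<_)
open import Algebra.Definitions.RawSemiring +-*-rawSemiring using (_^_)
open import Algebra.Properties.CommutativeSemiring.Exp
  (CommutativeRing.commutativeSemiring ℚₚ.+-*-commutativeRing) using (^-homo-*; ^-assocʳ; ^-distrib-*)
open +-*-Solver using (solve; _:=_; _:+_; _:*_; _:-_; :-_; con; _:^_)
open ℚₚ.≤-Reasoning

-- Exponentials and logarithms

∏< : ℕ → (ℕ → ℚ) → ℚ
∏< zero    f = 1ℚ
∏< (suc n) f = ∏< n f * f n

0≤∏ : ∀ n {f} → (∀ j → j ℕ.< n → 0ℚ ≤ f j) → 0ℚ ≤ ∏< n f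
0≤∏ zero    0≤f = 0≤1
0≤∏ (suc n) 0≤f = 0≤* (0≤∏ n (λ j j<n → 0≤f j (ℕₚ.m<n⇒m<1+n j<n))) (0≤f n ℕₚ.≤-refl)

∏-mono : ∀ n {f g} → (∀ j → j ℕ.< n → 0ℚ ≤ f j) → (∀ j → j ℕ.< n → f j ≤ g j) → ∏< n f ≤ ∏< n g
∏-mono zero    0≤f f≤g = ≤-refl
∏-mono (suc n) 0≤f f≤g = *-mono (0≤f n ℕₚ.≤-refl)
  (0≤∏ n (λ j j<n → ≤-trans (0≤f j (ℕₚ.m<n⇒m<1+n j<n)) (f≤g j (ℕₚ.m<n⇒m<1+n j<n))))
  (∏-mono n (λ j j<n → 0≤f j (ℕₚ.m<n⇒m<1+n j<n)) (λ j j<n → f≤g j (ℕₚ.m<n⇒m<1+n j<n)))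
  (f≤g n ℕₚ.≤-refl)

∏-double : ∀ n f → ∏< (2 ℕ.* n) f ≡ ∏< n (λ j → f (2 ℕ.* j) * f (suc (2 ℕ.* j)))
∏-double zero    f = refl
∏-double (suc n) f = begin-equality
  ∏< (2 ℕ.* suc n) f                             ≡⟨ cong (λ k → ∏< k f) (ℕₚ.*-suc 2 n) ⟩
  ∏< (2 ℕ.* n) f * f (2 ℕ.* n) * f (suc (2 ℕ.* n))
    ≡⟨ ℚₚ.*-assoc (∏< (2 ℕ.* n) f) (f (2 ℕ.* n)) (f (suc (2 ℕ.* n))) ⟩
  ∏< (2 ℕ.* n) f * (f (2 ℕ.* n) * f (suc (2 ℕ.* n)))
    ≡⟨ cong (_* (f (2 ℕ.* n) * f (suc (2 ℕ.* n)))) (∏-double n f) ⟩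
  ∏< (suc n) (λ j → f (2 ℕ.* j) * f (suc (2 ℕ.* j))) ∎

∏-square : ∀ n g → ∏< n (λ j → g j * g j) ≡ ∏< n g * ∏< n g
∏-square zero    g = refl
∏-square (suc n) g = trans (cong (_* (g n * g n)) (∏-square n g))
  (solve 2 (λ a b → a :* a :* (b :* b) := a :* b :* (a :* b)) refl (∏< n g) (g n))

∑<-*ˡ : ∀ n c f → ∑< n (λ j → c * f j) ≡ c * ∑< n f
∑<-*ˡ zero    c f = sym (ℚₚ.*-zeroʳ c)
∑<-*ˡ (suc n) c f = trans (cong (_+ c * f n) (∑<-*ˡ n c f)) (sym (ℚₚ.*-distribˡ-+ c (∑< n f) (f n)))

∑<-+ : ∀ n f g → ∑< n (λ j → f j + g j) ≡ ∑< n f + ∑< n g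
∑<-+ zero    f g = refl
∑<-+ (suc n) f g = trans (cong (_+ (f n + g n)) (∑<-+ n f g))
  (solve 4 (λ a b c d → a :+ b :+ (c :+ d) := a :+ c :+ (b :+ d)) refl (∑< n f) (∑< n g) (f n) (g n))

0≤∑< : ∀ n {f} → (∀ j → j ℕ.< n → 0ℚ ≤ f j) → 0ℚ ≤ ∑< n f
0≤∑< n {f} 0≤f = begin
  0ℚ                ≡⟨ ℚₚ.*-zeroʳ (ι n) ⟨
  ι n * 0ℚ          ≡⟨ ∑<-const n 0ℚ ⟨
  ∑< n (λ _ → 0ℚ)   ≤⟨ ∑<-mono n 0≤f ⟩
  ∑< n f            ∎

0≤square : ∀ p → 0ℚ ≤ p * p
0≤square p with ℚₚ.≤-total 0ℚ p
... | inj₁ 0≤p = 0≤* 0≤p 0≤p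
... | inj₂ p≤0 = subst (0ℚ ≤_) (solve 1 (λ p → :- p :* :- p := p :* p) refl p)
  (0≤* (ℚₚ.neg-antimono-≤ p≤0) (ℚₚ.neg-antimono-≤ p≤0))

x*y≤mean² : ∀ x y → x * y ≤ ½ * (x + y) * (½ * (x + y))
x*y≤mean² x y = begin
  x * y  ≤⟨ p≤p+q (0≤square (½ * (x - y))) ⟩
  x * y + ½ * (x - y) * (½ * (x - y))
    ≡⟨ solve 2 (λ x y → x :* y :+ con ½ :* (x :- y) :* (con ½ :* (x :- y))
         := con ½ :* (x :+ y) :* (con ½ :* (x :+ y))) refl x y ⟩
  ½ * (x + y) * (½ * (x + y)) ∎

-- Replacing adjacent factors by the square of their mean preserves the overall mean and halves the
-- number of bases. Powers of two suffice, since `expₙ` and `logₙ` use 2ᴺ steps.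
am-gm : ∀ N f → (∀ j → j ℕ.< 2 ℕ.^ N → 0ℚ ≤ f j) → ∏< (2 ℕ.^ N) f ≤ (h N * ∑< (2 ℕ.^ N) f) ^ (2 ℕ.^ N)
am-gm zero    f 0≤f = ≤-reflexive
  (solve 1 (λ a → con 1ℚ :* a := con 1ℚ :* (con 0ℚ :+ a) :* con 1ℚ) refl (f 0))
am-gm (suc N) f 0≤f = begin
  ∏< (2 ℕ.* M) f                                        ≡⟨ ∏-double M f ⟩
  ∏< M (λ j → f (2 ℕ.* j) * f (suc (2 ℕ.* j)))
    ≤⟨ ∏-mono M (λ j j< → 0≤* (0≤f (2 ℕ.* j) (even j j<)) (0≤f (suc (2 ℕ.* j)) (odd j j<)))
         (λ j _ → x*y≤mean² (f (2 ℕ.* j)) (f (suc (2 ℕ.* j)))) ⟩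
  ∏< M (λ j → g j * g j)                                ≡⟨ ∏-square M g ⟩
  ∏< M g * ∏< M g
    ≤⟨ *-mono (0≤∏ M 0≤g) (≤-trans (0≤∏ M 0≤g) (am-gm N g 0≤g)) (am-gm N g 0≤g) (am-gm N g 0≤g) ⟩
  (h N * ∑< M g) ^ M * (h N * ∑< M g) ^ M               ≡⟨ ^-homo-* (h N * ∑< M g) M M ⟨
  (h N * ∑< M g) ^ (M ℕ.+ M)
    ≡⟨ cong₂ _^_ mean (cong (M ℕ.+_) (sym (ℕₚ.+-identityʳ M))) ⟩
  (h (suc N) * ∑< (2 ℕ.* M) f) ^ (2 ℕ.* M)              ∎
  where
  M : ℕ
  M = 2 ℕ.^ N
  g : ℕ → ℚ
  g j = ½ * (f (2 ℕ.* j) + f (suc (2 ℕ.* j)))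
  odd : ∀ j → j ℕ.< M → suc (2 ℕ.* j) ℕ.< 2 ℕ.* M
  odd j j<M = subst (ℕ._≤ 2 ℕ.* M) (ℕₚ.*-suc 2 j) (ℕₚ.*-monoʳ-≤ 2 j<M)
  even : ∀ j → j ℕ.< M → 2 ℕ.* j ℕ.< 2 ℕ.* M
  even j j<M = ℕₚ.<-trans ℕₚ.≤-refl (odd j j<M)
  0≤g : ∀ j → j ℕ.< M → 0ℚ ≤ g j
  0≤g j j< = 0≤* 0≤½ (0≤+ (0≤f (2 ℕ.* j) (even j j<)) (0≤f (suc (2 ℕ.* j)) (odd j j<)))
  mean : h N * ∑< M g ≡ h (suc N) * ∑< (2 ℕ.* M) f
  mean = begin-equality
    h N * ∑< M g             ≡⟨ cong (h N *_) (∑<-*ˡ M ½ (λ j → f (2 ℕ.* j) + f (suc (2 ℕ.* j)))) ⟩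
    h N * (½ * ∑< M (λ j → f (2 ℕ.* j) + f (suc (2 ℕ.* j))))
      ≡⟨ cong (λ t → h N * (½ * t)) (sym (∑<-double M f)) ⟩
    h N * (½ * ∑< (2 ℕ.* M) f)
      ≡⟨ solve 2 (λ a b → a :* (con ½ :* b) := con ½ :* a :* b) refl (h N) (∑< (2 ℕ.* M) f) ⟩
    h (suc N) * ∑< (2 ℕ.* M) f ∎

-- The nodes s j run from 1 to p, and logₙ N p is the sum of (s (j + 1) - s j) / s j.
module Nodes (N : ℕ) {p : ℚ} (0<p : 0ℚ < p) where

  M : ℕ
  M = 2 ℕ.^ N

  X ℓ : ℚ
  X = p - 1ℚ
  ℓ = logₙ N p

  s : ℕ → ℚ
  s j = 1ℚ + ι j * h N * X

  F : ℕ → ℚ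
  F j = h N * (X * inv (s j))

  s₀ : s 0 ≡ 1ℚ
  s₀ = solve 2 (λ a b → con 1ℚ :+ con 0ℚ :* a :* b := con 1ℚ) refl (h N) X

  s-last : s M ≡ p
  s-last = begin-equality
    1ℚ + ι M * h N * X     ≡⟨ cong (λ t → 1ℚ + t * X) (ι2^*h N) ⟩
    1ℚ + 1ℚ * (p - 1ℚ)     ≡⟨ solve 1 (λ p → con 1ℚ :+ con 1ℚ :* (p :- con 1ℚ) := p) refl p ⟩
    p                      ∎

  s-suc : ∀ j → s (suc j) ≡ s j + h N * X
  s-suc j = trans (cong (λ t → 1ℚ + t * h N * X) (ι-suc j))
    (solve 3 (λ a h x → con 1ℚ :+ (con 1ℚ :+ a) :* h :* x := con 1ℚ :+ a :* h :* x :+ h :* x) refl (ι j) (h N) X)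

  0<s : ∀ j → j ℕ.≤ M → 0ℚ < s j
  0<s j j≤M = go (truncate-at-1 0<p)
    where
    node : ι j * h N ≤ 1ℚ
    node = ≤-trans (*-monoʳ (0≤h N) (ι-mono j≤M)) (≤-reflexive (ι2^*h N))
    go : (∃[ δ ] 0ℚ < δ × δ ≤ 1ℚ × δ ≤ p) → 0ℚ < s j
    go (δ , 0<δ , δ≤1 , δ≤p) = ℚₚ.<-≤-trans 0<δ
      (LogBounds.δ≤denominator 0<δ δ≤1 0<1 (0≤node N j) node δ≤p)

  -- The ratios s (j + 1) / s j and s j / s (j + 1): their products telescope, so AM–GM bounds exp (log p)
  -- from below and from above.
  forward backward : ℕ → ℚ
  forward  j = 1ℚ + F j
  backward j = 1ℚ - F (suc j)

  forward≡ : ∀ j → j ℕ.< M → s j * forward j ≡ s (suc j)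
  forward≡ j j<M = begin-equality
    s j * (1ℚ + h N * (X * inv (s j)))
      ≡⟨ solve 4 (λ s h x i → s :* (con 1ℚ :+ h :* (x :* i)) := s :+ h :* x :* (s :* i)) refl (s j) (h N) X (inv (s j)) ⟩
    s j + h N * X * (s j * inv (s j))    ≡⟨ cong (λ t → s j + h N * X * t) (inv-inverse (0<s j (ℕₚ.<⇒≤ j<M))) ⟩
    s j + h N * X * 1ℚ                   ≡⟨ cong (s j +_) (ℚₚ.*-identityʳ (h N * X)) ⟩
    s j + h N * X                        ≡⟨ s-suc j ⟨
    s (suc j)                            ∎

  backward≡ : ∀ j → j ℕ.< M → s (suc j) * backward j ≡ s j
  backward≡ j j<M = begin-equality
    s (suc j) * (1ℚ - h N * (X * inv (s (suc j))))
      ≡⟨ solve 4 (λ s h x i → s :* (con 1ℚ :- h :* (x :* i)) := s :- h :* x :* (s :* i)) refl (s (suc j)) (h N) X (inv (s (suc j))) ⟩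
    s (suc j) - h N * X * (s (suc j) * inv (s (suc j)))
      ≡⟨ cong₂ (λ a t → a - h N * X * t) (s-suc j) (inv-inverse (0<s (suc j) j<M)) ⟩
    s j + h N * X - h N * X * 1ℚ
      ≡⟨ solve 2 (λ s d → s :+ d :- d :* con 1ℚ := s) refl (s j) (h N * X) ⟩
    s j ∎

  quotient-nonNeg : ∀ {a b c} → 0ℚ < a → 0ℚ < c → a * b ≡ c → 0ℚ ≤ b
  quotient-nonNeg {a} {b} 0<a 0<c ab≡c = ℚₚ.*-cancelˡ-≤-pos a {{positive 0<a}}
    (subst₂ _≤_ (sym (ℚₚ.*-zeroʳ a)) (sym ab≡c) (<⇒≤ 0<c))

  0≤forward : ∀ j → j ℕ.< M → 0ℚ ≤ forward j
  0≤forward j j<M = quotient-nonNeg (0<s j (ℕₚ.<⇒≤ j<M)) (0<s (suc j) j<M) (forward≡ j j<M)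

  0≤backward : ∀ j → j ℕ.< M → 0ℚ ≤ backward j
  0≤backward j j<M = quotient-nonNeg (0<s (suc j) j<M) (0<s j (ℕₚ.<⇒≤ j<M)) (backward≡ j j<M)

  ∏forward : ∀ k → k ℕ.≤ M → ∏< k forward ≡ s k
  ∏forward zero    _   = sym s₀
  ∏forward (suc k) k<M = trans (cong (_* forward k) (∏forward k (ℕₚ.<⇒≤ k<M))) (forward≡ k k<M)

  ∏backward : ∀ k → k ℕ.≤ M → s k * ∏< k backward ≡ 1ℚ
  ∏backward zero    _   = trans (ℚₚ.*-identityʳ (s 0)) s₀
  ∏backward (suc k) k<M = begin-equality
    s (suc k) * (∏< k backward * backward k)
      ≡⟨ solve 3 (λ a b c → a :* (b :* c) := a :* c :* b) refl (s (suc k)) (∏< k backward) (backward k) ⟩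
    s (suc k) * backward k * ∏< k backward    ≡⟨ cong (_* ∏< k backward) (backward≡ k k<M) ⟩
    s k * ∏< k backward                       ≡⟨ ∏backward k (ℕₚ.<⇒≤ k<M) ⟩
    1ℚ                                        ∎

  h*∑1+ : ∀ f → h N * ∑< M (λ j → 1ℚ + f j) ≡ 1ℚ + ∑< M f * h N
  h*∑1+ f = begin-equality
    h N * ∑< M (λ j → 1ℚ + f j)       ≡⟨ cong (h N *_) (∑<-+ M (λ _ → 1ℚ) f) ⟩
    h N * (∑< M (λ _ → 1ℚ) + ∑< M f)  ≡⟨ cong (λ t → h N * (t + ∑< M f)) (∑<-const M 1ℚ) ⟩
    h N * (ι M * 1ℚ + ∑< M f)
      ≡⟨ solve 3 (λ h m f → h :* (m :* con 1ℚ :+ f) := m :* h :+ f :* h) refl (h N) (ι M) (∑< M f) ⟩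
    ι M * h N + ∑< M f * h N          ≡⟨ cong (_+ ∑< M f * h N) (ι2^*h N) ⟩
    1ℚ + ∑< M f * h N                 ∎

  p≤exp-log : p ≤ expₙ N ℓ
  p≤exp-log = begin
    p                                ≡⟨ trans (∏forward M ℕₚ.≤-refl) s-last ⟨
    ∏< M forward                     ≤⟨ am-gm N forward 0≤forward ⟩
    (h N * ∑< M forward) ^ M         ≡⟨ cong (_^ M) (h*∑1+ F) ⟩
    (1ℚ + ℓ * h N) ^ M               ∎

  module _ (1≤p : 1ℚ ≤ p) where

    0≤X : 0ℚ ≤ X
    0≤X = -‿≤ 1≤p

    0≤F : ∀ j → j ℕ.≤ M → 0ℚ ≤ F j
    0≤F j j≤M = 0≤* (0≤h N) (0≤* 0≤X (<⇒≤ (0<inv (0<s j j≤M))))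

    ℓ′ : ℚ
    ℓ′ = ∑< M (λ j → F (suc j))

    0≤ℓ′ : 0ℚ ≤ ℓ′
    0≤ℓ′ = 0≤∑< M (λ j j<M → 0≤F (suc j) j<M)

    shift-sum : ∀ k → ∑< k F + F k ≡ F 0 + ∑< k (λ j → F (suc j))
    shift-sum zero    = trans (ℚₚ.+-identityˡ (F 0)) (sym (ℚₚ.+-identityʳ (F 0)))
    shift-sum (suc k) = trans (cong (_+ F (suc k)) (shift-sum k)) (ℚₚ.+-assoc (F 0) _ (F (suc k)))

    inv1 : inv (s 0) ≡ 1ℚ
    inv1 = trans (sym (trans (cong (_* inv (s 0)) s₀) (ℚₚ.*-identityˡ (inv (s 0)))))
      (inv-inverse (0<s 0 z≤n))

    -- The left Riemann sum exceeds the right one `ℓ′` by F 0 - F M, where F 0 is h X.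
    ℓ≤ : ℓ ≤ h N * X + ℓ′
    ℓ≤ = begin
      ℓ                   ≤⟨ p≤p+q (0≤F M ℕₚ.≤-refl) ⟩
      ℓ + F M             ≡⟨ shift-sum M ⟩
      F 0 + ℓ′            ≡⟨ cong (λ t → h N * (X * t) + ℓ′) inv1 ⟩
      h N * (X * 1ℚ) + ℓ′ ≡⟨ cong (λ t → h N * t + ℓ′) (ℚₚ.*-identityʳ X) ⟩
      h N * X + ℓ′        ∎

    v δ : ℚ
    v = ℓ′ * h N
    δ = h N * (h N * X)

    0≤v : 0ℚ ≤ v
    0≤v = 0≤* 0≤ℓ′ (0≤h N)

    0≤δ : 0ℚ ≤ δ
    0≤δ = 0≤* (0≤h N) (0≤* (0≤h N) 0≤X)

    mean-backward : h N * ∑< M backward ≡ 1ℚ - v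
    mean-backward = trans (h*∑1+ (λ j → - F (suc j))) (cong (1ℚ +_) (begin-equality
      ∑< M (λ j → - F (suc j)) * h N  ≡⟨ cong (_* h N) (neg-sum M) ⟩
      - ℓ′ * h N                      ≡⟨ solve 2 (λ a b → :- a :* b := :- (a :* b)) refl ℓ′ (h N) ⟩
      - v                             ∎))
      where
      neg-sum : ∀ k → ∑< k (λ j → - F (suc j)) ≡ - ∑< k (λ j → F (suc j))
      neg-sum zero    = refl
      neg-sum (suc k) = trans (cong (_+ - F (suc k)) (neg-sum k)) (sym (ℚₚ.neg-distrib-+ (∑< k (λ j → F (suc j))) (F (suc k))))

    0≤1-v : 0ℚ ≤ 1ℚ - v
    0≤1-v = subst (0ℚ ≤_) mean-backward (0≤* (0≤h N) (0≤∑< M 0≤backward))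

    1≤p*[1-v]^M : 1ℚ ≤ p * (1ℚ - v) ^ M
    1≤p*[1-v]^M = begin
      1ℚ                              ≡⟨ trans (cong (_* ∏< M backward) (sym s-last)) (∏backward M ℕₚ.≤-refl) ⟨
      p * ∏< M backward               ≤⟨ *-monoˡ (<⇒≤ 0<p) (am-gm N backward 0≤backward) ⟩
      p * (h N * ∑< M backward) ^ M   ≡⟨ cong (λ t → p * t ^ M) mean-backward ⟩
      p * (1ℚ - v) ^ M                ∎

    1^ : ∀ k → 1ℚ ^ k ≡ 1ℚ
    1^ zero    = refl
    1^ (suc k) = trans (ℚₚ.*-identityˡ (1ℚ ^ k)) (1^ k)

    -- Multiplication by 1 ≤ p (1 - v)^M replaces a division and leaves p (1 - v²)^M.
    [1+v]^M≤p : (1ℚ + v) ^ M ≤ p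
    [1+v]^M≤p = begin
      (1ℚ + v) ^ M                          ≡⟨ ℚₚ.*-identityʳ _ ⟨
      (1ℚ + v) ^ M * 1ℚ                     ≤⟨ *-monoˡ (0≤^ M (0≤+ 0≤1 0≤v)) 1≤p*[1-v]^M ⟩
      (1ℚ + v) ^ M * (p * (1ℚ - v) ^ M)
        ≡⟨ solve 3 (λ a b c → a :* (b :* c) := b :* (a :* c)) refl ((1ℚ + v) ^ M) p ((1ℚ - v) ^ M) ⟩
      p * ((1ℚ + v) ^ M * (1ℚ - v) ^ M)     ≡⟨ cong (p *_) (^-distrib-* (1ℚ + v) (1ℚ - v) M) ⟨
      p * ((1ℚ + v) * (1ℚ - v)) ^ M         ≤⟨ *-monoˡ (<⇒≤ 0<p) (^-mono M (0≤* (0≤+ 0≤1 0≤v) 0≤1-v) product≤1) ⟩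
      p * 1ℚ ^ M                            ≡⟨ trans (cong (p *_) (1^ M)) (ℚₚ.*-identityʳ p) ⟩
      p                                     ∎
      where
      product≤1 : (1ℚ + v) * (1ℚ - v) ≤ 1ℚ
      product≤1 = ≤-trans (≤-reflexive (solve 1 (λ v → (con 1ℚ :+ v) :* (con 1ℚ :- v) := con 1ℚ :- v :* v) refl v))
        (p-q≤p (0≤square v))

    [1+δ]^M≤2 : h N * X ≤ ½ → (1ℚ + δ) ^ M ≤ 1ℚ + 1ℚ
    [1+δ]^M≤2 hX≤½ = ^-upper M 0≤δ (≤-trans (≤-reflexive (average N (h N * X))) hX≤½)

    0≤ℓ : 0ℚ ≤ ℓ
    0≤ℓ = 0≤∑< M (λ j j<M → 0≤F j (ℕₚ.<⇒≤ j<M))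

    0≤ℓh : 0ℚ ≤ ℓ * h N
    0≤ℓh = 0≤* 0≤ℓ (0≤h N)

    -- Passing from the left to the right Riemann sum costs the factor (1 + δ)^M. As M δ = h X ≤ ½,
    -- it is at most 2.
    exp-log≤2p : h N * X ≤ ½ → expₙ N ℓ ≤ (1ℚ + 1ℚ) * p
    exp-log≤2p hX≤½ = begin
      (1ℚ + ℓ * h N) ^ M                 ≤⟨ ^-mono M (0≤+ 0≤1 0≤ℓh) base ⟩
      ((1ℚ + δ) * (1ℚ + v)) ^ M          ≡⟨ ^-distrib-* (1ℚ + δ) (1ℚ + v) M ⟩
      (1ℚ + δ) ^ M * (1ℚ + v) ^ M
        ≤⟨ *-mono (0≤^ M (0≤+ 0≤1 0≤v)) (ℚₚ.nonNegative⁻¹ (1ℚ + 1ℚ)) ([1+δ]^M≤2 hX≤½) [1+v]^M≤p ⟩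
      (1ℚ + 1ℚ) * p                      ∎
      where
      base : 1ℚ + ℓ * h N ≤ (1ℚ + δ) * (1ℚ + v)
      base = begin
        1ℚ + ℓ * h N                     ≤⟨ ℚₚ.+-monoʳ-≤ 1ℚ (*-monoʳ (0≤h N) ℓ≤) ⟩
        1ℚ + (h N * X + ℓ′) * h N        ≤⟨ p≤p+q (0≤* 0≤δ 0≤v) ⟩
        1ℚ + (h N * X + ℓ′) * h N + δ * v
          ≡⟨ solve 3 (λ h x l → con 1ℚ :+ (h :* x :+ l) :* h :+ h :* (h :* x) :* (l :* h)
               := (con 1ℚ :+ h :* (h :* x)) :* (con 1ℚ :+ l :* h)) refl (h N) X ℓ′ ⟩
        (1ℚ + δ) * (1ℚ + v)              ∎

ι-* : ∀ m n → ι (m ℕ.* n) ≡ ι m * ι n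
ι-* zero    n = sym (ℚₚ.*-zeroˡ (ι n))
ι-* (suc m) n = begin-equality
  ι (n ℕ.+ m ℕ.* n)      ≡⟨ ι-+ n (m ℕ.* n) ⟩
  ι n + ι (m ℕ.* n)      ≡⟨ cong (ι n +_) (ι-* m n) ⟩
  ι n + ι m * ι n        ≡⟨ solve 2 (λ a b → b :+ a :* b := (con 1ℚ :+ a) :* b) refl (ι m) (ι n) ⟩
  (1ℚ + ι m) * ι n       ≡⟨ cong (_* ι n) (ι-suc m) ⟨
  ι (suc m) * ι n        ∎

ι-^ : ∀ m k → ι (m ℕ.^ k) ≡ ι m ^ k
ι-^ m zero    = refl
ι-^ m (suc k) = trans (ι-* m (m ℕ.^ k)) (cong (ι m *_) (ι-^ m k))

2^[1+N∸s]*ℓh≤½ : ∀ N s {ℓ} → s ℕ.≤ N → ℓ ≤ ι (2 ℕ.^ s) * (½ * ½) →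
  ι (2 ℕ.^ suc (N ℕ.∸ s)) * (ℓ * h N) ≤ ½
2^[1+N∸s]*ℓh≤½ N s {ℓ} s≤N ℓ≤ = begin
  ι (2 ℕ.* 2 ℕ.^ r) * (ℓ * h N)       ≡⟨ cong₂ (λ a k → a * (ℓ * h k)) (ι-double (2 ℕ.^ r)) (sym (ℕₚ.m∸n+n≡m s≤N)) ⟩
  (A + A) * (ℓ * h (r ℕ.+ s))         ≡⟨ cong (λ t → (A + A) * (ℓ * t)) (^-homo-* ½ r s) ⟩
  (A + A) * (ℓ * (h r * h s))
    ≡⟨ solve 4 (λ a l x y → (a :+ a) :* (l :* (x :* y)) := a :* x :* (l :* (y :+ y))) refl A ℓ (h r) (h s) ⟩
  A * h r * (ℓ * (h s + h s))         ≡⟨ cong (_* (ℓ * (h s + h s))) (ι2^*h r) ⟩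
  1ℚ * (ℓ * (h s + h s))              ≤⟨ *-monoˡ 0≤1 (*-monoʳ (0≤+ (0≤h s) (0≤h s)) ℓ≤) ⟩
  1ℚ * (ι (2 ℕ.^ s) * (½ * ½) * (h s + h s))
    ≡⟨ solve 2 (λ a y → con 1ℚ :* (a :* (con ½ :* con ½) :* (y :+ y)) := a :* y :* con ½) refl (ι (2 ℕ.^ s)) (h s) ⟩
  ι (2 ℕ.^ s) * h s * ½               ≡⟨ cong (_* ½) (ι2^*h s) ⟩
  ½                                   ∎
  where
  r : ℕ
  r = N ℕ.∸ s
  A : ℚ
  A = ι (2 ℕ.^ r)

-- Otherwise group the 2M factors of (1 + ℓh)^(2M) into 2^k blocks: each is at most 2 by `^-upper`,
-- so the power is at most `Q`. But it is at least p², hence at least Q².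
log-lower : ∀ N k {p} → k ℕ.≤ N → ι (2 ℕ.^ (2 ℕ.^ k)) ≤ p → ι (2 ℕ.^ k) * (½ * ½) ≤ logₙ N p
log-lower N k {p} k≤N Q≤p with ℚₚ.≤-total (ι (2 ℕ.^ k) * (½ * ½)) (logₙ N p)
... | inj₁ Λ/4≤ℓ = Λ/4≤ℓ
... | inj₂ ℓ≤Λ/4 = ⊥-elim (ℚₚ.<-irrefl refl (ℚₚ.<-≤-trans Q<Q² Q²≤Q))
  where
  Q : ℚ
  Q = ι (2 ℕ.^ (2 ℕ.^ k))
  2≤Q : ι 2 ≤ Q
  2≤Q = ι-mono (ℕₚ.^-monoʳ-≤ 2 (ℕₚ.m^n>0 2 k))
  0<Q : 0ℚ < Q
  0<Q = ℚₚ.<-≤-trans (ℚₚ.positive⁻¹ (ι 2)) 2≤Q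
  1≤p : 1ℚ ≤ p
  1≤p = ≤-trans (ι-mono {1} {2} (s≤s z≤n)) (≤-trans 2≤Q Q≤p)
  open Nodes N {p} (ℚₚ.<-≤-trans 0<Q Q≤p)
  u : ℚ
  u = ℓ * h N
  Q<Q² : Q < Q * Q
  Q<Q² = begin-strict
    Q          ≡⟨ ℚₚ.*-identityʳ Q ⟨
    Q * 1ℚ     <⟨ ℚₚ.*-monoʳ-<-pos Q {{positive 0<Q}} (ℚₚ.<-≤-trans (subst (1ℚ <_) (sym (ι-suc 1)) (0<+ʳ 0<1)) 2≤Q) ⟩
    Q * Q      ∎
    where
    0<+ʳ : ∀ {q} → 0ℚ < q → 1ℚ < 1ℚ + q
    0<+ʳ {q} 0<q = subst (_< 1ℚ + q) (ℚₚ.+-identityʳ 1ℚ) (ℚₚ.+-monoʳ-< 1ℚ 0<q)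
  Q²≤Q : Q * Q ≤ Q
  Q²≤Q = begin
    Q * Q                                    ≤⟨ *-mono (<⇒≤ 0<Q) (≤-trans (<⇒≤ 0<Q) Q≤exp) Q≤exp Q≤exp ⟩
    (1ℚ + u) ^ M * (1ℚ + u) ^ M              ≡⟨ ^-homo-* (1ℚ + u) M M ⟨
    (1ℚ + u) ^ (M ℕ.+ M)                     ≡⟨ cong ((1ℚ + u) ^_) exponents ⟩
    (1ℚ + u) ^ (2 ℕ.^ suc (N ℕ.∸ k) ℕ.* 2 ℕ.^ k) ≡⟨ ^-assocʳ (1ℚ + u) (2 ℕ.^ suc (N ℕ.∸ k)) (2 ℕ.^ k) ⟨
    ((1ℚ + u) ^ (2 ℕ.^ suc (N ℕ.∸ k))) ^ (2 ℕ.^ k)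
      ≤⟨ ^-mono (2 ℕ.^ k) (0≤^ (2 ℕ.^ suc (N ℕ.∸ k)) (0≤+ 0≤1 (0≤ℓh 1≤p)))
           (^-upper (2 ℕ.^ suc (N ℕ.∸ k)) (0≤ℓh 1≤p) (2^[1+N∸s]*ℓh≤½ N k k≤N ℓ≤Λ/4)) ⟩
    ι 2 ^ (2 ℕ.^ k)                          ≡⟨ ι-^ 2 (2 ℕ.^ k) ⟨
    Q                                        ∎
    where
    Q≤exp : Q ≤ (1ℚ + u) ^ M
    Q≤exp = ≤-trans Q≤p p≤exp-log
    exponents : M ℕ.+ M ≡ 2 ℕ.^ suc (N ℕ.∸ k) ℕ.* 2 ℕ.^ k
    exponents = trans (cong (M ℕ.+_) (sym (ℕₚ.+-identityʳ M)))
      (trans (cong (λ j → 2 ℕ.^ suc j) (sym (ℕₚ.m∸n+n≡m k≤N))) (ℕₚ.^-distribˡ-+-* 2 (suc (N ℕ.∸ k)) k))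

-- Bernoulli's inequality 1 + 8u/5 ≤ (1 + u)^(8/5), raised to the fifth power
[1+8u/5]⁵≤[1+u]⁸ : ∀ {u} → 0ℚ ≤ u → (1ℚ + (ℤ.+ 8 / 5) * u) ^ 5 ≤ (1ℚ + u) ^ 8
[1+8u/5]⁵≤[1+u]⁸ {u} 0≤u = begin
  (1ℚ + (ℤ.+ 8 / 5) * u) ^ 5
    ≡⟨ cong (λ t → (1ℚ + t) ^ 5) (solve 1 (λ u → con (ℤ.+ 8 / 5) :* u := con (ι 8) :* (con (ℤ.+ 1 / 5) :* u)) refl u) ⟩
  (1ℚ + ι 8 * w) ^ 5
    ≤⟨ p≤p+q (0≤* (0≤* 0≤w 0≤w) (0≤horner 60 (0≤horner 1880 (0≤horner 23270 (0≤horner 142232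
          (0≤horner 437500 (0≤horner 625000 (0≤horner 390625 (0≤ι 0))))))))) ⟩
  (1ℚ + ι 8 * w) ^ 5 + w * w * (ι 60 + w * (ι 1880 + w * (ι 23270
      + w * (ι 142232 + w * (ι 437500 + w * (ι 625000 + w * (ι 390625 + w * ι 0)))))))
    ≡⟨ solve 1 (λ w → (con 1ℚ :+ con (ι 8) :* w) :^ 5 :+ w :* w :* (con (ι 60) :+ w :* (con (ι 1880)
           :+ w :* (con (ι 23270) :+ w :* (con (ι 142232) :+ w :* (con (ι 437500)
           :+ w :* (con (ι 625000) :+ w :* (con (ι 390625) :+ w :* con (ι 0))))))))
         := (con 1ℚ :+ con (ι 5) :* w) :^ 8) refl w ⟩
  (1ℚ + ι 5 * w) ^ 8
    ≡⟨ cong (λ t → (1ℚ + t) ^ 8) (solve 1 (λ u → con (ι 5) :* (con (ℤ.+ 1 / 5) :* u) := u) refl u) ⟩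
  (1ℚ + u) ^ 8                ∎
  where
  -- In w = u/5 both sides have integer coefficients. They agree up to degree one, and the
  -- difference is w² times a polynomial with positive coefficients.
  w : ℚ
  w = (ℤ.+ 1 / 5) * u
  0≤w : 0ℚ ≤ w
  0≤w = 0≤* (ℚₚ.nonNegative⁻¹ (ℤ.+ 1 / 5)) 0≤u
  0≤horner : ∀ a {t} → 0ℚ ≤ t → 0ℚ ≤ ι a + w * t
  0≤horner a 0≤t = 0≤+ (0≤ι a) (0≤* 0≤w 0≤t)

^-comm : ∀ x m n → (x ^ m) ^ n ≡ (x ^ n) ^ m
^-comm x m n = trans (^-assocʳ x m n) (trans (cong (x ^_) (ℕₚ.*-comm m n)) (sym (^-assocʳ x n m)))

-- Moving the fifth power inside the M-th power lets Bernoulli's inequality act on the base; exp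
-- (log p) ≤ 2p is then raised to the eighth power.
exp-8/5-log⁵≤ : ∀ N {p} → 1ℚ ≤ p → h N * (p - 1ℚ) ≤ ½ →
  expₙ N ((ℤ.+ 8 / 5) * logₙ N p) ^ 5 ≤ ((1ℚ + 1ℚ) * p) ^ 8
exp-8/5-log⁵≤ N {p} 1≤p hX≤½ = begin
  ((1ℚ + (ℤ.+ 8 / 5) * ℓ * h N) ^ M) ^ 5     ≡⟨ cong (λ t → ((1ℚ + t) ^ M) ^ 5) (ℚₚ.*-assoc (ℤ.+ 8 / 5) ℓ (h N)) ⟩
  ((1ℚ + (ℤ.+ 8 / 5) * (ℓ * h N)) ^ M) ^ 5   ≡⟨ ^-comm (1ℚ + (ℤ.+ 8 / 5) * (ℓ * h N)) M 5 ⟩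
  ((1ℚ + (ℤ.+ 8 / 5) * (ℓ * h N)) ^ 5) ^ M
    ≤⟨ ^-mono M (0≤^ 5 (0≤+ 0≤1 (0≤* (ℚₚ.nonNegative⁻¹ (ℤ.+ 8 / 5)) (0≤ℓh 1≤p)))) ([1+8u/5]⁵≤[1+u]⁸ (0≤ℓh 1≤p)) ⟩
  ((1ℚ + ℓ * h N) ^ 8) ^ M                   ≡⟨ ^-comm (1ℚ + ℓ * h N) 8 M ⟩
  ((1ℚ + ℓ * h N) ^ M) ^ 8                   ≤⟨ ^-mono 8 (0≤^ M (0≤+ 0≤1 (0≤ℓh 1≤p))) (exp-log≤2p 1≤p hX≤½) ⟩
  ((1ℚ + 1ℚ) * p) ^ 8                        ∎
  where open Nodes N {p} (ℚₚ.<-≤-trans 0<1 1≤p)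

0<^ : ∀ {x} n → 0ℚ < x → 0ℚ < x ^ n
0<^ = ExpBounds.0<^ 0<1

-- Here D is m, ν is n, y is n^(8/5) and Λ the dyadic scale of log₂ n. The fifth power of the first
-- bound leads to D⁵Λ⁵ ≤ ½ D⁵Λ³. The factor 2²¹ is 4⁵ · 2⁸ · 2³: from log n ≥ Λ/4, from exp (log n)
-- ≤ 2n, and from log₂ n < 2Λ.
incompatible : ∀ {D Λ y ν K c} → 0ℚ < D → 1ℚ ≤ Λ → 0ℚ ≤ y → 0ℚ ≤ c →
  D * (Λ * (½ * ½)) ≤ c * y → y ^ 5 ≤ ((1ℚ + 1ℚ) * ν) ^ 8 →
  ν ^ 8 ≤ K * ((ι 2 * Λ) ^ 3 * D ^ 5) → c ^ 5 * (ι (2 ℕ.^ 21) * K) ≤ ½ → ⊥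
incompatible {D} {Λ} {y} {ν} {K} {c} 0<D 1≤Λ 0≤y 0≤c DΛ≤ y⁵≤ ν⁸≤ c⁵K≤ = ℚₚ.<-irrefl refl (begin-strict
  T                                        ≡⟨ solve 2 (λ d l → d :^ 5 :* l :^ 5 := (d :* l) :^ 5) refl D Λ ⟩
  (D * Λ) ^ 5
    ≡⟨ cong (_^ 5) (solve 2 (λ d l → d :* l := con (ι 4) :* (d :* (l :* (con ½ :* con ½)))) refl D Λ) ⟩
  (ι 4 * (D * (Λ * (½ * ½)))) ^ 5
    ≤⟨ ^-mono 5 (0≤* (0≤ι 4) (0≤* (<⇒≤ 0<D) (0≤* (<⇒≤ 0<Λ) (0≤* 0≤½ 0≤½)))) (*-monoˡ (0≤ι 4) DΛ≤) ⟩
  (ι 4 * (c * y)) ^ 5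
    ≡⟨ solve 2 (λ c y → (con (ι 4) :* (c :* y)) :^ 5 := con (ι 1024) :* c :^ 5 :* y :^ 5) refl c y ⟩
  ι 1024 * c ^ 5 * y ^ 5                   ≤⟨ *-monoˡ (0≤* (0≤ι 1024) (0≤^ 5 0≤c)) y⁵≤ ⟩
  ι 1024 * c ^ 5 * ((1ℚ + 1ℚ) * ν) ^ 8
    ≡⟨ solve 2 (λ c n → con (ι 1024) :* c :* ((con 1ℚ :+ con 1ℚ) :* n) :^ 8 := con (ι 262144) :* c :* n :^ 8) refl (c ^ 5) ν ⟩
  ι 262144 * c ^ 5 * ν ^ 8                 ≤⟨ *-monoˡ (0≤* (0≤ι 262144) (0≤^ 5 0≤c)) ν⁸≤ ⟩
  ι 262144 * c ^ 5 * (K * ((ι 2 * Λ) ^ 3 * D ^ 5))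
    ≡⟨ solve 4 (λ c k l d → con (ι 262144) :* c :* (k :* ((con (ι 2) :* l) :^ 3 :* d))
         := c :* (con (ι 2097152) :* k) :* (d :* l :^ 3)) refl (c ^ 5) K Λ (D ^ 5) ⟩
  c ^ 5 * (ι (2 ℕ.^ 21) * K) * (D ^ 5 * Λ ^ 3)  ≤⟨ *-monoʳ (0≤* (0≤^ 5 (<⇒≤ 0<D)) (0≤^ 3 (<⇒≤ 0<Λ))) c⁵K≤ ⟩
  ½ * (D ^ 5 * Λ ^ 3)                      ≤⟨ *-monoˡ 0≤½ (*-monoˡ (0≤^ 5 (<⇒≤ 0<D)) Λ³≤Λ⁵) ⟩
  ½ * T                                    <⟨ ½T<T ⟩
  T                                        ∎)
  where
  0<Λ : 0ℚ < Λ
  0<Λ = ℚₚ.<-≤-trans 0<1 1≤Λ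
  T : ℚ
  T = D ^ 5 * Λ ^ 5
  0<T : 0ℚ < T
  0<T = 0<* (0<^ 5 0<D) (0<^ 5 0<Λ)
  ½T<T : ½ * T < T
  ½T<T = begin-strict
    ½ * T          ≡⟨ ℚₚ.+-identityʳ (½ * T) ⟨
    ½ * T + 0ℚ     <⟨ ℚₚ.+-monoʳ-< (½ * T) (0<* 0<½ 0<T) ⟩
    ½ * T + ½ * T  ≡⟨ ½+½ T ⟩
    T              ∎
  Λ³≤Λ⁵ : Λ ^ 3 ≤ Λ ^ 5
  Λ³≤Λ⁵ = begin
    Λ ^ 3               ≡⟨ solve 1 (λ l → l :^ 3 := con 1ℚ :* con 1ℚ :* l :^ 3) refl Λ ⟩
    1ℚ * 1ℚ * Λ ^ 3     ≤⟨ *-monoʳ (0≤^ 3 (<⇒≤ 0<Λ)) (*-mono 0≤1 (<⇒≤ 0<Λ) 1≤Λ 1≤Λ) ⟩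
    Λ * Λ * Λ ^ 3       ≡⟨ ℚₚ.*-assoc Λ Λ (Λ ^ 3) ⟩
    Λ ^ 5               ∎

-- The equation 2⁻⁵⁵ · 2⁵⁴ = ½ is what fixes c = 2⁻¹¹.
h-constant : h 11 ^ 5 * (ι (2 ℕ.^ 21) * ι (2 ℕ.^ 33)) ≤ ½
h-constant = ≤-reflexive (begin-equality
  h 11 ^ 5 * (ι (2 ℕ.^ 21) * ι (2 ℕ.^ 33))   ≡⟨ cong₂ _*_ (^-assocʳ ½ 11 5) (sym (ι-* (2 ℕ.^ 21) (2 ℕ.^ 33))) ⟩
  h 55 * ι (2 ℕ.^ 21 ℕ.* 2 ℕ.^ 33)           ≡⟨ cong (λ k → h 55 * ι k) (sym (ℕₚ.^-distribˡ-+-* 2 21 33)) ⟩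
  ½ * h 54 * ι (2 ℕ.^ 54)
    ≡⟨ solve 3 (λ a b c → a :* b :* c := c :* b :* a) refl ½ (h 54) (ι (2 ℕ.^ 54)) ⟩
  ι (2 ℕ.^ 54) * h 54 * ½                    ≡⟨ cong (_* ½) (ι2^*h 54) ⟩
  ½                                          ∎)

-- From real numbers to ranks

open Combinatorics using (∑; ∑-mono; ∑-mono-<; ∑-const; 𝟙; 𝟙≤1; 𝟙-mono; 𝟙-mono-<; Incidence; module SchoenShkredov)

Seq : Set
Seq = ℕ → ℚ

-- Order and equality of reals in terms of the difference sequence: linear relations between reals
-- become rational identities that the ring solver checks termwise.
Pos Zero : Seq → Set
Pos  f = ∃[ ε ] 0ℚ < ε × ∃[ N ] ∀ n → N ℕ.≤ n → ε ≤ f n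
Zero f = ∀ ε → 0ℚ < ε → ∃[ N ] ∀ n → N ℕ.≤ n → ∣ f n ∣ < ε

<ᴿ⇒Pos : ∀ x y → x <ᴿ y → Pos (λ n → seq y n - seq x n)
<ᴿ⇒Pos x y (ε , 0<ε , N , x+ε≤y) = ε , 0<ε , N , λ n N≤n → begin
  ε                          ≡⟨ solve 2 (λ x e → e := x :+ e :- x) refl (seq x n) ε ⟩
  seq x n + ε - seq x n      ≤⟨ ℚₚ.+-monoˡ-≤ (- seq x n) (x+ε≤y n N≤n) ⟩
  seq y n - seq x n          ∎

Pos-resp : ∀ {f g} → (∀ n → f n ≡ g n) → Pos f → Pos g
Pos-resp f≡g (ε , 0<ε , N , ε≤f) = ε , 0<ε , N , λ n N≤n → subst (ε ≤_) (f≡g n) (ε≤f n N≤n)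

Zero-resp : ∀ {f g} → (∀ n → f n ≡ g n) → Zero f → Zero g
Zero-resp f≡g f≈0 ε 0<ε with f≈0 ε 0<ε
... | N , f<ε = N , λ n N≤n → subst (λ t → ∣ t ∣ < ε) (f≡g n) (f<ε n N≤n)

Pos-+ : ∀ {f g} → Pos f → Pos g → Pos (λ n → f n + g n)
Pos-+ (ε , 0<ε , M , ε≤f) (δ , 0<δ , N , δ≤g) = ε + δ , 0<+ 0<ε (<⇒≤ 0<δ) , M ℕ.⊔ N , λ n ≤n →
  ℚₚ.+-mono-≤ (ε≤f n (ℕₚ.m⊔n≤o⇒m≤o M N ≤n)) (δ≤g n (ℕₚ.m⊔n≤o⇒n≤o M N ≤n))

-∣∣≤ : ∀ p → - ∣ p ∣ ≤ p
-∣∣≤ p = subst (- ∣ p ∣ ≤_) (solve 1 (λ p → :- (:- p) := p) refl p)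
  (ℚₚ.neg-antimono-≤ (subst (- p ≤_) (ℚₚ.∣-p∣≡∣p∣ p) (p≤∣p∣ (- p))))

Pos-+-Zero : ∀ {f g} → Pos f → Zero g → Pos (λ n → f n + g n)
Pos-+-Zero {f} {g} (ε , 0<ε , M , ε≤f) g≈0 with g≈0 (½ * ε) (0<* 0<½ 0<ε)
... | N , g<ε/2 = ½ * ε , 0<* 0<½ 0<ε , M ℕ.⊔ N , λ n ≤n → begin
  ½ * ε              ≡⟨ solve 1 (λ e → con ½ :* e := e :- con ½ :* e) refl ε ⟩
  ε - ½ * ε          ≤⟨ ℚₚ.+-mono-≤ (ε≤f n (ℕₚ.m⊔n≤o⇒m≤o M N ≤n))
                          (≤-trans (ℚₚ.neg-antimono-≤ (<⇒≤ (g<ε/2 n (ℕₚ.m⊔n≤o⇒n≤o M N ≤n)))) (-∣∣≤ (g n))) ⟩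
  f n + g n          ∎

Zero-+ : ∀ {f g} → Zero f → Zero g → Zero (λ n → f n + g n)
Zero-+ {f} {g} f≈0 g≈0 ε 0<ε with f≈0 (½ * ε) (0<* 0<½ 0<ε) | g≈0 (½ * ε) (0<* 0<½ 0<ε)
... | M , f< | N , g< = M ℕ.⊔ N , λ n ≤n → ℚₚ.≤-<-trans (ℚₚ.∣p+q∣≤∣p∣+∣q∣ (f n) (g n))
  (subst (∣ f n ∣ + ∣ g n ∣ <_) (½+½ ε)
    (ℚₚ.+-mono-< (f< n (ℕₚ.m⊔n≤o⇒m≤o M N ≤n)) (g< n (ℕₚ.m⊔n≤o⇒n≤o M N ≤n))))

Zero-neg : ∀ {f} → Zero f → Zero (λ n → - f n)
Zero-neg {f} f≈0 ε 0<ε with f≈0 ε 0<ε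
... | N , f< = N , λ n N≤n → subst (_< ε) (sym (ℚₚ.∣-p∣≡∣p∣ (f n))) (f< n N≤n)

Zero-0 : Zero (λ _ → 0ℚ)
Zero-0 ε 0<ε = 0 , λ _ _ → 0<ε

Pos⇒¬Zero : ∀ {f} → Pos f → ¬ Zero f
Pos⇒¬Zero {f} (ε , 0<ε , M , ε≤f) f≈0 with f≈0 ε 0<ε
... | N , f<ε = ℚₚ.<-irrefl refl (ℚₚ.≤-<-trans (≤-trans (ε≤f (M ℕ.⊔ N) (ℕₚ.m≤m⊔n M N)) (p≤∣p∣ (f (M ℕ.⊔ N))))
                  (f<ε (M ℕ.⊔ N) (ℕₚ.m≤n⊔m M N)))

Pos-asym : ∀ {f} → Pos f → ¬ Pos (λ n → - f n)
Pos-asym {f} f>0 f<0 = Pos⇒¬Zero (Pos-resp (λ n → ℚₚ.+-inverseʳ (f n)) (Pos-+ f>0 f<0)) Zero-0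

-- If |f n| ≥ ε at a stage after which f moves by less than ε/2, then f or -f stays above ε/2. The
-- test |f n| < ε compares rationals, so no double negation remains.
trichotomy : ∀ {f} → Small (λ m n → ∣ f m - f n ∣) → ¬ Pos f → ¬ Pos (λ n → - f n) → Zero f
trichotomy {f} cauchy-f f≯0 f≮0 ε 0<ε = go (cauchy-f (½ * ε) 0<ε/2)
  where
  0<ε/2 : 0ℚ < ½ * ε
  0<ε/2 = 0<* 0<½ 0<ε
  stays-large : ∀ {g N} → (∀ n → N ℕ.≤ n → ∣ g N - g n ∣ < ½ * ε) → ε ≤ g N → Pos g
  stays-large {g} {N} close ε≤gN = ½ * ε , 0<ε/2 , N , λ n N≤n → begin
    ½ * ε                   ≡⟨ solve 1 (λ e → con ½ :* e := e :- con ½ :* e) refl ε ⟩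
    ε - ½ * ε               ≤⟨ ℚₚ.+-mono-≤ ε≤gN (ℚₚ.neg-antimono-≤ (≤-trans (p≤∣p∣ (g N - g n)) (<⇒≤ (close n N≤n)))) ⟩
    g N - (g N - g n)       ≡⟨ solve 2 (λ a b → a :- (a :- b) := b) refl (g N) (g n) ⟩
    g n                     ∎
  go : (∃[ N ] ∀ m n → N ℕ.≤ m → N ℕ.≤ n → ∣ f m - f n ∣ < ½ * ε) → ∃[ N ] ∀ n → N ℕ.≤ n → ∣ f n ∣ < ε
  go (N , close) = N , λ n N≤n → small n (λ k n≤k → close n k N≤n (ℕₚ.≤-trans N≤n n≤k))
    where
    small : ∀ n → (∀ k → n ℕ.≤ k → ∣ f n - f k ∣ < ½ * ε) → ∣ f n ∣ < ε
    small n near with ∣ f n ∣ ℚₚ.<? ε | ℚₚ.∣p∣≡p∨∣p∣≡-p (f n)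
    ... | yes f<ε | _ = f<ε
    ... | no f≮ε | inj₁ ∣f∣≡f = ⊥-elim (f≯0 (stays-large {f} {n} near (subst (ε ≤_) ∣f∣≡f (ℚₚ.≮⇒≥ f≮ε))))
    ... | no f≮ε | inj₂ ∣f∣≡-f = ⊥-elim (f≮0 (stays-large {λ k → - f k} {n}
            (λ k n≤k → subst (_< ½ * ε) (trans (∣-∣-swap (f n) (f k))
              (cong ∣_∣ (solve 2 (λ a b → b :- a := :- a :- :- b) refl (f n) (f k)))) (near k n≤k))
            (subst (ε ≤_) ∣f∣≡-f (ℚₚ.≮⇒≥ f≮ε))))

-- Gaps of a convex sequence

module Gaps (f : ℕ → Seq) (n : ℕ)
  (step : ∀ k → suc (suc k) ℕ.< n → Pos (λ t → (f (suc (suc k)) t - f (suc k) t) - (f (suc k) t - f k t))) where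

  Δ-increasing : ∀ k d → suc (suc (d ℕ.+ k)) ℕ.< n →
    Pos (λ t → (f (suc (suc (d ℕ.+ k))) t - f (suc (d ℕ.+ k)) t) - (f (suc k) t - f k t))
  Δ-increasing k zero    k< = step k k<
  Δ-increasing k (suc d) k< = Pos-resp
    (λ t → solve 3 (λ a b c → (a :- b) :+ (b :- c) := a :- c) refl
      (f (suc (suc (suc d ℕ.+ k))) t - f (suc (suc d ℕ.+ k)) t)
      (f (suc (suc (d ℕ.+ k))) t - f (suc (d ℕ.+ k)) t) (f (suc k) t - f k t))
    (Pos-+ (step (suc d ℕ.+ k) k<) (Δ-increasing k d (ℕₚ.<⇒≤ k<)))

  -- A gap of e + 1 steps is a sum of consecutive differences, each smaller than the one d + 1
  -- places further on.
  gap-increasing : ∀ k d e → suc e ℕ.+ (suc d ℕ.+ k) ℕ.< n →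
    Pos (λ t → (f (suc e ℕ.+ (suc d ℕ.+ k)) t - f (suc d ℕ.+ k) t) - (f (suc e ℕ.+ k) t - f k t))
  gap-increasing k d zero    k< = Δ-increasing k d k<
  gap-increasing k d (suc e) k< = Pos-resp
    (λ t → solve 6 (λ a b c a′ b′ c′ → ((a :- b) :- (a′ :- b′)) :+ ((b :- c) :- (b′ :- c′))
                := (a :- c) :- (a′ :- c′)) refl
      (f (suc (suc e) ℕ.+ (suc d ℕ.+ k)) t) (f (suc e ℕ.+ (suc d ℕ.+ k)) t) (f (suc d ℕ.+ k) t)
      (f (suc (suc e) ℕ.+ k) t) (f (suc e ℕ.+ k) t) (f k t))
    (Pos-+ far
           (gap-increasing k d e (ℕₚ.<⇒≤ k<)))
    where
    shuffle : suc e ℕ.+ (suc d ℕ.+ k) ≡ suc d ℕ.+ (suc e ℕ.+ k)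
    shuffle = trans (sym (ℕₚ.+-assoc (suc e) (suc d) k))
      (trans (cong (ℕ._+ k) (ℕₚ.+-comm (suc e) (suc d))) (ℕₚ.+-assoc (suc d) (suc e) k))
    far : Pos (λ t → (f (suc (suc e) ℕ.+ (suc d ℕ.+ k)) t - f (suc e ℕ.+ (suc d ℕ.+ k)) t)
                   - (f (suc (suc e) ℕ.+ k) t - f (suc e ℕ.+ k) t))
    far = subst (λ j → Pos (λ t → (f (suc j) t - f j t) - (f (suc (suc e) ℕ.+ k) t - f (suc e ℕ.+ k) t)))
      (sym shuffle) (Δ-increasing (suc e ℕ.+ k) d (subst (λ j → suc j ℕ.< n) shuffle k<))

module _ (A : FiniteSet) where

  private
    n = size A
    a : Fin n → Seq
    a i = seq (elem A i)

  elem-increasing : ∀ {i j} → i Fin.< j → Pos (λ t → a j t - a i t)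
  elem-increasing {i} {j} i<j = <ᴿ⇒Pos (elem A i) (elem A j) (increasing A i<j)

  elem-injective : ∀ {i j} → Zero (λ t → a i t - a j t) → i ≡ j
  elem-injective {i} {j} eq with Finₚ.<-cmp i j
  ... | tri< i<j _ _ = ⊥-elim (Pos⇒¬Zero (elem-increasing i<j)
          (Zero-resp (λ t → solve 2 (λ x y → :- (x :- y) := y :- x) refl (a i t) (a j t)) (Zero-neg eq)))
  ... | tri≈ _ i≡j _ = i≡j
  ... | tri> _ _ j<i = ⊥-elim (Pos⇒¬Zero (elem-increasing j<i) eq)

  elem-reflects-< : ∀ {i j} → Pos (λ t → a j t - a i t) → i Fin.< j
  elem-reflects-< {i} {j} pos with Finₚ.<-cmp i j
  ... | tri< i<j _ _ = i<j
  ... | tri≈ _ refl _ = ⊥-elim (Pos⇒¬Zero (Pos-resp (λ t → ℚₚ.+-inverseʳ (a i t)) pos) Zero-0)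
  ... | tri> _ _ j<i = ⊥-elim (Pos-asym pos
          (Pos-resp (λ t → solve 2 (λ x y → x :- y := :- (y :- x)) refl (a i t) (a j t)) (elem-increasing j<i)))

  module _ (convex : Convex A) where

    private
      -- A extended by 0 beyond its last index, so that index arithmetic takes place in ℕ. The
      -- default is never compared, because `step` asks for k + 2 < n.
      f : ℕ → Seq
      f k with k ℕₚ.<? n
      ... | yes k<n = a (fromℕ< k<n)
      ... | no  _   = λ _ → 0ℚ

      f≡ : ∀ {k} (k<n : k ℕ.< n) → f k ≡ a (fromℕ< k<n)
      f≡ {k} k<n with k ℕₚ.<? n
      ... | yes _  = refl
      ... | no k≮n = ⊥-elim (k≮n k<n)

      f-toℕ : ∀ i → f (toℕ i) ≡ a i
      f-toℕ i = trans (f≡ (Finₚ.toℕ<n i)) (cong a (Finₚ.fromℕ<-toℕ i (Finₚ.toℕ<n i)))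

      step : ∀ k → suc (suc k) ℕ.< n → Pos (λ t → (f (suc (suc k)) t - f (suc k) t) - (f (suc k) t - f k t))
      step k k+2<n
        rewrite f≡ k+2<n | f≡ (ℕₚ.<⇒≤ k+2<n) | f≡ (ℕₚ.<⇒≤ (ℕₚ.<⇒≤ k+2<n)) =
        <ᴿ⇒Pos (elem A j -ᴿ elem A i) (elem A l -ᴿ elem A j) (convex i j l
          (trans (Finₚ.toℕ-fromℕ< _) (cong suc (sym (Finₚ.toℕ-fromℕ< _))))
          (trans (Finₚ.toℕ-fromℕ< _) (cong suc (sym (Finₚ.toℕ-fromℕ< _)))))
        where
        i = fromℕ< (ℕₚ.<⇒≤ (ℕₚ.<⇒≤ k+2<n))
        j = fromℕ< (ℕₚ.<⇒≤ k+2<n)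
        l = fromℕ< k+2<n

      open Gaps f n step

    gap-< : ∀ {i j i′ j′} → i Fin.< j → i′ Fin.< j′ → toℕ j ℕ.∸ toℕ i ≡ toℕ j′ ℕ.∸ toℕ i′ → i Fin.< i′ →
      Pos (λ t → (a j′ t - a i′ t) - (a j t - a i t))
    gap-< {i} {j} {i′} {j′} i<j i′<j′ gap≡ i<i′ =
      Pos-resp (λ t → cong₂ _-_ (cong₂ _-_ (at j′≡ t) (at i′≡ t)) (cong₂ _-_ (at j≡ t) (cong (λ g → g t) (f-toℕ i))))
        (gap-increasing (toℕ i) d e (subst (ℕ._< n) (sym (trans (cong (suc e ℕ.+_) i′≡) j′≡′)) (Finₚ.toℕ<n j′)))
      where
      d e : ℕ
      d = toℕ i′ ℕ.∸ suc (toℕ i)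
      e = toℕ j ℕ.∸ suc (toℕ i)
      suc-∸ : ∀ {x y} → x ℕ.< y → suc (y ℕ.∸ suc x) ≡ y ℕ.∸ x
      suc-∸ {x} {y} x<y = sym (ℕₚ.+-∸-assoc 1 x<y)
      i′≡ : suc d ℕ.+ toℕ i ≡ toℕ i′
      i′≡ = trans (cong (ℕ._+ toℕ i) (suc-∸ i<i′)) (ℕₚ.m∸n+n≡m (ℕₚ.<⇒≤ i<i′))
      j≡ : suc e ℕ.+ toℕ i ≡ toℕ j
      j≡ = trans (cong (ℕ._+ toℕ i) (suc-∸ i<j)) (ℕₚ.m∸n+n≡m (ℕₚ.<⇒≤ i<j))
      j′≡′ : suc e ℕ.+ toℕ i′ ≡ toℕ j′
      j′≡′ = trans (cong (ℕ._+ toℕ i′) (trans (suc-∸ i<j) gap≡)) (ℕₚ.m∸n+n≡m (ℕₚ.<⇒≤ i′<j′))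
      j′≡ : suc e ℕ.+ (suc d ℕ.+ toℕ i) ≡ toℕ j′
      j′≡ = trans (cong (suc e ℕ.+_) i′≡) j′≡′
      at : ∀ {k l} → k ≡ toℕ l → ∀ t → f k t ≡ a l t
      at {k} {l} k≡l t = cong (λ g → g t) (trans (cong f k≡l) (f-toℕ l))

    gap-injective : ∀ {i j i′ j′} → i Fin.< j → i′ Fin.< j′ → toℕ j ℕ.∸ toℕ i ≡ toℕ j′ ℕ.∸ toℕ i′ →
      Zero (λ t → (a j t - a i t) - (a j′ t - a i′ t)) → i ≡ i′
    gap-injective {i} {j} {i′} {j′} i<j i′<j′ gap≡ eq with Finₚ.<-cmp i i′
    ... | tri< i<i′ _ _ = ⊥-elim (Pos⇒¬Zero (gap-< i<j i′<j′ gap≡ i<i′)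
            (Zero-resp (λ t → solve 2 (λ x y → :- (x :- y) := y :- x) refl (a j t - a i t) (a j′ t - a i′ t)) (Zero-neg eq)))
    ... | tri≈ _ i≡i′ _ = i≡i′
    ... | tri> _ _ i′<i = ⊥-elim (Pos⇒¬Zero (gap-< i′<j′ i<j (sym gap≡) i′<i) eq)

-- The difference set and the ranks of the values a_i - d_u

≈ᴿ-refl : ∀ x → x ≈ᴿ x
≈ᴿ-refl x = Zero-resp (λ n → sym (ℚₚ.+-inverseʳ (seq x n))) Zero-0

module Discrete (A D : FiniteSet) (convexA : Convex A) (isD : IsDifferenceSet D A) where

  n m : ℕ
  n = size A
  m = size D

  a : Fin n → Seq
  a i = seq (elem A i)

  d : Fin m → Seq
  d u = seq (elem D u)

  private
    index : ∀ i j → ∃[ u ] (elem A i -ᴿ elem A j) ≈ᴿ elem D u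
    index i j = Equivalence.from (isD (elem A i -ᴿ elem A j))
      (elem A i , elem A j , (i , ≈ᴿ-refl (elem A i)) , (j , ≈ᴿ-refl (elem A j)) , ≈ᴿ-refl (elem A i -ᴿ elem A j))

  s : Fin n → Fin n → Fin m
  s i j = proj₁ (index i j)

  s-spec : ∀ i j → Zero (λ t → (a i t - a j t) - d (s i j) t)
  s-spec i j = proj₂ (index i j)

  s≡⇒ : ∀ {i j i′ j′} → s i j ≡ s i′ j′ → Zero (λ t → (a i t - a j t) - (a i′ t - a j′ t))
  s≡⇒ {i} {j} {i′} {j′} eq = Zero-resp
    (λ t → trans (cong (λ u → ((a i t - a j t) - d (s i j) t) + - ((a i′ t - a j′ t) - d u t)) (sym eq))
      (solve 3 (λ x y z → (x :- z) :+ :- (y :- z) := x :- y) refl (a i t - a j t) (a i′ t - a j′ t) (d (s i j) t)))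
    (Zero-+ (s-spec i j) (Zero-neg (s-spec i′ j′)))

  ⇒s≡ : ∀ {i j i′ j′} → Zero (λ t → (a i t - a j t) - (a i′ t - a j′ t)) → s i j ≡ s i′ j′
  ⇒s≡ {i} {j} {i′} {j′} eq = elem-injective D (Zero-resp
    (λ t → solve 4 (λ x y u v → (x :- y) :+ (:- (x :- u) :+ (y :- v)) := u :- v) refl
      (a i t - a j t) (a i′ t - a j′ t) (d (s i j) t) (d (s i′ j′) t))
    (Zero-+ eq (Zero-+ (Zero-neg (s-spec i j)) (s-spec i′ j′))))

  transpose : ∀ {l j l′ j′} → s l j ≡ s l′ j′ → s l l′ ≡ s j j′
  transpose {l} {j} {l′} {j′} eq = ⇒s≡ (Zero-resp
    (λ t → solve 4 (λ l j l′ j′ → (l :- j) :- (l′ :- j′) := (l :- l′) :- (j :- j′)) refl (a l t) (a j t) (a l′ t) (a j′ t))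
    (s≡⇒ eq))

  -- As D is listed in increasing order, the index of a difference in D already serves as its rank,
  -- and no comparison of reals has to be decided.
  inc₁ : Incidence (λ i j → toℕ (s i j)) m
  inc₁ = record
    { bounded   = λ i k → Finₚ.toℕ<n (s i k)
    ; monotone  = λ {i} {j} k i<j → elem-reflects-< D (Pos-resp
        (λ t → solve 5 (λ x y z u v → (y :- x) :+ (:- ((y :- z) :- v) :+ ((x :- z) :- u)) := v :- u) refl
          (a i t) (a j t) (a k t) (d (s i k) t) (d (s j k) t))
        (Pos-+-Zero (elem-increasing A i<j) (Zero-+ (Zero-neg (s-spec j k)) (s-spec i k))))
    ; injective = λ i {k} {k′} eq → elem-injective A (Zero-resp
        (λ t → solve 3 (λ x y z → :- ((x :- y) :- (x :- z)) := y :- z) refl (a i t) (a k t) (a k′ t))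
        (Zero-neg (s≡⇒ (Finₚ.toℕ-injective eq))))
    ; convex    = λ {i} {j} {i′} {j′} {k} {k′} i<j i′<j′ gap≡ eqᵢ eqⱼ → gap-injective A convexA i<j i′<j′ gap≡ (Zero-resp
        (λ t → solve 6 (λ i j i′ j′ k k′ → ((j :- k) :- (j′ :- k′)) :+ :- ((i :- k) :- (i′ :- k′)) := (j :- i) :- (j′ :- i′)) refl
          (a i t) (a j t) (a i′ t) (a j′ t) (a k t) (a k′ t))
        (Zero-+ (s≡⇒ (Finₚ.toℕ-injective eqⱼ)) (Zero-neg (s≡⇒ (Finₚ.toℕ-injective eqᵢ)))))
    }

  V : Fin n × Fin m → ℝ
  V (i , u) = elem A i -ᴿ elem D u

  _≺_ : Fin n × Fin m → Fin n × Fin m → Set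
  p ≺ q = Pos (λ t → seq (V q) t - seq (V p) t)

  module Rank (_≺?_ : ∀ p q → Dec (p ≺ q)) where

    P : List (Fin n × Fin m)
    P = cartesianProduct (allFin n) (allFin m)

    -- Only strictly smaller values are counted, so pairs with equal values share a rank, which
    -- thereby names the value.
    rank : Fin n × Fin m → ℕ
    rank p = ∑ P (λ q → 𝟙 (q ≺? p))

    rank≤ : ∀ p → rank p ℕ.≤ length P
    rank≤ p = ℕₚ.≤-trans (∑-mono P (λ q → 𝟙≤1 (q ≺? p))) (ℕₚ.≤-reflexive (trans (∑-const P 1) (ℕₚ.*-identityʳ _)))

    ≺-trans : ∀ {p q r} → p ≺ q → q ≺ r → p ≺ r
    ≺-trans {p} {q} {r} p≺q q≺r = Pos-resp
      (λ t → solve 3 (λ x y z → (y :- x) :+ (z :- y) := z :- x) refl (seq (V p) t) (seq (V q) t) (seq (V r) t))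
      (Pos-+ p≺q q≺r)

    ≺-irrefl : ∀ {p} → ¬ p ≺ p
    ≺-irrefl {p} p≺p = Pos⇒¬Zero p≺p (≈ᴿ-refl (V p))

    rank-< : ∀ {p q} → p ≺ q → rank p ℕ.< rank q
    rank-< {p} {q} p≺q = ∑-mono-< (λ z → 𝟙-mono (z ≺? p) (z ≺? q) (λ z≺p → ≺-trans {z} {p} {q} z≺p p≺q))
      (Mem.∈-cartesianProduct⁺ (Mem.∈-allFin (proj₁ p)) (Mem.∈-allFin (proj₂ p)))
      (𝟙-mono-< (p ≺? p) (p ≺? q) (≺-irrefl {p}) p≺q)

    ≈⇒rank≤ : ∀ {p q} → V p ≈ᴿ V q → rank p ℕ.≤ rank q
    ≈⇒rank≤ {p} {q} p≈q = ∑-mono P (λ z → 𝟙-mono (z ≺? p) (z ≺? q) (λ z≺p → Pos-resp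
      (λ t → solve 3 (λ x y z → (y :- x) :+ :- (y :- z) := z :- x) refl (seq (V z) t) (seq (V p) t) (seq (V q) t))
      (Pos-+-Zero z≺p (Zero-neg p≈q))))

    ≈-sym : ∀ {p q} → V p ≈ᴿ V q → V q ≈ᴿ V p
    ≈-sym {p} {q} p≈q = Zero-resp (λ t → solve 2 (λ x y → :- (x :- y) := y :- x) refl (seq (V p) t) (seq (V q) t)) (Zero-neg p≈q)

    ≈⇒rank≡ : ∀ {p q} → V p ≈ᴿ V q → rank p ≡ rank q
    ≈⇒rank≡ {p} {q} p≈q = ℕₚ.≤-antisym (≈⇒rank≤ {p} {q} p≈q) (≈⇒rank≤ {q} {p} (≈-sym {p} {q} p≈q))

    -- Equal ranks exclude both strict comparisons; `trichotomy` leaves equality.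
    rank≡⇒≈ : ∀ {p q} → rank p ≡ rank q → V p ≈ᴿ V q
    rank≡⇒≈ {p} {q} eq = trichotomy (cauchy (V p -ᴿ V q))
      (λ q≺p → ℕₚ.<⇒≢ (rank-< {q} {p} q≺p) (sym eq))
      (λ pos → ℕₚ.<⇒≢ (rank-< {p} {q} (Pos-resp
        (λ t → solve 2 (λ x y → :- (x :- y) := y :- x) refl (seq (V p) t) (seq (V q) t)) pos)) eq)

    ρ : Fin n → Fin m → ℕ
    ρ i u = rank (i , u)

    inc₂ : Incidence ρ (suc (length P))
    inc₂ = record
      { bounded   = λ i u → s≤s (rank≤ (i , u))
      ; monotone  = λ {i} {j} u i<j → rank-< {i , u} {j , u} (Pos-resp
          (λ t → solve 3 (λ x y z → y :- x := (y :- z) :- (x :- z)) refl (a i t) (a j t) (d u t))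
          (elem-increasing A i<j))
      ; injective = λ i {u} {v} eq → elem-injective D (Zero-resp
          (λ t → solve 3 (λ x u v → :- ((x :- u) :- (x :- v)) := u :- v) refl (a i t) (d u t) (d v t))
          (Zero-neg (rank≡⇒≈ {i , u} {i , v} eq)))
      ; convex    = λ {i} {j} {i′} {j′} {u} {v} i<j i′<j′ gap≡ eqᵢ eqⱼ → gap-injective A convexA i<j i′<j′ gap≡ (Zero-resp
          (λ t → solve 6 (λ i j i′ j′ k k′ → ((j :- k) :- (j′ :- k′)) :+ :- ((i :- k) :- (i′ :- k′)) := (j :- i) :- (j′ :- i′)) refl
            (a i t) (a j t) (a i′ t) (a j′ t) (d u t) (d v t))
          (Zero-+ (rank≡⇒≈ {j , u} {j′ , v} eqⱼ) (Zero-neg (rank≡⇒≈ {i , u} {i′ , v} eqᵢ))))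
      }

    -- The equation a_i′ - a_j′ = a_i - a_j rearranges to a_j′ - (a_l - a_i) = a_i′ - (a_l - a_j).
    shift : ∀ l {i j i′ j′} → s i′ j′ ≡ s i j → ρ j′ (s l i) ≡ ρ i′ (s l j)
    shift l {i} {j} {i′} {j′} eq = ≈⇒rank≡ {j′ , s l i} {i′ , s l j} (Zero-resp
      (λ t → solve 7 (λ i j i′ j′ l u v → :- ((i′ :- j′) :- (i :- j)) :+ (((l :- i) :- u) :+ :- ((l :- j) :- v))
                := (j′ :- u) :- (i′ :- v)) refl
        (a i t) (a j t) (a i′ t) (a j′ t) (a l t) (d (s l i) t) (d (s l j) t))
      (Zero-+ (Zero-neg (s≡⇒ eq)) (Zero-+ (s-spec l i) (Zero-neg (s-spec l j)))))

  ¬¬-all : ∀ k {Q : Fin k → Set} → (∀ i → ¬ ¬ Q i) → ¬ ¬ (∀ i → Q i)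
  ¬¬-all zero    ¬¬Q ¬all = ¬all (λ ())
  ¬¬-all (suc k) ¬¬Q ¬all = ¬¬Q Fin.zero λ q₀ → ¬¬-all k (λ i → ¬¬Q (Fin.suc i)) λ q →
    ¬all λ { Fin.zero → q₀ ; (Fin.suc i) → q i }

  -- Excluded middle holds doubly negated for each comparison, and double negation passes through
  -- finite universal quantifiers.
  ¬¬-≺? : ¬ ¬ (∀ p q → Dec (p ≺ q))
  ¬¬-≺? k = ¬¬-all n (λ i → ¬¬-all m (λ u → ¬¬-all n (λ j → ¬¬-all m (λ v ¬dec →
    ¬dec (no (λ i,u≺j,v → ¬dec (yes i,u≺j,v))))))) (λ dec → k (λ (i , u) (j , v) → dec i u j v))

  n⁸≤m⁵ : 0 ℕ.< n → 0 ℕ.< m → ∀ L → n ℕ.< 2 ℕ.^ L → ¬ ¬ (n ℕ.^ 8 ℕ.≤ 2 ℕ.^ 33 ℕ.* (L ℕ.^ 3 ℕ.* m ℕ.^ 5))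
  n⁸≤m⁵ 0<n 0<m L n<2^L ¬bound = ¬¬-≺? λ _≺?_ → let open Rank _≺?_ in
    ¬bound (SchoenShkredov.n⁸≤ 0<n 0<m s ρ inc₁ inc₂ transpose shift L n<2^L)

  difference-set-nonempty : 0 ℕ.< n → 0 ℕ.< m
  difference-set-nonempty 0<n = ℕₚ.≤-<-trans z≤n (Finₚ.toℕ<n (s (fromℕ< 0<n) (fromℕ< 0<n)))

-- The final estimate

open import Data.Integer.Base using (+_)
open import Data.Nat.Base using () renaming (_≤_ to _≤ℕ_)

-- Rounds log₂ n down to a power of two, at the cost of a factor 2, so that the exponent 2ᴺ splits
-- evenly in `log-lower`.
double-exponential-scale : ∀ {n} → 2 ℕ.≤ n →
  ∃[ s ] (2 ℕ.^ (2 ℕ.^ s) ℕ.≤ n) × (n ℕ.< 2 ℕ.^ (2 ℕ.^ suc s))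
double-exponential-scale {n} 2≤n = descend (suc n)
  (ℕₚ.≤-trans (n≤2^n (suc n)) (n≤2^n (2 ℕ.^ suc n)))
  where
  descend : ∀ s → n ℕ.< 2 ℕ.^ (2 ℕ.^ s) → ∃[ s ] (2 ℕ.^ (2 ℕ.^ s) ℕ.≤ n) × (n ℕ.< 2 ℕ.^ (2 ℕ.^ suc s))
  descend zero    n<2 = ⊥-elim (ℕₚ.<⇒≱ n<2 2≤n)
  descend (suc s) n<  with 2 ℕ.^ (2 ℕ.^ s) ℕₚ.≤? n
  ... | yes ≤n = s , ≤n , n<
  ... | no ≰n  = descend s (ℕₚ.≰⇒> ≰n)

mesh≤½ : ∀ {x} → 0ℚ < x → ∃[ N₀ ] ∀ N → N₀ ℕ.≤ N → h N * (x - 1ℚ) ≤ ½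
mesh≤½ {x} 0<x with archimedean (0<* 0<½ (0<inv 0<x))
... | N₀ , hN₀≤ = N₀ , λ N N₀≤N → begin
  h N * (x - 1ℚ)      ≤⟨ *-monoˡ (0≤h N) (p-q≤p {x} 0≤1) ⟩
  h N * x             ≤⟨ *-monoʳ (<⇒≤ 0<x) (≤-trans (h-anti N₀≤N) hN₀≤) ⟩
  ½ * inv x * x       ≡⟨ solve 2 (λ i x → con ½ :* i :* x := con ½ :* (x :* i)) refl (inv x) x ⟩
  ½ * (x * inv x)     ≡⟨ cong (½ *_) (inv-inverse 0<x) ⟩
  ½ * 1ℚ              ≡⟨ ℚₚ.*-identityʳ ½ ⟩
  ½                   ∎

-- ν, D, y and z are the N-th terms of the sequences representing n, m, n^(8/5) and (log n)^1.
module _ {n m s : ℕ} {c : ℚ} {K : ℕ} (0<n : 0 ℕ.< n) (0<m : 0 ℕ.< m) (0≤c : 0ℚ ≤ c)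
  (c⁵K≤½ : c ^ 5 * (ι (2 ℕ.^ 21) * ι K) ≤ ½)
  (scale : 2 ℕ.^ (2 ℕ.^ s) ℕ.≤ n) (n⁸≤ : n ℕ.^ 8 ℕ.≤ K ℕ.* ((2 ℕ.^ suc s) ℕ.^ 3 ℕ.* m ℕ.^ 5))
  (N : ℕ) (s≤N : s ℕ.≤ N) (mesh≤ : h N * (ι n - 1ℚ) ≤ ½) where

  private
    ν D Λ ℓ y z : ℚ
    ν = ι n
    D = ι m
    Λ = ι (2 ℕ.^ s)
    ℓ = logₙ N ν
    y = expₙ N ((+ 8 / 5) * ℓ)
    z = expₙ N (1ℚ * logₙ N ℓ)
    0<ι : ∀ {k} → 0 ℕ.< k → 0ℚ < ι k
    0<ι 0<k = ℚₚ.<-≤-trans 0<1 (ι-mono 0<k)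
    1≤ν : 1ℚ ≤ ν
    1≤ν = ι-mono 0<n
    1≤Λ : 1ℚ ≤ Λ
    1≤Λ = ι-mono (ℕₚ.m^n>0 2 s)
    Λ/4≤ℓ : Λ * (½ * ½) ≤ ℓ
    Λ/4≤ℓ = log-lower N s s≤N (ι-mono scale)
    0<ℓ : 0ℚ < ℓ
    0<ℓ = ℚₚ.<-≤-trans (0<* (ℚₚ.<-≤-trans 0<1 1≤Λ) (0<* 0<½ 0<½)) Λ/4≤ℓ
    -- Only this half of exp (log ℓ) = ℓ is needed, as `z` stands in the denominator.
    ℓ≤z : ℓ ≤ z
    ℓ≤z = subst (λ t → ℓ ≤ expₙ N t) (sym (ℚₚ.*-identityˡ (logₙ N ℓ))) (Nodes.p≤exp-log N 0<ℓ)
    0<z : 0ℚ < z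
    0<z = ℚₚ.<-≤-trans 0<ℓ ℓ≤z
    0≤y : 0ℚ ≤ y
    0≤y = 0≤^ (2 ℕ.^ N) (0≤+ 0≤1 (0≤* (0≤* (ℚₚ.nonNegative⁻¹ (+ 8 / 5)) (<⇒≤ 0<ℓ)) (0≤h N)))

  stage-bound : ¬ (D ≤ c * y * inv z)
  stage-bound D≤ = incompatible {D} {Λ} {y} {ν} {ι K} {c} (0<ι 0<m) 1≤Λ 0≤y 0≤c DΛ≤ (exp-8/5-log⁵≤ N 1≤ν mesh≤) ν⁸≤ c⁵K≤½
    where
    DΛ≤ : D * (Λ * (½ * ½)) ≤ c * y
    DΛ≤ = begin
      D * (Λ * (½ * ½))      ≤⟨ *-monoˡ (0≤ι m) (≤-trans Λ/4≤ℓ ℓ≤z) ⟩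
      D * z                  ≤⟨ *-monoʳ (<⇒≤ 0<z) D≤ ⟩
      c * y * inv z * z   ≡⟨ solve 3 (λ a i z → a :* i :* z := a :* (z :* i)) refl (c * y) (inv z) z ⟩
      c * y * (z * inv z) ≡⟨ cong (c * y *_) (inv-inverse 0<z) ⟩
      c * y * 1ℚ          ≡⟨ ℚₚ.*-identityʳ (c * y) ⟩
      c * y               ∎
    ν⁸≤ : ν ^ 8 ≤ ι K * ((ι 2 * Λ) ^ 3 * D ^ 5)
    ν⁸≤ = begin
      ν ^ 8                                             ≡⟨ ι-^ n 8 ⟨
      ι (n ℕ.^ 8)                                       ≤⟨ ι-mono n⁸≤ ⟩
      ι (K ℕ.* ((2 ℕ.^ suc s) ℕ.^ 3 ℕ.* m ℕ.^ 5))       ≡⟨ ι-* K _ ⟩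
      ι K * ι ((2 ℕ.^ suc s) ℕ.^ 3 ℕ.* m ℕ.^ 5)
        ≡⟨ cong (ι K *_) (trans (ι-* ((2 ℕ.^ suc s) ℕ.^ 3) (m ℕ.^ 5))
             (cong₂ _*_ (trans (ι-^ (2 ℕ.^ suc s) 3) (cong (_^ 3) (ι-* 2 (2 ℕ.^ s)))) (ι-^ m 5))) ⟩
      ι K * ((ι 2 * Λ) ^ 3 * D ^ 5)                     ∎

theorem5 : ∃[ c ] ∃[ C ] (0ᴿ <ᴿ c) × (0ᴿ ≤ᴿ C) ×
    ((A : FiniteSet) → Convex A → (2≤∣A∣ : 2 ≤ℕ size A) →
     (A-A : FiniteSet) → IsDifferenceSet A-A A →
     let n = fromℕ (size A)
         0<n = 0<fromℕ 2≤∣A∣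
         log-n = log n 0<n
         0<log-n = log-positive n 0<n (1<fromℕ 2≤∣A∣)
     in c *ᴿ power n 0<n (fromℚ (+ 8 / 5)) /ᴿ power log-n 0<log-n C [ power-positive log-n 0<log-n C ]
          ≤ᴿ fromℕ (size A-A))
theorem5 = fromℚ (h 11) , 1ᴿ
  , (h 11 , 0<h 11 , 0 , λ _ _ → ≤-reflexive (ℚₚ.+-identityˡ (h 11)))
  , (λ (ε , 0<ε , N , 1+ε≤0) → ℚₚ.<-irrefl refl (ℚₚ.<-≤-trans (0<+ 0<1 (<⇒≤ 0<ε)) (1+ε≤0 N ℕₚ.≤-refl)))
  , λ A convexA 2≤n A-A isD (ε , 0<ε , N₁ , m+ε≤) →
      let open Discrete A A-A convexA isD using (n; m; n⁸≤m⁵; difference-set-nonempty)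
          0<n = ℕₚ.<-≤-trans (s≤s z≤n) 2≤n
          0<m = difference-set-nonempty 0<n
          s , n≥ , n< = double-exponential-scale 2≤n
          N₂ , mesh≤ = mesh≤½ (ℚₚ.<-≤-trans 0<1 (ι-mono 0<n))
          -- Three thresholds: `N₁` from the negated goal, `s` for `log-lower`, `N₂` for a mesh of
          -- at most one half.
          N = N₁ ℕ.⊔ (s ℕ.⊔ N₂)
      -- The goal is now the empty type, so the doubly negated bound may be used.
      in n⁸≤m⁵ 0<n 0<m (2 ℕ.^ suc s) n< λ n⁸≤ →
        stage-bound {n} {m} {s} {h 11} {2 ℕ.^ 33} 0<n 0<m (0≤h 11) h-constant n≥ n⁸≤ N
          (ℕₚ.≤-trans (ℕₚ.m≤m⊔n s N₂) (ℕₚ.m≤n⊔m N₁ _))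
          (mesh≤ N (ℕₚ.≤-trans (ℕₚ.m≤n⊔m s N₂) (ℕₚ.m≤n⊔m N₁ _)))
          (≤-trans (p≤p+q (<⇒≤ 0<ε)) (m+ε≤ N (ℕₚ.m≤m⊔n N₁ _)))
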